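{- Let $U=U_1\times\cdots\times U_m$ be a Cartesian product of nonempty finite sets. For a set $S\subseteq U$, the following conditions are equivalent: (1) $S$ is ample; (2) $S$ is isometric and both $S^e$ and $S_e$ are ample for some elementary minor-subproduct $e$; (3) $S$ is connected and $S^e$ is ample for every elementary minor-subproduct $e$; (4) $S\cap[u,v]$ is ample in $[u,v]$ for all $u,v\in S$.
   Context: A generalized partition of a finite product $Z=Z_1\times\cdots\times Z_m$ of nonempty sets is a tuple $\Lambda=(\alpha_1,\dots,\alpha_m)$ with $\alpha_i$ a partition of $Z_i$ into nonempty blocks. It defines a partition of $Z$ into the boxes $P^1\times\cdots\times P^m$, $P^i\in\alpha_i$, and the minor-subproduct $M(\Lambda)=M_1\times\cdots\times M_m$, where $M_i$ is the set of blocks of $\alpha_i$; elements of $M(\Lambda)$ are identified with boxes. $M(\Lambda)$ is shattered by $S\subseteq Z$ if $S$ meets every box of the box-partition. A copy of $M(\Lambda)$ is a set $W_1\times\cdots\times W_m$ where $W_i$ consists of exactly one element from each block of $\alpha_i$. $M(\Lambda)$ is strongly shattered by $S$ if $S$ contains a copy of it. $S$ is ample in $Z$ if every minor-subproduct of $Z$ shattered by $S$ is strongly shattered by $S$. "Ample" for $S\subseteq U$ means ample in $U$. A minor-subproduct $e$ of $U$ is elementary if all blocks of all partitions $\alpha_i$ are singletons, except exactly one block of one partition, which has size 2. For $S\subseteq U$, $S_e$ (resp. $S^e$) is the set of elements of $e$ whose corresponding box meets $S$ (resp. is contained in $S$). Ampleness of $S^e$ and $S_e$ is meant in the product $e=M_1\times\cdots\times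 M_m$. The Hamming graph of $U$ has vertex set $U$, two tuples being adjacent iff they differ in exactly one coordinate; the distance is the number of differing coordinates. $S$ is connected if it induces a connected subgraph, and isometric if any $u,v\in S$ are joined by a path in $S$ of length equal to their Hamming distance (the empty set counts as connected and isometric). The interval is $[u,v]=\{u_1,v_1\}\times\cdots\times\{u_m,v_m\}$, itself regarded as a product.
   Formalization: The equivalence of (1) and (2) is stated only when some U_i has at least two elements: otherwise no elementary minor-subproduct exists, so (2) fails although S is ample. Membership in S is taken to be decidable, which is automatic classically. -}

module Defs where

open import Data.Fin.Base using (Fin)
import Data.Fin.Properties as Fin
open import Data.List.Base using (length; filter; allFin)
open import Data.Nat.Base using (ℕ; zero; suc)
open import Data.Product.Base using (Σ; ∃; ∃-syntax; _×_)
open import Data.Refinement using (Refinement; value)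
open import Data.Sum.Base using (_⊎_)
open import Function.Bundles using (_↔_)
open import Function.Properties.Inverse using (↔⇒↣)
open import Level using (0ℓ)
open import Relation.Binary.Definitions using (DecidableEquality)
open import Relation.Binary.PropositionalEquality.Core using (_≡_; _≢_)
open import Relation.Nullary.Decidable using (¬?; via-injection)
open import Relation.Unary using (Pred; _∈_; _⊆_)

private
  variable
    m : ℕ

Tuple : (Fin m → Set) → Set
Tuple Z = ∀ i → Z i

-- Without function extensionality, a set of tuples is a predicate that respects
-- this relation.
_≈_ : {Z : Fin m → Set} → Tuple Z → Tuple Z → Set
x ≈ y = ∀ i → x i ≡ y i

-- The blocks are labelled by Fin size: block b is { x | blockOf x ≡ b }.
-- Only finite sets A are used, so there are finitely many blocks.
record Partition (A : Set) : Set where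
  field
    size     : ℕ
    blockOf  : A → Fin size
    nonempty : ∀ b → ∃[ x ] blockOf x ≡ b

open Partition public

Block : {A : Set} (α : Partition A) → Fin (size α) → Pred A 0ℓ
Block α b x = blockOf α x ≡ b

GeneralizedPartition : (Fin m → Set) → Set
GeneralizedPartition Z = ∀ i → Partition (Z i)

-- M Λ i is the set M_i of blocks, so that Tuple (M Λ) is M(Λ).
M : {Z : Fin m → Set} → GeneralizedPartition Z → Fin m → Set
M Λ i = Fin (size (Λ i))

Box : {Z : Fin m → Set} (Λ : GeneralizedPartition Z) → Tuple (M Λ) → Pred (Tuple Z) 0ℓ
Box Λ P x = ∀ i → x i ∈ Block (Λ i) (P i)

Subproduct : {Z : Fin m → Set} → (∀ i → Pred (Z i) 0ℓ) → Pred (Tuple Z) 0ℓ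
Subproduct W x = ∀ i → x i ∈ W i

IsCopy : {Z : Fin m → Set} → GeneralizedPartition Z → (∀ i → Pred (Z i) 0ℓ) → Set
IsCopy {Z = Z} Λ W = ∀ i b → ∃[ x ] (x ∈ Block (Λ i) b × x ∈ W i
  × (∀ y → y ∈ Block (Λ i) b → y ∈ W i → y ≡ x))

Shattered : {Z : Fin m → Set} → Pred (Tuple Z) 0ℓ → GeneralizedPartition Z → Set
Shattered S Λ = ∀ P → ∃[ x ] (x ∈ Box Λ P × x ∈ S)

StronglyShattered : {Z : Fin m → Set} → Pred (Tuple Z) 0ℓ → GeneralizedPartition Z → Set₁
StronglyShattered {Z = Z} S Λ =
  Σ (∀ i → Pred (Z i) 0ℓ) λ W → IsCopy Λ W × Subproduct W ⊆ S

Ample : (Z : Fin m → Set) → Pred (Tuple Z) 0ℓ → Set₁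
Ample Z S = (Λ : GeneralizedPartition Z) → Shattered S Λ → StronglyShattered S Λ

HasSize : {A : Set} → Pred A 0ℓ → ℕ → Set
HasSize {A} B k = Σ A B ↔ Fin k

Elementary : {Z : Fin m → Set} → GeneralizedPartition Z → Set
Elementary {m} Λ = Σ (Fin m) λ i → Σ (Fin (size (Λ i))) λ b →
    HasSize (Block (Λ i) b) 2
  × (∀ c → c ≢ b → HasSize (Block (Λ i) c) 1)
  × (∀ j → j ≢ i → ∀ c → HasSize (Block (Λ j) c) 1)

-- lower S e is S_e and upper S e is S^e.
lower upper : {Z : Fin m → Set} → Pred (Tuple Z) 0ℓ →
              (e : GeneralizedPartition Z) → Pred (Tuple (M e)) 0ℓ
lower S e P = ∃[ x ] (x ∈ Box e P × x ∈ S)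
upper S e P = Box e P ⊆ S

Adjacent : {Z : Fin m → Set} → Tuple Z → Tuple Z → Set
Adjacent x y = ∃[ i ] (x i ≢ y i × (∀ j → j ≢ i → x j ≡ y j))

distance : {Z : Fin m → Set} → (∀ i → DecidableEquality (Z i)) → Tuple Z → Tuple Z → ℕ
distance {m} _≟_ x y = length (filter (λ i → ¬? (_≟_ i (x i) (y i))) (allFin m))

-- Path S k u v: a walk of length k from u to v in the Hamming graph, all of whose
-- vertices are in S.
data Path {Z : Fin m → Set} (S : Pred (Tuple Z) 0ℓ) : ℕ → Tuple Z → Tuple Z → Set where
  stop : ∀ {u v} → u ∈ S → u ≈ v → Path S zero u v
  step : ∀ {k u w v} → u ∈ S → Adjacent u w → Path S k w v → Path S (suc k) u v

Connected : {Z : Fin m → Set} → Pred (Tuple Z) 0ℓ → Set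
Connected S = ∀ u v → u ∈ S → v ∈ S → ∃[ k ] Path S k u v

Isometric : {Z : Fin m → Set} → (∀ i → DecidableEquality (Z i)) → Pred (Tuple Z) 0ℓ → Set
Isometric _≟_ S = ∀ u v → u ∈ S → v ∈ S → Path S (distance _≟_ u v) u v

-- The i-th factor is {u_i , v_i}.  The membership proof has to be irrelevant:
-- otherwise this factor would have two elements when u_i ≡ v_i.
Interval : {Z : Fin m → Set} → Tuple Z → Tuple Z → Fin m → Set
Interval {Z = Z} u v i = Refinement (Z i) λ x → x ≡ u i ⊎ x ≡ v i

-- S ∩ [u , v] as a subset of the product [u , v].
restrict : {Z : Fin m → Set} → Pred (Tuple Z) 0ℓ → (u v : Tuple Z) →
           Pred (Tuple (Interval u v)) 0ℓ
restrict S u v x = (λ i → value (x i)) ∈ S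

finite⇒≟ : {A : Set} {n : ℕ} → A ↔ Fin n → DecidableEquality A
finite⇒≟ A↔Fin = via-injection (↔⇒↣ A↔Fin) Fin._≟_

-- Ampleness passes from the product to its subproducts: given a partition of a
-- subproduct missing a point p, add p to some block; if the resulting copy uses p,
-- then the slice of S at p meets every box, so p may form a block of its own and the
-- new copy, without p, is the one wanted.  Similar changes of one block show that S^e
-- and S_e are ample when S is, and ampleness in intervals makes S isometric.
--
-- Conversely let e merge a and b, and let S be isometric with S^e ample.  If a product
-- of the other coordinates is covered by the slices S_a and S_b, then one of the two
-- covers it: otherwise some cube [x , y] would meet S^e in everything but the antipodes
-- x and y, which is not ample.  So copies in S_e lift to S.  Condition (3) is inherited
-- by S_e, hence (3) ⇒ (1) by merging points of equal blocks until the blocks are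
-- singletons.  For (2) ⇒ (1), partitions separating a from b are reduced to S^e and to
-- the subproducts without a or without b.  For (4) ⇒ (1), induct on the number of
-- points: (4) is inherited by S^e, the only delicate case being an interval times
-- three values all of whose proper subproducts are ample.
module Submission where

open import Defs
open import Data.Empty using (⊥; ⊥-elim)
open import Data.Fin.Base as Fin using (Fin; zero; suc)
import Data.Fin.Properties as Fin
open import Data.Irrelevant using ([_])
open import Data.List.Base
  using (List; []; _∷_; map; concat; allFin; length; filter; lookup; tabulate; deduplicate)
open import Data.List.Membership.Propositional using (find; lose) renaming (_∈_ to _∈ˡ_)
open import Data.List.Membership.Propositional.Properties
  using (∈-map⁺; ∈-map⁻; ∈-concat⁺′; ∈-allFin; ∈-lookup; ∈-deduplicate⁺; ∈-deduplicate⁻)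
import Data.List.Relation.Unary.All as All
open import Data.List.Relation.Unary.AllPairs using ([]; _∷_)
open import Data.List.Relation.Unary.Any as Any using (here; there)
open import Data.List.Relation.Unary.Any.Properties using (lookup-index)
import Data.List.Relation.Unary.Unique.DecPropositional.Properties as DecUnique
open import Data.List.Relation.Unary.Unique.Propositional using (Unique)
open import Data.Maybe.Base using (Maybe; just; nothing)
open import Data.Maybe.Properties using (just-injective) renaming (≡-dec to Maybe-≡-dec)
open import Data.Nat.Base using (ℕ; zero; suc; _+_; _≤_; _<_; z≤n; s≤s)
import Data.Nat.Properties as ℕ
open import Data.Product.Base using (Σ; ∃; ∃-syntax; _×_; _,_; proj₁; proj₂; map₂)
open import Data.Refinement using (value; _,_)
import Data.Refinement as Refinement
open import Data.Sum.Base as Sum using (_⊎_; inj₁; inj₂; [_,_]′)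
open import Data.Unit.Base using (⊤; tt)
import Data.Unit.Properties as Unit
open import Function.Base using (_∘_; id; const)
open import Function.Bundles using (_↔_; _⇔_; Inverse; mk↔ₛ′; mk⇔)
open import Level using (Level; 0ℓ)
open import Relation.Binary.Definitions using (DecidableEquality; _Respects_)
open import Relation.Binary.PropositionalEquality
  using (_≡_; _≢_; refl; sym; trans; cong; subst)
open import Relation.Nullary.Decidable
  using (Dec; yes; no; ¬?; _×-dec_; _⊎-dec_; _→-dec_; map′; decidable-stable; recompute)
open import Relation.Nullary.Negation.Core using (¬_; contradiction)
open import Relation.Unary using (Pred; Decidable; _∈_; _⊆_)

-- Minors and subproducts are never formed as new products. A subproduct is given by sets of points
-- of the factors of `U`, and the minor merging `a` with `b` is the subproduct without `b`, in which
-- `a` stands for the merged point and only the set changes (`up`, `lo`). Every induction thus stays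
-- inside one product, at the price of showing first that ampleness in `U` extends to all
-- partitioned subproducts (`AmpleIn`). Each argument alters one factor, while a copy consists of
-- choices in all of them; hence `Fibres` treats one factor with the other partitions frozen. The
-- recurrent obstacle is that two slices may each meet every box without one section filling both.
-- But a slice filled by some section does meet every box, so a first copy yields either what is
-- wanted or the hypothesis that makes a second partition shattered. As a hypothesis, isometricity
-- enters through `Switching` alone, which turns hits in two slices into a hit in their
-- intersection.

private
  variable
    ℓ : Level
    m : ℕ

-- Finite factors and labelled subsets of them.

record Finite (V : Set) : Set where
  field
    _≟_      : DecidableEquality V
    elements : List V
    complete : ∀ v → v ∈ˡ elements

  search : {P : Pred V 0ℓ} → Decidable P → Dec (∃ P)
  search P? = map′ (λ h → let (v , _ , p) = find h in v , p)
                   (λ (v , p) → lose (complete v) p)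
                   (Any.any? P? elements)

  merge : V → V → V → V
  merge p q v with v ≟ p
  ... | yes _ = q
  ... | no  _ = v

  merge-≡ : ∀ p q → merge p q p ≡ q
  merge-≡ p q with p ≟ p
  ... | yes _  = refl
  ... | no p≢p = contradiction refl p≢p

  merge-≢ : ∀ {p q v} → v ≢ p → merge p q v ≡ v
  merge-≢ {p} {v = v} v≢p with v ≟ p
  ... | yes v≡p = contradiction v≡p v≢p
  ... | no  _   = refl

  merge-elim : ∀ {p q} (P : V → V → Set) → P p q → (∀ v → v ≢ p → P v v) → ∀ v → P v (merge p q v)
  merge-elim {p} P pq vv v with v ≟ p
  ... | yes refl = pq
  ... | no v≢p   = vv v v≢p

-- Takes the place of `Partition` because points are removed and blocks merged all the time: with
-- labels of any type, and no condition that each label is taken, nothing has to be renumbered and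
-- no nonemptiness proved again.
record Labelling (V : Set) : Set₁ where
  constructor labelling
  field
    {Alive}  : Pred V 0ℓ
    alive?   : Decidable Alive
    {Label}  : Set
    _≟ᴸ_     : DecidableEquality Label
    label    : V → Label

open Labelling public

Same : {V : Set} → Labelling V → V → V → Set
Same C y x = Alive C x × label C x ≡ label C y

-- V is one factor of the product and F v the slice of S at v.  T stands for the boxes
-- in the product of the other factors, partitioned once and for all, and Sec for the
-- choices of one element from each of their blocks.
module Fibres
  {V : Set} (finite : Finite V)
  {X T Sec : Set} (Box : T → Pred X 0ℓ) (app : Sec → T → X)
  (app∈Box : ∀ s t → app s t ∈ Box t)
  where

  open Finite finite

  -- Ampleness seen from one factor.

  Family : Set₁
  Family = V → Pred X 0ℓ

  Shatters : Family → Labelling V → Set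
  Shatters F C = ∀ t c → Alive C c → ∃ λ v → Same C c v × ∃ λ x → x ∈ Box t × x ∈ F v

  _Fills_ : Sec → Pred X 0ℓ → Set
  s Fills G = ∀ t → app s t ∈ G

  -- `s` comes before `c` because a copy is a product set: the same choice in the other factors has
  -- to work for every block of `V`. That `σ` may vary within a block leaves room for pointwise
  -- changes of a copy.
  Copies : Family → Labelling V → Set
  Copies F C = Σ Sec λ s → Σ (V → V) λ σ →
    ∀ c → Alive C c → Same C c (σ c) × s Fills F (σ c)

  Good : Family → Pred V 0ℓ → Set₁
  Good F Y = ∀ C → (∀ v → Alive C v → Y v) → Shatters F C → Copies F C

  Good-cong : ∀ {F F′ Y Y′} → (∀ v → Y′ v → Y v) →
    (∀ v x → Y′ v → F v x → F′ v x) → (∀ v x → Y′ v → F′ v x → F v x) →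
    Good F Y → Good F′ Y′
  Good-cong Y′⊆Y to from good C C⊆Y′ sh =
    let s , σ , h = good C (λ v → Y′⊆Y v ∘ C⊆Y′ v) λ t c al →
          let v , same , x , x∈B , x∈F = sh t c al
          in v , same , x , x∈B , from v x (C⊆Y′ v (proj₁ same)) x∈F
    in s , σ , λ c al → let same , fills = h c al
                        in same , λ t → to _ _ (C⊆Y′ _ (proj₁ same)) (fills t)

  _∖_ : Pred V 0ℓ → V → Pred V 0ℓ
  (Y ∖ b) v = Y v × v ≢ b

  Meets : Pred X 0ℓ → Set
  Meets G = ∀ t → ∃ λ x → x ∈ Box t × x ∈ G

  fills⇒meets : ∀ {G} s → s Fills G → Meets G
  fills⇒meets s fills t = app s t , app∈Box s t , fills t

  -- Changing a single block.

  isolated : (C : Labelling V) → V → V → Maybe (Label C)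
  isolated C p v with v ≟ p
  ... | yes _ = nothing
  ... | no  _ = just (label C v)

  isolate : (C : Labelling V) (p : V) {Y : Pred V 0ℓ} → Decidable Y → Labelling V
  isolate C p Y? = labelling Y? (Maybe-≡-dec (_≟ᴸ_ C)) (isolated C p)

  isolated-≡ : ∀ C p {v} → isolated C p v ≡ isolated C p p → v ≡ p
  isolated-≡ C p {v} eq with v ≟ p | p ≟ p
  ... | yes v≡p | _      = v≡p
  ... | no _    | no p≢p = contradiction refl p≢p
  isolated-≡ C p {v} () | no _ | yes _

  isolated-≢ : ∀ C p {v c} → c ≢ p → isolated C p v ≡ isolated C p c → v ≢ p × label C v ≡ label C c
  isolated-≢ C p {v} {c} c≢p eq with v ≟ p | c ≟ p
  ... | _      | yes c≡p = contradiction c≡p c≢p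
  ... | no v≢p | no _    = v≢p , just-injective eq
  isolated-≢ C p {v} {c} c≢p () | yes _ | no _

  isolated-cong : ∀ C p {v c} → v ≢ p → c ≢ p → label C v ≡ label C c → isolated C p v ≡ isolated C p c
  isolated-cong C p {v} {c} v≢p c≢p eq with v ≟ p | c ≟ p
  ... | yes v≡p | _       = contradiction v≡p v≢p
  ... | no _    | yes c≡p = contradiction c≡p c≢p
  ... | no _    | no _    = cong just eq

  -- `p` joins the block of `q`. Labels are defined on dead points too, so the label that `C` gives
  -- to a dead `p` means nothing and is overridden by that of `q`.
  enlarge : Labelling V → V → V → Labelling V
  enlarge C p q =
    labelling {Alive = λ v → Alive C v ⊎ v ≡ p} (λ v → alive? C v ⊎-dec (v ≟ p))
              (_≟ᴸ_ C) (label C ∘ merge p q)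

  Alive-merge : ∀ C {p q} → Alive C q → ∀ v → Alive (enlarge C p q) v → Alive C (merge p q v)
  Alive-merge C q-alive = merge-elim (λ v w → Alive C v ⊎ v ≡ _ → Alive C w) (λ _ → q-alive)
    λ { v v≢p (inj₁ al) → al ; v v≢p (inj₂ v≡p) → contradiction v≡p v≢p }

  Same-enlarge⁺ : ∀ C {p q c v} → v ≢ p → Same C (merge p q c) v → Same (enlarge C p q) c v
  Same-enlarge⁺ C v≢p (al , eq) = inj₁ al , trans (cong (label C) (merge-≢ v≢p)) eq

  Same-enlarge-new : ∀ C {p q c} → Same C (merge p q c) q → Same (enlarge C p q) c p
  Same-enlarge-new C (_ , eq) = inj₂ refl , trans (cong (label C) (merge-≡ _ _)) eq

  Same-enlarge⁻ : ∀ C {p q c v} → Alive C q → c ≢ p → Same (enlarge C p q) c v → Same C c (merge p q v)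
  Same-enlarge⁻ C q-alive c≢p (al , eq) =
    Alive-merge C q-alive _ al , trans eq (cong (label C) (merge-≢ c≢p))

  adjoin : ∀ {F} C p → ¬ Alive C p → Sec →
    (∀ C′ → (∀ {v} → v ≢ p → (Alive C v → Alive C′ v) × (Alive C′ v → Alive C v)) →
      Alive C′ p → Shatters F C′ → Copies F C′) →
    Shatters F C → Copies F C
  adjoin {F} C p p-dead default enlarged sh with search (alive? C)
  -- Without alive points there is nothing to fill, yet a copy still contains a section of the other
  -- factors; `default` provides it.
  ... | no none = default , id , λ c al → contradiction (c , al) none
  ... | yes (q , q-alive) = conclude (search λ c → alive? C c ×-dec (σ₁ c ≟ p))
    where
    C₁ C₂ : Labelling V
    C₁ = enlarge C p q
    C₂ = isolate C p (alive? C₁)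

    off-p : ∀ {v} → v ≢ p → Alive C₁ v → Alive C v
    off-p v≢p (inj₁ al)  = al
    off-p v≢p (inj₂ v≡p) = contradiction v≡p v≢p

    alive⇒≢ : ∀ {v} → Alive C v → v ≢ p
    alive⇒≢ al refl = p-dead al

    copy₁ : Copies F C₁
    copy₁ = enlarged C₁ (λ v≢p → inj₁ , off-p v≢p) (inj₂ refl) λ t c al →
      let v , same , hit = sh t (merge p q c) (Alive-merge C q-alive c al)
      in v , Same-enlarge⁺ C (alive⇒≢ (proj₁ same)) same , hit

    s₁ = proj₁ copy₁
    σ₁ = proj₁ (proj₂ copy₁)
    h₁ = proj₂ (proj₂ copy₁)

    conclude : Dec (∃ λ c → Alive C c × σ₁ c ≡ p) → Copies F C
    conclude (no avoids) = s₁ , σ₁ , λ c al →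
      let same , fills = h₁ c (inj₁ al)
          σc≢p = λ σc≡p → avoids (c , al , σc≡p)
      in subst (Same C c) (merge-≢ σc≢p) (Same-enlarge⁻ C q-alive (alive⇒≢ al) same) , fills
    conclude (yes (c₀ , al₀ , σc₀≡p)) =
      let s , σ , h = enlarged C₂ (λ v≢p → inj₁ , off-p v≢p) (inj₂ refl) sh₂
      in s , σ , λ c al →
           let (al′ , eq) , fills = h c (inj₁ al)
               σc≢p , eq′ = isolated-≢ C p (alive⇒≢ al) eq
           in (off-p σc≢p al′ , eq′) , fills
      where
      sh₂ : Shatters F C₂
      sh₂ t c (inj₁ al) =
        let v , (v-alive , eq) , hit = sh t c al
        in v , (inj₁ v-alive , isolated-cong C p (alive⇒≢ v-alive) (alive⇒≢ al) eq) , hit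
      sh₂ t c (inj₂ refl) = p , (inj₂ refl , refl) ,
        fills⇒meets s₁ (subst (λ v → s₁ Fills F v) σc₀≡p (proj₂ (h₁ c₀ (inj₁ al₀)))) t

  -- The slices of S^e and S_e, where e merges a and b: the point {a , b} of e is
  -- represented by a, and b is to be left out.
  upᶠ loᶠ : Family → V → V → Family
  upᶠ F a b v x = F v x × (v ≡ a → F b x)
  loᶠ F a b v x = F v x ⊎ (v ≡ a × F b x)

  -- `upᶠ` differs from `F` only at `a`, so a copy in `F` that avoids `a` is already one. Otherwise
  -- the slice at `a` meets every box. With `b` alive in the place of `a` (`C₂`) there is again a
  -- copy: if it avoids `b` it is the one wanted, and if not, the slice at `b` meets every box too.
  -- Then the block of `a` can be replaced by two singletons `a` and `b` (`C₃`), and one section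
  -- fills both slices.
  Good-up : ∀ {F Y a b} → a ≢ b → Y b → Good F Y → Good (upᶠ F a b) (Y ∖ b)
  Good-up {F} {Y} {a} {b} a≢b b∈Y good C C⊆Y∖b sh with alive? C a
  ... | no a-dead =
    let s , σ , h = good C (λ v → proj₁ ∘ C⊆Y∖b v) λ t c al →
          let v , same , x , x∈B , x∈F , _ = sh t c al in v , same , x , x∈B , x∈F
    in s , σ , λ c al →
         let same , fills = h c al
         in same , λ t → fills t , λ σc≡a → contradiction (subst (Alive C) σc≡a (proj₁ same)) a-dead
  ... | yes a-alive = conclude₁ (search λ c → alive? C c ×-dec (σ₁ c ≟ a))
    where
    alive⇒≢b : ∀ {v} → Alive C v → v ≢ b
    alive⇒≢b al = proj₂ (C⊆Y∖b _ al)

    copy₁ : Copies F C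
    copy₁ = good C (λ v → proj₁ ∘ C⊆Y∖b v) λ t c al →
      let v , same , x , x∈B , x∈F , _ = sh t c al in v , same , x , x∈B , x∈F

    s₁ = proj₁ copy₁
    σ₁ = proj₁ (proj₂ copy₁)
    h₁ = proj₂ (proj₂ copy₁)

    Alive₂ : Pred V 0ℓ
    Alive₂ v = (Alive C v × v ≢ a) ⊎ v ≡ b

    C₂ : Labelling V
    C₂ = labelling {Alive = Alive₂} (λ v → (alive? C v ×-dec ¬? (v ≟ a)) ⊎-dec (v ≟ b))
                   (_≟ᴸ_ C) (label C ∘ merge b a)

    unmerge : ∀ v → Alive₂ v → Alive C (merge b a v)
    unmerge = merge-elim (λ v w → Alive₂ v → Alive C w) (λ _ → a-alive)
      λ { v v≢b (inj₁ (al , _)) → al ; v v≢b (inj₂ v≡b) → contradiction v≡b v≢b }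

    copy₂ : Copies F C₂
    copy₂ = good C₂ sub sh₂
      where
      sub : ∀ v → Alive₂ v → Y v
      sub v (inj₁ (al , _)) = proj₁ (C⊆Y∖b v al)
      sub v (inj₂ refl)     = b∈Y

      sh₂ : Shatters F C₂
      sh₂ t c al with sh t (merge b a c) (unmerge c al)
      ... | v , (v-alive , eq) , x , x∈B , x∈F , both with v ≟ a
      ...   | yes refl = b , (inj₂ refl , trans (cong (label C) (merge-≡ b a)) eq) , x , x∈B , both refl
      ...   | no v≢a   = v , (inj₁ (v-alive , v≢a) ,
                             trans (cong (label C) (merge-≢ (alive⇒≢b v-alive))) eq) , x , x∈B , x∈F

    s₂ = proj₁ copy₂
    σ₂ = proj₁ (proj₂ copy₂)
    h₂ = proj₂ (proj₂ copy₂)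

    Alive₃ : Pred V 0ℓ
    Alive₃ v = (Alive C v × label C v ≢ label C a) ⊎ (v ≡ a ⊎ v ≡ b)

    C₃ : Labelling V
    C₃ = isolate C b {Alive₃} λ v →
      (alive? C v ×-dec ¬? (_≟ᴸ_ C (label C v) (label C a))) ⊎-dec ((v ≟ a) ⊎-dec (v ≟ b))

    conclude₃ : Meets (F a) → Meets (F b) → Copies (upᶠ F a b) C
    conclude₃ meets-a meets-b = s₃ , σ , good-σ
      where
      copy₃ : Copies F C₃
      copy₃ = good C₃ sub sh₃
        where
        sub : ∀ v → Alive₃ v → Y v
        sub v (inj₁ (al , _))    = proj₁ (C⊆Y∖b v al)
        sub v (inj₂ (inj₁ refl)) = proj₁ (C⊆Y∖b a a-alive)
        sub v (inj₂ (inj₂ refl)) = b∈Y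

        sh₃ : Shatters F C₃
        sh₃ t c (inj₂ (inj₁ refl)) = a , (inj₂ (inj₁ refl) , refl) , meets-a t
        sh₃ t c (inj₂ (inj₂ refl)) = b , (inj₂ (inj₂ refl) , refl) , meets-b t
        sh₃ t c (inj₁ (al , c≁a)) =
          let v , (v-alive , eq) , x , x∈B , x∈F , _ = sh t c al
          in v , (inj₁ (v-alive , λ eq′ → c≁a (trans (sym eq) eq′)) ,
                  isolated-cong C b (alive⇒≢b v-alive) (alive⇒≢b al) eq) , x , x∈B , x∈F

      s₃ = proj₁ copy₃
      σ₃ = proj₁ (proj₂ copy₃)
      h₃ = proj₂ (proj₂ copy₃)

      σ₃a≡a : σ₃ a ≡ a
      σ₃a≡a with h₃ a (inj₂ (inj₁ refl))
      ... | (inj₁ (_ , ≁a) , eq) , _     = contradiction (proj₂ (isolated-≢ C b a≢b eq)) ≁a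
      ... | (inj₂ (inj₁ eq) , _) , _     = eq
      ... | (inj₂ (inj₂ eq) , iso) , _   = contradiction eq (proj₁ (isolated-≢ C b a≢b iso))

      σ₃b≡b : σ₃ b ≡ b
      σ₃b≡b = isolated-≡ C b (proj₂ (proj₁ (h₃ b (inj₂ (inj₂ refl)))))

      fills-a : s₃ Fills F a
      fills-a = subst (λ v → s₃ Fills F v) σ₃a≡a (proj₂ (h₃ a (inj₂ (inj₁ refl))))

      fills-b : s₃ Fills F b
      fills-b = subst (λ v → s₃ Fills F v) σ₃b≡b (proj₂ (h₃ b (inj₂ (inj₂ refl))))

      σ : V → V
      σ c with _≟ᴸ_ C (label C c) (label C a)
      ... | yes _ = a
      ... | no  _ = σ₃ c

      good-σ : ∀ c → Alive C c → Same C c (σ c) × s₃ Fills upᶠ F a b (σ c)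
      good-σ c al with _≟ᴸ_ C (label C c) (label C a)
      ... | yes c~a = (a-alive , sym c~a) , λ t → fills-a t , λ _ → fills-b t
      ... | no c≁a with h₃ c (inj₁ (al , c≁a))
      ...   | (al′ , iso) , fills with isolated-≢ C b (alive⇒≢b al) iso
      ...     | σc≢b , eq with al′
      ...       | inj₁ (σc-alive , ≁a) =
        (σc-alive , eq) , λ t → fills t , λ σc≡a → contradiction (cong (label C) σc≡a) ≁a
      ...       | inj₂ (inj₁ σc≡a) =
        contradiction (trans (sym eq) (cong (label C) σc≡a)) c≁a
      ...       | inj₂ (inj₂ σc≡b) = contradiction σc≡b σc≢b

    conclude₂ : Meets (F a) → Dec (∃ λ c → Alive₂ c × σ₂ c ≡ b) → Copies (upᶠ F a b) C
    conclude₂ meets-a (yes (c , al , σc≡b)) =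
      conclude₃ meets-a (fills⇒meets s₂ (subst (λ v → s₂ Fills F v) σc≡b (proj₂ (h₂ c al))))
    conclude₂ meets-a (no avoids) = s₂ , σ₂ ∘ merge a b , λ c al →
      let alive₂ = merge-elim (λ c c′ → Alive C c → Alive₂ c′) (λ _ → inj₂ refl)
                     (λ c c≢a al → inj₁ (al , c≢a)) c al
          (al′ , eq) , fills = h₂ (merge a b c) alive₂
          σc≢b = λ σc≡b → avoids (_ , alive₂ , σc≡b)
          σc-alive , σc≢a = [ id , (λ σc≡b → contradiction σc≡b σc≢b) ]′ al′
          back = merge-elim (λ c c′ → Alive C c → label C (merge b a c′) ≡ label C c)
                   (λ _ → cong (label C) (merge-≡ b a))
                   (λ c c≢a al → cong (label C) (merge-≢ (alive⇒≢b al))) c al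
      in (σc-alive , trans (sym (cong (label C) (merge-≢ σc≢b))) (trans eq back)) ,
         λ t → fills t , λ σc≡a → contradiction σc≡a σc≢a

    conclude₁ : Dec (∃ λ c → Alive C c × σ₁ c ≡ a) → Copies (upᶠ F a b) C
    conclude₁ (yes (c , al , σc≡a)) =
      conclude₂ (fills⇒meets s₁ (subst (λ v → s₁ Fills F v) σc≡a (proj₂ (h₁ c al))))
        (search λ c → ((alive? C c ×-dec ¬? (c ≟ a)) ⊎-dec (c ≟ b)) ×-dec (σ₂ c ≟ b))
    conclude₁ (no avoids) = s₁ , σ₁ , λ c al →
      let same , fills = h₁ c al
      in same , λ t → fills t , λ σc≡a → contradiction (c , al , σc≡a) avoids

  -- A labelling on the side of `Y′` is pulled back along `φ`, which may identify points; hits are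
  -- lifted through `φ`, and `ψ` only selects where the resulting copy is evaluated.
  Good-transport : ∀ {F F′ Y Y′} (φ ψ : V → V) →
    (∀ v → Y′ (φ v) → Y v) → (∀ v → Y′ v → φ (ψ v) ≡ v) →
    (∀ v x → Y v → F v x → F′ (φ v) x) →
    (∀ v x → Y′ v → F′ v x → ∃ λ w → φ w ≡ v × F w x) →
    Good F Y → Good F′ Y′
  Good-transport {F} {F′} {Y} {Y′} φ ψ φ⁻¹Y′⊆Y φψ push lift good C C⊆Y′ sh =
    let s , σ , h = good C₁ (λ v → φ⁻¹Y′⊆Y v ∘ C⊆Y′ (φ v)) sh₁
    in s , φ ∘ σ ∘ ψ , λ c al →
         let φψc≡c = φψ c (C⊆Y′ c al)
             (al′ , eq) , fills = h (ψ c) (subst (Alive C) (sym φψc≡c) al)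
         in (al′ , trans eq (cong (label C) φψc≡c)) ,
            λ t → push _ _ (φ⁻¹Y′⊆Y _ (C⊆Y′ _ al′)) (fills t)
    where
    C₁ : Labelling V
    C₁ = labelling (λ v → alive? C (φ v)) (_≟ᴸ_ C) (label C ∘ φ)

    sh₁ : Shatters F C₁
    sh₁ t c al with sh t (φ c) al
    ... | v , (v-alive , eq) , x , x∈B , x∈F′ with lift v x (C⊆Y′ v v-alive) x∈F′
    ...   | w , refl , x∈F = w , (v-alive , eq) , x , x∈B , x∈F

  -- `loᶠ F a b` is the image of `F` under `merge b a`, and off `b` the identity is a right inverse
  -- of this map.
  Good-lo : ∀ {F Y a b} → a ≢ b → Y b → Good F Y → Good (loᶠ F a b) (Y ∖ b)
  Good-lo {F} {Y} {a} {b} a≢b b∈Y = Good-transport (merge b a) id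
    (merge-elim (λ v w → (Y ∖ b) w → Y v) (λ _ → b∈Y) (λ _ _ → proj₁))
    (λ v (_ , v≢b) → merge-≢ v≢b)
    (λ v x _ → merge-elim (λ v w → F v x → loᶠ F a b w x)
      (λ x∈F → inj₂ (refl , x∈F)) (λ _ _ → inj₁) v)
    λ { v x (_ , v≢b) (inj₁ x∈F)          → v , merge-≢ v≢b , x∈F
      ; v x _         (inj₂ (refl , x∈F)) → b , merge-≡ b a , x∈F }

  -- Exchanging the names of the merged points.

  swap : V → V → V → V
  swap a b v with v ≟ a
  ... | yes _ = b
  ... | no  _ = merge b a v

  swap-≡ˡ : ∀ a b → swap a b a ≡ b
  swap-≡ˡ a b with a ≟ a
  ... | yes _  = refl
  ... | no a≢a = contradiction refl a≢a

  swap-≡ʳ : ∀ {a b} → a ≢ b → swap a b b ≡ a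
  swap-≡ʳ {a} {b} a≢b with b ≟ a
  ... | yes b≡a = contradiction (sym b≡a) a≢b
  ... | no  _   = merge-≡ b a

  swap-≢ : ∀ {a b v} → v ≢ a → v ≢ b → swap a b v ≡ v
  swap-≢ {a} {v = v} v≢a v≢b with v ≟ a
  ... | yes v≡a = contradiction v≡a v≢a
  ... | no  _   = merge-≢ v≢b

  data Position (a b : V) : V → Set where
    is-a  : Position a b a
    is-b  : Position a b b
    other : ∀ {v} → v ≢ a → v ≢ b → Position a b v

  position : ∀ a b v → Position a b v
  position a b v with v ≟ a | v ≟ b
  ... | yes refl | _        = is-a
  ... | no _     | yes refl = is-b
  ... | no v≢a   | no v≢b   = other v≢a v≢b

  -- The merged point may be represented by `b` instead of `a`, so that what is proved about `a` can
  -- be used for `b` as well.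
  Good-swap : ∀ {F F′ Y a b} → a ≢ b → Y a →
    (∀ {x} → F a x → F′ b x) → (∀ {x} → F′ b x → F a x) →
    (∀ {v x} → v ≢ a → v ≢ b → F v x → F′ v x) →
    (∀ {v x} → v ≢ a → v ≢ b → F′ v x → F v x) →
    Good F (Y ∖ b) → Good F′ (Y ∖ a)
  Good-swap {F} {F′} {Y} {a} {b} a≢b a∈Y to-b to-a to from =
    Good-transport (swap a b) (swap a b) sub invol push lift
    where
    sub : ∀ v → (Y ∖ a) (swap a b v) → (Y ∖ b) v
    sub v (v∈Y , v≢a) with position a b v
    ... | is-a      = a∈Y , a≢b
    ... | is-b      = contradiction (swap-≡ʳ a≢b) v≢a
    ... | other p q = subst Y (swap-≢ p q) v∈Y , q

    invol : ∀ v → (Y ∖ a) v → swap a b (swap a b v) ≡ v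
    invol v (_ , v≢a) with position a b v
    ... | is-a      = contradiction refl v≢a
    ... | is-b      = trans (cong (swap a b) (swap-≡ʳ a≢b)) (swap-≡ˡ a b)
    ... | other p q = trans (cong (swap a b) (swap-≢ p q)) (swap-≢ p q)

    push : ∀ v x → (Y ∖ b) v → F v x → F′ (swap a b v) x
    push v x (_ , v≢b) x∈F with position a b v
    ... | is-a      = subst (λ w → F′ w x) (sym (swap-≡ˡ a b)) (to-b x∈F)
    ... | is-b      = contradiction refl v≢b
    ... | other p q = subst (λ w → F′ w x) (sym (swap-≢ p q)) (to p q x∈F)

    lift : ∀ v x → (Y ∖ a) v → F′ v x → ∃ λ w → swap a b w ≡ v × F w x
    lift v x (_ , v≢a) x∈F′ with position a b v
    ... | is-a      = contradiction refl v≢a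
    ... | is-b      = a , swap-≡ˡ a b , to-a x∈F′
    ... | other p q = v , swap-≢ p q , from p q x∈F′

  Good-up-swap : ∀ {F Y a b} → a ≢ b → Y a → Good (upᶠ F a b) (Y ∖ b) → Good (upᶠ F b a) (Y ∖ a)
  Good-up-swap a≢b a∈Y = Good-swap a≢b a∈Y
    (λ (x∈a , x∈b) → x∈b refl , λ _ → x∈a) (λ (x∈b , x∈a) → x∈a refl , λ _ → x∈b)
    (λ _ v≢b (x∈v , _) → x∈v , λ v≡b → contradiction v≡b v≢b)
    (λ v≢a _ (x∈v , _) → x∈v , λ v≡a → contradiction v≡a v≢a)

  Good-lo-swap : ∀ {F Y a b} → a ≢ b → Y a → Good (loᶠ F a b) (Y ∖ b) → Good (loᶠ F b a) (Y ∖ a)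
  Good-lo-swap a≢b a∈Y = Good-swap a≢b a∈Y
    (λ { (inj₁ x∈a) → inj₂ (refl , x∈a) ; (inj₂ (_ , x∈b)) → inj₁ x∈b })
    (λ { (inj₁ x∈b) → inj₂ (refl , x∈b) ; (inj₂ (_ , x∈a)) → inj₁ x∈a })
    (λ { _ v≢b (inj₁ x∈v) → inj₁ x∈v ; v≢a _ (inj₂ (v≡a , _)) → contradiction v≡a v≢a })
    (λ { _ _ (inj₁ x∈v) → inj₁ x∈v ; _ v≢b (inj₂ (v≡b , _)) → contradiction v≡b v≢b })

  -- What isometricity says of one box: a geodesic from the slice at `v` to the slice at `w` passes
  -- from one to the other at some `x`, and `x` is in the box because boxes are products.
  Switches : Family → V → V → Set
  Switches F v w = ∀ t → (∃ λ x → x ∈ Box t × x ∈ F v) → (∃ λ x → x ∈ Box t × x ∈ F w) →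
    ∃ λ x → x ∈ Box t × x ∈ F v × x ∈ F w

  meets-filled : ∀ F C ((s , σ , h) : Copies F C) {c v} → Alive C c → σ c ≡ v → Meets (F v)
  meets-filled F C (s , σ , h) al σc≡v =
    fills⇒meets s (subst (λ v → s Fills F v) σc≡v (proj₂ (h _ al)))

  -- At `a` the target is the intersection of the slice at `y` with the union of those at `a` and
  -- `b`. Letting `b` join the block of `a` turns each hit in the union into one at `a` or at `b`.
  -- Of the two copies, in `upᶠ F a y` and in `upᶠ F b y`, the first serves unless it uses `b`, the
  -- second unless it uses `a`; if both fail, the slices at `a` and `b` each meet every box.
  Good-up-lo : ∀ {F Y a b y} → a ≢ b → a ≢ y → b ≢ y → Y a → Y b → Y y →
    Switches F a b → Good (upᶠ F a y) (Y ∖ y) → Good (upᶠ F b y) (Y ∖ y) → Good (upᶠ F a b) (Y ∖ b) →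
    Good (upᶠ (loᶠ F a b) a y) ((Y ∖ b) ∖ y)
  Good-up-lo {F} {Y} {a} {b} {y} a≢b a≢y b≢y a∈Y b∈Y y∈Y switch good-ay good-by good-ab C C⊆ sh
    with alive? C a
  ... | no a-dead =
    let s , σ , h = good-ay C (λ v al → let (v∈Y , _) , v≢y = C⊆ v al in v∈Y , v≢y) λ t c al →
          let v , same , x , x∈B , x∈lo , _ = sh t c al
              v≢a = λ v≡a → a-dead (subst (Alive C) v≡a (proj₁ same))
          in v , same , x , x∈B , [ id , (λ (v≡a , _) → contradiction v≡a v≢a) ]′ x∈lo ,
             λ v≡a → contradiction v≡a v≢a
    in s , σ , λ c al →
         let same , fills = h c al
         in same , λ t → inj₁ (proj₁ (fills t)) ,
              λ v≡a → contradiction (subst (Alive C) v≡a (proj₁ same)) a-dead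
  ... | yes a-alive =
    conclude₁ (search λ c → alive? C₁ c ×-dec (σ₁ c ≟ b))
    where
    Target : Family
    Target = upᶠ (loᶠ F a b) a y

    alive⇒≢b : ∀ {v} → Alive C v → v ≢ b
    alive⇒≢b al = proj₂ (proj₁ (C⊆ _ al))

    alive⇒≢y : ∀ {v} → Alive C v → v ≢ y
    alive⇒≢y al = proj₂ (C⊆ _ al)

    lo⇒F : ∀ {v x} → v ≢ a → loᶠ F a b v x → F v x
    lo⇒F v≢a (inj₁ x∈F)       = x∈F
    lo⇒F v≢a (inj₂ (v≡a , _)) = contradiction v≡a v≢a

    C₁ : Labelling V
    C₁ = enlarge C b a

    C₁⊆Y∖y : ∀ v → Alive C₁ v → (Y ∖ y) v
    C₁⊆Y∖y v (inj₁ al)   = proj₁ (proj₁ (C⊆ v al)) , alive⇒≢y al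
    C₁⊆Y∖y v (inj₂ refl) = b∈Y , b≢y

    copy₁ : Copies (upᶠ F a y) C₁
    copy₁ = good-ay C₁ C₁⊆Y∖y sh₁
      where
      sh₁ : Shatters (upᶠ F a y) C₁
      sh₁ t c al with sh t (merge b a c) (Alive-merge C a-alive c al)
      ... | v , same , x , x∈B , x∈lo , x∈y with v ≟ a
      ...   | no v≢a = v , Same-enlarge⁺ C (alive⇒≢b (proj₁ same)) same , x , x∈B ,
                       lo⇒F v≢a x∈lo , λ v≡a → contradiction v≡a v≢a
      ...   | yes refl with x∈lo
      ...     | inj₁ x∈a       = a , Same-enlarge⁺ C a≢b same , x , x∈B ,
                                 x∈a , λ _ → lo⇒F (a≢y ∘ sym) (x∈y refl)
      ...     | inj₂ (_ , x∈b) = b , Same-enlarge-new C same , x , x∈B ,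
                                 x∈b , λ b≡a → contradiction (sym b≡a) a≢b

    copy₂ : Copies (upᶠ F b y) C₁
    copy₂ = good-by C₁ C₁⊆Y∖y sh₂
      where
      sh₂ : Shatters (upᶠ F b y) C₁
      sh₂ t c al with sh t (merge b a c) (Alive-merge C a-alive c al)
      ... | v , same , x , x∈B , x∈lo , x∈y with v ≟ a
      ...   | no v≢a = v , Same-enlarge⁺ C (alive⇒≢b (proj₁ same)) same , x , x∈B ,
                       lo⇒F v≢a x∈lo , λ v≡b → contradiction v≡b (alive⇒≢b (proj₁ same))
      ...   | yes refl with x∈lo
      ...     | inj₁ x∈a       = a , Same-enlarge⁺ C a≢b same , x , x∈B ,
                                 x∈a , λ a≡b → contradiction a≡b a≢b
      ...     | inj₂ (_ , x∈b) = b , Same-enlarge-new C same , x , x∈B ,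
                                 x∈b , λ _ → lo⇒F (a≢y ∘ sym) (x∈y refl)

    s₁ = proj₁ copy₁
    σ₁ = proj₁ (proj₂ copy₁)
    h₁ = proj₂ (proj₂ copy₁)
    s₂ = proj₁ copy₂
    σ₂ = proj₁ (proj₂ copy₂)
    h₂ = proj₂ (proj₂ copy₂)

    -- The slices at a and b both meet every box, hence so does their intersection,
    -- which can now be given a block of its own while y takes over the block of a.
    conclude₃ : Meets (F a) → Meets (F b) → Copies Target C
    conclude₃ meets-a meets-b = s₃ , σ , good-σ
      where
      C₃ : Labelling V
      C₃ = isolate (enlarge C y a) a (alive? (enlarge C y a))

      copy₃ : Copies (upᶠ F a b) C₃
      copy₃ = good-ab C₃ sub sh₃
        where
        sub : ∀ v → Alive C₃ v → (Y ∖ b) v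
        sub v (inj₁ al)   = proj₁ (C⊆ v al)
        sub v (inj₂ refl) = y∈Y , b≢y ∘ sym

        sh₃ : Shatters (upᶠ F a b) C₃
        sh₃ t c al = hit (c ≟ a)
          where
          hit : Dec (c ≡ a) → ∃ λ v → Same C₃ c v × ∃ λ x → x ∈ Box t × x ∈ upᶠ F a b v
          hit (yes refl) = let w , w∈B , w∈a , w∈b = switch t (meets-a t) (meets-b t)
                           in a , (al , refl) , w , w∈B , w∈a , λ _ → w∈b
          hit (no c≢a) with sh t (merge y a c) (Alive-merge C a-alive c al)
          ... | v , same , x , x∈B , x∈lo , x∈y = hit′ (v ≟ a)
            where
            hit′ : Dec (v ≡ a) → ∃ λ v → Same C₃ c v × ∃ λ x → x ∈ Box t × x ∈ upᶠ F a b v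
            hit′ (yes v≡a) =
              y , (inj₂ refl , isolated-cong (enlarge C y a) a (a≢y ∘ sym) c≢a
                     (proj₂ (Same-enlarge-new C (subst (Same C _) v≡a same)))) ,
              x , x∈B , lo⇒F (a≢y ∘ sym) (x∈y v≡a) , λ y≡a → contradiction (sym y≡a) a≢y
            hit′ (no v≢a) =
              v , (inj₁ (proj₁ same) , isolated-cong (enlarge C y a) a v≢a c≢a
                     (proj₂ (Same-enlarge⁺ C (alive⇒≢y (proj₁ same)) same))) ,
              x , x∈B , lo⇒F v≢a x∈lo , λ v≡a → contradiction v≡a v≢a

      s₃ = proj₁ copy₃
      σ₃ = proj₁ (proj₂ copy₃)
      h₃ = proj₂ (proj₂ copy₃)

      fills-a : s₃ Fills F a
      fills-a t = proj₁ (subst (λ v → s₃ Fills upᶠ F a b v)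
        (isolated-≡ (enlarge C y a) a (proj₂ (proj₁ (h₃ a (inj₁ a-alive)))))
        (proj₂ (h₃ a (inj₁ a-alive))) t)

      σ : V → V
      σ c = merge y a (σ₃ (merge a y c))

      good-σ : ∀ c → Alive C c → Same C c (σ c) × s₃ Fills Target (σ c)
      good-σ c al = (proj₁ same , trans (proj₂ same) back) , λ t →
        merge-elim (λ v w → v ≢ a → F v (app s₃ t) → Target w (app s₃ t))
          (λ _ x∈y → inj₁ (fills-a t) , λ _ → inj₁ x∈y)
          (λ v _ v≢a x∈v → inj₁ x∈v , λ v≡a → contradiction v≡a v≢a)
          _ σc′≢a (proj₁ (proj₂ (h₃ c′ al′) t))
        where
        c′ = merge a y c

        al′ : Alive C₃ c′
        al′ = merge-elim (λ c c′ → Alive C c → Alive C₃ c′) (λ _ → inj₂ refl) (λ _ _ → inj₁) c al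

        c′≢a : c′ ≢ a
        c′≢a = merge-elim (λ c c′ → c′ ≢ a) (a≢y ∘ sym) (λ _ → id) c

        back : label C (merge y a c′) ≡ label C c
        back = merge-elim (λ c c′ → Alive C c → label C (merge y a c′) ≡ label C c)
          (λ _ → cong (label C) (merge-≡ y a))
          (λ c _ al → cong (label C) (merge-≢ (alive⇒≢y al))) c al

        iso = isolated-≢ (enlarge C y a) a c′≢a (proj₂ (proj₁ (h₃ c′ al′)))
        σc′≢a = proj₁ iso

        same : Alive C (σ c) × label C (σ c) ≡ label C (merge y a c′)
        same = Alive-merge C a-alive _ (proj₁ (proj₁ (h₃ c′ al′))) , proj₂ iso

    conclude₂ : Meets (F b) → Dec (∃ λ c → Alive C₁ c × σ₂ c ≡ a) → Copies Target C
    conclude₂ meets-b (yes (c , al , σc≡a)) =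
      conclude₃ (λ t → map₂ (map₂ proj₁) (meets-filled (upᶠ F b y) C₁ copy₂ al σc≡a t)) meets-b
    conclude₂ meets-b (no avoids) = s₂ , merge b a ∘ σ₂ , λ c al →
      let same , fills = h₂ c (inj₁ al)
          σc≢a = λ σc≡a → avoids (c , inj₁ al , σc≡a)
      in Same-enlarge⁻ C a-alive (alive⇒≢b al) same , λ t →
         merge-elim (λ v w → v ≢ a → upᶠ F b y v (app s₂ t) → Target w (app s₂ t))
           (λ _ (x∈b , x∈y) → inj₂ (refl , x∈b) , λ _ → inj₁ (x∈y refl))
           (λ v _ v≢a (x∈v , _) → inj₁ x∈v , λ v≡a → contradiction v≡a v≢a)
           _ σc≢a (fills t)

    conclude₁ : Dec (∃ λ c → Alive C₁ c × σ₁ c ≡ b) → Copies Target C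
    conclude₁ (yes (c , al , σc≡b)) =
      conclude₂ (λ t → map₂ (map₂ proj₁) (meets-filled (upᶠ F a y) C₁ copy₁ al σc≡b t))
        (search λ c → alive? C₁ c ×-dec (σ₂ c ≟ a))
    conclude₁ (no avoids) = s₁ , σ₁ , λ c al →
      let same , fills = h₁ c (inj₁ al)
          σc≢b = λ σc≡b → avoids (c , inj₁ al , σc≡b)
      in subst (Same C c) (merge-≢ σc≢b) (Same-enlarge⁻ C a-alive (alive⇒≢b al) same) ,
         λ t → inj₁ (proj₁ (fills t)) , λ σc≡a → inj₁ (proj₂ (fills t) σc≡a)

  -- Undoing a contraction in one factor.

  Merges : Family → V → V → Set
  Merges F a b = ∀ s → s Fills (λ x → F a x ⊎ F b x) → s Fills F a ⊎ s Fills F b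

  -- Only at `a` can a copy in `loᶠ` lie outside `F`, and there the section is covered by the slices
  -- at `a` and `b`, one of which contains it. The second case records that `a` was used: this is
  -- what shows that the slice at `b` meets every box.
  split-lo : ∀ F C {a b} → Merges F a b → ((s , σ , _) : Copies (loᶠ F a b) C) →
    (∀ c → Alive C c → s Fills F (σ c)) ⊎
    (∃ λ c → Alive C c × σ c ≡ a) × (∀ c → Alive C c → s Fills F (merge a b (σ c)))
  split-lo F C {a} {b} merges (s , σ , h) with search (λ c → alive? C c ×-dec (σ c ≟ a))
  ... | no avoids = inj₁ λ c al t →
    [ id , (λ (σc≡a , _) → contradiction (c , al , σc≡a) avoids) ]′ (proj₂ (h c al) t)
  ... | yes (c₀ , al₀ , σc₀≡a) with merges s fills
    where
    fills : s Fills (λ x → F a x ⊎ F b x)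
    fills t with proj₂ (h c₀ al₀) t
    ... | inj₁ x∈σc      = inj₁ (subst (λ v → F v (app s t)) σc₀≡a x∈σc)
    ... | inj₂ (_ , x∈b) = inj₂ x∈b
  ...   | inj₁ fills-a = inj₁ fills
    where
    fills : ∀ c → Alive C c → s Fills F (σ c)
    fills c al t with proj₂ (h c al) t
    ... | inj₁ x∈σc       = x∈σc
    ... | inj₂ (σc≡a , _) = subst (λ v → F v (app s t)) (sym σc≡a) (fills-a t)
  ...   | inj₂ fills-b = inj₂ ((c₀ , al₀ , σc₀≡a) , λ c al t →
    merge-elim (λ v w → loᶠ F a b v (app s t) → F w (app s t)) (λ _ → fills-b t)
      (λ { v v≢a (inj₁ x∈v) → x∈v ; v v≢a (inj₂ (v≡a , _)) → contradiction v≡a v≢a })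
      (σ c) (proj₂ (h c al) t))

  restrict-labelling : (C : Labelling V) {Y : Pred V 0ℓ} → Decidable Y → Labelling V
  restrict-labelling C Y? = labelling (λ v → alive? C v ×-dec Y? v) (_≟ᴸ_ C) (label C)

  without : Labelling V → V → Labelling V
  without C b = restrict-labelling C (λ v → ¬? (v ≟ b))

  Shatters-lo : ∀ {F C a b} → a ≢ b → Alive C a → label C a ≡ label C b →
    Shatters F C → Shatters (loᶠ F a b) (without C b)
  Shatters-lo {a = a} {b} a≢b a-alive a~b sh t c (al , _) with sh t c al
  ... | v , (v-alive , eq) , x , x∈B , x∈F with v ≟ b
  ...   | yes refl = a , ((a-alive , a≢b) , trans a~b eq) , x , x∈B , inj₂ (refl , x∈F)
  ...   | no v≢b   = v , ((v-alive , v≢b) , eq) , x , x∈B , inj₁ x∈F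

  -- With `a` and `b` in one block, a copy that has to be moved from `a` to `b` stays in its block.
  unmerge-copies : ∀ {F C a b} → a ≢ b → Alive C a → Alive C b → label C a ≡ label C b →
    Merges F a b → Copies (loᶠ F a b) (without C b) → Copies F C
  unmerge-copies {F} {C} {a} {b} a≢b a-alive b-alive a~b merges copy@(s , σ , h) =
    conclude (split-lo F (without C b) merges copy)
    where
    reduce : ∀ c → Alive C c → Alive (without C b) (merge b a c)
    reduce = merge-elim (λ c c′ → Alive C c → Alive C c′ × c′ ≢ b)
      (λ _ → a-alive , a≢b) (λ c c≢b al → al , c≢b)

    same : ∀ c → Alive C c → Same C c (σ (merge b a c))
    same c al with h (merge b a c) (reduce c al)
    ... | ((al′ , _) , eq) , _ = al′ , trans eq
      (merge-elim (λ c c′ → label C c′ ≡ label C c) a~b (λ _ _ → refl) c)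

    conclude : _ ⊎ _ → Copies F C
    conclude (inj₁ fills) = s , σ ∘ merge b a , λ c al → same c al , fills _ (reduce c al)
    conclude (inj₂ (_ , fills)) = s , merge a b ∘ σ ∘ merge b a , λ c al →
      merge-elim (λ v w → Same C c v → Same C c w)
        (λ (_ , eq) → b-alive , trans (sym a~b) eq) (λ _ _ → id) _ (same c al) ,
      fills _ (reduce c al)

  -- A copy in `loᶠ` may call for the point `b`, which is not at hand. In that case the slice at `b`
  -- meets every box, each hit at `a` can be switched into the slice at `b` as well, and the
  -- partition is shattered already in `upᶠ`, which lies in `F`.
  Good-without : ∀ {F Y a b} → Switches F a b → Merges F a b →
    Good (upᶠ F a b) (Y ∖ b) → Good (loᶠ F a b) (Y ∖ b) → Good F (Y ∖ b)
  Good-without {F} {Y} {a} {b} switch merges good-up good-lo C C⊆ sh =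
    from-lo (good-lo C C⊆ λ t c al →
      let v , same , x , x∈B , x∈F = sh t c al in v , same , x , x∈B , inj₁ x∈F)
    where
    from-lo : Copies (loᶠ F a b) C → Copies F C
    from-lo (s₁ , σ₁ , h₁) with split-lo F C merges (s₁ , σ₁ , h₁)
    ... | inj₁ fills = s₁ , σ₁ , λ c al → proj₁ (h₁ c al) , fills c al
    ... | inj₂ ((c₀ , al₀ , σc₀≡a) , fills) =
      let s , σ , h = good-up C C⊆ sh-up
      in s , σ , λ c al → map₂ (proj₁ ∘_) (h c al)
      where
      meets-b : Meets (F b)
      meets-b = fills⇒meets s₁ (subst (λ v → s₁ Fills F v)
        (trans (cong (merge a b) σc₀≡a) (merge-≡ a b)) (fills c₀ al₀))

      sh-up : Shatters (upᶠ F a b) C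
      sh-up t c al with sh t c al
      ... | v , same , x , x∈B , x∈F with v ≟ a
      ...   | no v≢a   = v , same , x , x∈B , x∈F , λ v≡a → contradiction v≡a v≢a
      ...   | yes refl = let w , w∈B , w∈a , w∈b = switch t (x , x∈B , x∈F) (meets-b t)
                         in a , same , w , w∈B , w∈a , λ _ → w∈b

  -- If the slice at another point `r` of the block meets every box, hits at `p` can be exchanged
  -- for hits at `r`, and `p` can be deleted.
  replace : ∀ {F Y p r} C → (∀ v → Alive C v → Y v) → Alive C r → r ≢ p → label C r ≡ label C p →
    Meets (F r) → Good F (Y ∖ p) → Shatters F C → Copies F C
  replace {F} {Y} {p} {r} C C⊆Y r-alive r≢p r~p meets-r good sh =
    let s , σ , h = good (without C p) (λ v (al , v≢p) → C⊆Y v al , v≢p) sh′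
    in s , σ ∘ merge p r , λ c al →
         let ((al′ , _) , eq) , fills = h (merge p r c)
               (merge-elim (λ c c′ → Alive C c → Alive C c′ × c′ ≢ p)
                 (λ _ → r-alive , r≢p) (λ c c≢p al → al , c≢p) c al)
         in (al′ , trans eq (merge-elim (λ c c′ → label C c′ ≡ label C c) r~p (λ _ _ → refl) c)) , fills
    where
    sh′ : Shatters F (without C p)
    sh′ t c (al , _) with sh t c al
    ... | v , (v-alive , eq) , hit with v ≟ p
    ...   | no v≢p   = v , ((v-alive , v≢p) , eq) , hit
    ...   | yes refl = r , ((r-alive , r≢p) , trans r~p eq) , meets-r t

  -- If `r` is not `a`, then `a` can be deleted. If it is, drop the block of `a` and let `a` take
  -- over the role of `b` (`C₃`): hits at `b` switch to hits in both slices. Either the copy in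
  -- `upᶠ` represents `a` by itself, and its section fills the slices at `a` and at `b`; or it
  -- represents `a` by another point of the block of `b`, whose slice therefore meets every box, and
  -- `b` can be deleted.
  separated : ∀ {F Y a b} C → (∀ v → Alive C v → Y v) → a ≢ b → Alive C a → Alive C b →
    label C a ≢ label C b → Switches F a b →
    Good (upᶠ F a b) (Y ∖ b) → Good F (Y ∖ a) → Good F (Y ∖ b) →
    ∀ r → Alive C r → label C r ≡ label C a → Meets (F r) →
    Shatters F C → Copies F C
  separated {F} {Y} {a} {b} C C⊆Y a≢b a-alive b-alive a≁b switch good-up good-a good-b
    r r-alive r~a meets-r sh with r ≟ a
  ... | no r≢a   = replace C C⊆Y r-alive r≢a r~a meets-r good-a sh
  ... | yes refl = conclude copy₃
    where
    Alive₃ : Pred V 0ℓ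
    Alive₃ v = (Alive C v × label C v ≢ label C a × v ≢ b) ⊎ v ≡ a

    C₃ : Labelling V
    C₃ = labelling {Alive = Alive₃}
      (λ v → (alive? C v ×-dec (¬? (_≟ᴸ_ C (label C v) (label C a)) ×-dec ¬? (v ≟ b))) ⊎-dec (v ≟ a))
      (_≟ᴸ_ C) (label C ∘ merge a b)

    sh₃ : Shatters (upᶠ F a b) C₃
    sh₃ t c al = hit (sh t (merge a b c) (proj₁ (reduce c al)))
      where
      reduce : ∀ c → Alive₃ c → Alive C (merge a b c) × label C (merge a b c) ≢ label C a
      reduce = merge-elim (λ c c′ → Alive₃ c → Alive C c′ × label C c′ ≢ label C a)
        (λ _ → b-alive , a≁b ∘ sym)
        λ { c c≢a (inj₁ (al , ≁a , _)) → al , ≁a ; c c≢a (inj₂ c≡a) → contradiction c≡a c≢a }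

      hit : (∃ λ v → Same C (merge a b c) v × ∃ λ x → x ∈ Box t × x ∈ F v) →
        ∃ λ v → Same C₃ c v × ∃ λ x → x ∈ Box t × x ∈ upᶠ F a b v
      hit (v , (v-alive , eq) , x , x∈B , x∈F) with v ≟ b
      ... | yes refl = let w , w∈B , w∈a , w∈b = switch t (meets-r t) (x , x∈B , x∈F)
                       in a , (inj₂ refl , trans (cong (label C) (merge-≡ a b)) eq) ,
                          w , w∈B , w∈a , λ _ → w∈b
      ... | no v≢b =
        v , (inj₁ (v-alive , ≁a , v≢b) , trans (cong (label C) (merge-≢ v≢a)) eq) ,
        x , x∈B , x∈F , λ v≡a → contradiction v≡a v≢a
        where
        ≁a : label C v ≢ label C a
        ≁a v~a = proj₂ (reduce c al) (trans (sym eq) v~a)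
        v≢a : v ≢ a
        v≢a = ≁a ∘ cong (label C)

    copy₃ : Copies (upᶠ F a b) C₃
    copy₃ = good-up C₃
      (λ { v (inj₁ (al , _ , v≢b)) → C⊆Y v al , v≢b ; v (inj₂ refl) → C⊆Y a a-alive , a≢b }) sh₃

    conclude : Copies (upᶠ F a b) C₃ → Copies F C
    conclude (s₃ , σ₃ , h₃) with σ₃ a ≟ a
    ... | yes σa≡a = s₃ , σ , good-σ
      where
      fills : s₃ Fills upᶠ F a b a
      fills = subst (λ v → s₃ Fills upᶠ F a b v) σa≡a (proj₂ (h₃ a (inj₂ refl)))

      σ : V → V
      σ c with _≟ᴸ_ C (label C c) (label C a) | _≟ᴸ_ C (label C c) (label C b)
      ... | yes _ | _     = a
      ... | no  _ | yes _ = b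
      ... | no  _ | no  _ = σ₃ c

      good-σ : ∀ c → Alive C c → Same C c (σ c) × s₃ Fills F (σ c)
      good-σ c al with _≟ᴸ_ C (label C c) (label C a) | _≟ᴸ_ C (label C c) (label C b)
      ... | yes c~a | _       = (a-alive , sym c~a) , proj₁ ∘ fills
      ... | no  _   | yes c~b = (b-alive , sym c~b) , λ t → proj₂ (fills t) refl
      ... | no c≁a  | no c≁b with h₃ c (inj₁ (al , c≁a , c≁b ∘ cong (label C)))
      ...   | (al′ , eq) , fills′ = same al′ , proj₁ ∘ fills′
        where
        eq′ : label C (merge a b (σ₃ c)) ≡ label C c
        eq′ = trans eq (cong (label C) (merge-≢ (c≁a ∘ cong (label C))))

        σc≢a : σ₃ c ≢ a
        σc≢a σc≡a = c≁b (trans (sym eq′)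
          (cong (label C) (trans (cong (merge a b) σc≡a) (merge-≡ a b))))

        same : Alive₃ (σ₃ c) → Same C c (σ₃ c)
        same (inj₁ (al″ , _)) = al″ , trans (sym (cong (label C) (merge-≢ σc≢a))) eq′
        same (inj₂ σc≡a)      = contradiction σc≡a σc≢a
    ... | no σa≢a with h₃ a (inj₂ refl)
    ...   | (inj₂ σa≡a , _) , _ = contradiction σa≡a σa≢a
    ...   | (inj₁ (al , _ , σa≢b) , eq) , fills =
      replace C C⊆Y al σa≢b
        (trans (sym (cong (label C) (merge-≢ σa≢a))) (trans eq (cong (label C) (merge-≡ a b))))
        (fills⇒meets s₃ (proj₁ ∘ fills)) good-b sh

  -- If `a` and `b` share a block, `b` can be deleted and `loᶠ` used. If their blocks differ, gluing
  -- the two blocks leads back to that case; the glued block is then represented by a point of one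
  -- of them whose slice meets every box, which is the hypothesis of `separated` for `a` or,
  -- symmetrically, for `b`.
  Good-from-contraction : ∀ {F Y a b} → a ≢ b → Y a → Y b → Switches F a b → Merges F a b →
    Good (upᶠ F a b) (Y ∖ b) → Good (loᶠ F a b) (Y ∖ b) → Good F Y
  Good-from-contraction {F} {Y} {a} {b} a≢b a∈Y b∈Y switch merges good-up good-lo C C⊆Y sh =
    cases (alive? C a) (alive? C b)
    where
    switch′ : Switches F b a
    switch′ t hb ha = let x , x∈B , x∈a , x∈b = switch t ha hb in x , x∈B , x∈b , x∈a

    merges′ : Merges F b a
    merges′ s fills = [ inj₂ , inj₁ ]′ (merges s λ t → [ inj₂ , inj₁ ]′ (fills t))

    good-up′ : Good (upᶠ F b a) (Y ∖ a)
    good-up′ = Good-up-swap a≢b a∈Y good-up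

    good-b : Good F (Y ∖ b)
    good-b = Good-without switch merges good-up good-lo

    good-a : Good F (Y ∖ a)
    good-a = Good-without switch′ merges′ good-up′ (Good-lo-swap a≢b a∈Y good-lo)

    merged : ∀ C → (∀ v → Alive C v → Y v) → Alive C a → Alive C b → label C a ≡ label C b →
      Shatters F C → Copies F C
    merged C C⊆Y a-alive b-alive a~b sh = unmerge-copies {F} {C} a≢b a-alive b-alive a~b merges
      (good-lo (without C b) (λ v (al , v≢b) → C⊆Y v al , v≢b) (Shatters-lo {F} {C} a≢b a-alive a~b sh))

    cases : Dec (Alive C a) → Dec (Alive C b) → Copies F C
    cases (no a-dead) _ =
      good-a C (λ v al → C⊆Y v al , λ v≡a → a-dead (subst (Alive C) v≡a al)) sh
    cases (yes _) (no b-dead) =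
      good-b C (λ v al → C⊆Y v al , λ v≡b → b-dead (subst (Alive C) v≡b al)) sh
    cases (yes a-alive) (yes b-alive) = labels (_≟ᴸ_ C (label C a) (label C b))
      where
      labels : Dec (label C a ≡ label C b) → Copies F C
      labels (yes a~b) = merged C C⊆Y a-alive b-alive a~b sh
      labels (no a≁b)  = representative copy
        where
        identify : Label C → Label C
        identify l with _≟ᴸ_ C l (label C b)
        ... | yes _ = label C a
        ... | no  _ = l

        identify-b : identify (label C b) ≡ label C a
        identify-b with _≟ᴸ_ C (label C b) (label C b)
        ... | yes _  = refl
        ... | no b≁b = contradiction refl b≁b

        identify-a : identify (label C a) ≡ label C a
        identify-a with _≟ᴸ_ C (label C a) (label C b)
        ... | yes _ = refl
        ... | no  _ = refl

        identify⁻ : ∀ l → identify l ≡ label C a → l ≡ label C a ⊎ l ≡ label C b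
        identify⁻ l eq with _≟ᴸ_ C l (label C b)
        ... | yes l≡b = inj₂ l≡b
        ... | no  _   = inj₁ eq

        C′ : Labelling V
        C′ = labelling (alive? C) (_≟ᴸ_ C) (identify ∘ label C)

        copy : Copies F C′
        copy = merged C′ C⊆Y a-alive b-alive (trans identify-a (sym identify-b)) λ t c al →
          let v , (v-alive , eq) , hit = sh t c al in v , (v-alive , cong identify eq) , hit

        representative : Copies F C′ → Copies F C
        representative (s , σ , h) with h a a-alive
        ... | (al , eq) , fills with identify⁻ (label C (σ a)) (trans eq identify-a)
        ...   | inj₁ r~a = separated C C⊆Y a≢b a-alive b-alive a≁b switch good-up good-a good-b
                             (σ a) al r~a (fills⇒meets s fills) sh
        ...   | inj₂ r~b = separated C C⊆Y (a≢b ∘ sym) b-alive a-alive (a≁b ∘ sym) switch′ good-up′ good-b good-a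
                             (σ a) al r~b (fills⇒meets s fills) sh

  -- Two or three values in one factor.

  ⟦_,_⟧ : V → V → Pred V 0ℓ
  ⟦ p , q ⟧ v = v ≡ p ⊎ v ≡ q

  common-filling : ∀ {F p q} → Good F ⟦ p , q ⟧ → Meets (F p) → Meets (F q) →
    ∃ λ s → s Fills F p × s Fills F q
  common-filling {F} {p} {q} good meets-p meets-q =
    let s , σ , h = good (labelling (λ v → (v ≟ p) ⊎-dec (v ≟ q)) _≟_ id) (λ _ al → al)
          λ { t c al@(inj₁ refl) → p , (al , refl) , meets-p t
            ; t c al@(inj₂ refl) → q , (al , refl) , meets-q t }
        fills : ∀ c → ⟦ p , q ⟧ c → s Fills F c
        fills c al = let (_ , σc≡c) , fills-σc = h c al in subst (λ v → s Fills F v) σc≡c fills-σc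
    in s , fills p (inj₁ refl) , fills q (inj₂ refl)

  constant-copy : ∀ {F} p q → Good F ⟦ p , q ⟧ → (∀ t → (∃ λ x → x ∈ Box t × x ∈ F p) ⊎ (∃ λ x → x ∈ Box t × x ∈ F q)) →
    (∃ λ s → s Fills F p) ⊎ (∃ λ s → s Fills F q)
  constant-copy {F} p q good cover
    with good (labelling (λ v → (v ≟ p) ⊎-dec (v ≟ q)) Unit._≟_ (const tt)) (λ _ al → al)
           (λ t _ _ → [ (λ hit → p , (inj₁ refl , refl) , hit) , (λ hit → q , (inj₂ refl , refl) , hit) ]′ (cover t))
  ... | s , σ , h with h p (inj₁ refl)
  ...   | (inj₁ eq , _) , fills = inj₁ (s , subst (λ v → s Fills F v) eq fills)
  ...   | (inj₂ eq , _) , fills = inj₂ (s , subst (λ v → s Fills F v) eq fills)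

  -- Every box meets the slice at `y` or the intersection of those at `a` and `b`. Comparing `y`
  -- with `a` and with `b` gives a section filling the slice at `y`, which is enough, or one for `a`
  -- and one for `b`; the latter two slices then meet every box and have a common section.
  same-block-copies : ∀ {F a b y} C → a ≢ y →
    Good F ⟦ a , b ⟧ → Good F ⟦ a , y ⟧ → Good F ⟦ b , y ⟧ →
    (∀ v → Alive C v → ⟦ a , y ⟧ v) → Alive C a → Alive C y → label C a ≡ label C y →
    Shatters (upᶠ F a b) C → Copies (upᶠ F a b) C
  same-block-copies {F} {a} {b} {y} C a≢y good-ab good-ay good-by C⊆ a-alive y-alive a~y sh =
    conclude (constant-copy a y good-ay (λ t → [ (λ (x , x∈B , x∈a , _) → inj₁ (x , x∈B , x∈a)) , inj₂ ]′ (cover t)))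
             (constant-copy b y good-by (λ t → [ (λ (x , x∈B , _ , x∈b) → inj₁ (x , x∈B , x∈b)) , inj₂ ]′ (cover t)))
    where
    cover : ∀ t → (∃ λ x → x ∈ Box t × x ∈ F a × x ∈ F b) ⊎ (∃ λ x → x ∈ Box t × x ∈ F y)
    cover t with sh t a a-alive
    ... | v , (al , _) , x , x∈B , x∈v , x∈b with C⊆ v al
    ...   | inj₁ refl = inj₁ (x , x∈B , x∈v , x∈b refl)
    ...   | inj₂ refl = inj₂ (x , x∈B , x∈v)

    all-one-block : ∀ c → Alive C c → label C c ≡ label C a
    all-one-block c al with C⊆ c al
    ... | inj₁ refl = refl
    ... | inj₂ refl = sym a~y

    constant : ∀ {p} s → Alive C p → s Fills upᶠ F a b p → Copies (upᶠ F a b) C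
    constant {p} s al fills = s , const p , λ c c-alive →
      (al , trans (all-one-block p al) (sym (all-one-block c c-alive))) , fills

    conclude : (∃ λ s → s Fills F a) ⊎ (∃ λ s → s Fills F y) →
      (∃ λ s → s Fills F b) ⊎ (∃ λ s → s Fills F y) → Copies (upᶠ F a b) C
    conclude (inj₂ (s , fills)) _ = constant s y-alive λ t → fills t , λ y≡a → contradiction (sym y≡a) a≢y
    conclude _ (inj₂ (s , fills)) = constant s y-alive λ t → fills t , λ y≡a → contradiction (sym y≡a) a≢y
    conclude (inj₁ (sa , fills-a)) (inj₁ (sb , fills-b)) =
      let s , in-a , in-b = common-filling good-ab (fills⇒meets sa fills-a) (fills⇒meets sb fills-b)
      in constant s a-alive λ t → in-a t , λ _ → in-b t

  Shatters-cong : ∀ {F F′ C} → (∀ v x → F v x → F′ v x) → Shatters F C → Shatters F′ C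
  Shatters-cong to sh t c al = let v , same , x , x∈B , x∈v = sh t c al in v , same , x , x∈B , to v x x∈v

  Copies-cong : ∀ {F F′ C} → (∀ v x → F v x → F′ v x) → Copies F C → Copies F′ C
  Copies-cong to (s , σ , h) = s , σ , λ c al → map₂ (λ fills t → to _ _ (fills t)) (h c al)

  -- Merging `g` with `h` interferes with the merged point only if one of them is `a`, which is
  -- `Good-up-lo`; otherwise the two contractions commute and `Good-lo` applies.
  Good-up-of-lo : ∀ {F Y a b g h} → a ≢ b → Y a → Y b → Switches F a b →
    (∀ {p q} → p ≢ q → Y p → Y q → Good (upᶠ F p q) (Y ∖ q)) →
    g ≢ h → (Y ∖ b) g → (Y ∖ b) h → Good (upᶠ (loᶠ F a b) g h) ((Y ∖ b) ∖ h)
  Good-up-of-lo {F} {Y} {a} {b} {g} {h} a≢b a∈Y b∈Y switch good g≢h (g∈Y , g≢b) (h∈Y , h≢b)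
    with g ≟ a | h ≟ a
  ... | yes refl | _ =
    Good-up-lo a≢b g≢h (h≢b ∘ sym) a∈Y b∈Y h∈Y switch
      (good g≢h a∈Y h∈Y) (good (h≢b ∘ sym) b∈Y h∈Y) (good a≢b a∈Y b∈Y)
  ... | no _ | yes refl = Good-up-swap (g≢h ∘ sym) (a∈Y , h≢b)
    (Good-up-lo a≢b (g≢h ∘ sym) (g≢b ∘ sym) a∈Y b∈Y g∈Y switch
      (good (g≢h ∘ sym) a∈Y g∈Y) (good (g≢b ∘ sym) b∈Y g∈Y) (good a≢b a∈Y b∈Y))
  ... | no g≢a | no h≢a = Good-cong
    (λ v ((v∈Y , v≢b) , v≢h) → (v∈Y , v≢h) , v≢b)
    (λ { v x _ (inj₁ (x∈v , both))       → inj₁ x∈v , inj₁ ∘ both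
       ; v x _ (inj₂ (v≡a , x∈b , both)) → inj₂ (v≡a , x∈b) ,
           λ v≡g → contradiction (trans (sym v≡g) v≡a) g≢a })
    (λ { v x _ (inj₁ x∈v , both)         → inj₁ (x∈v ,
           λ v≡g → [ id , (λ (h≡a , _) → contradiction h≡a h≢a) ]′ (both v≡g))
       ; v x _ (inj₂ (v≡a , x∈b) , _)    → inj₂ (v≡a , x∈b , λ b≡g → contradiction (sym b≡g) g≢b) })
    (Good-lo a≢b (b∈Y , h≢b ∘ sym) (good g≢h g∈Y h∈Y))

-- Tuples and ampleness in subproducts.

at : {B : Fin m → Set ℓ} (i : Fin m) → B i → (∀ j → B j) → ∀ j → B j
at i v f j with j Fin.≟ i
... | yes refl = v
... | no  _    = f j

at-≡ : {B : Fin m → Set ℓ} (i : Fin m) {v : B i} {f : ∀ j → B j} → at i v f i ≡ v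
at-≡ i with i Fin.≟ i
... | yes refl = refl
... | no i≢i   = contradiction refl i≢i

at-≢ : {B : Fin m → Set ℓ} {i j : Fin m} {v : B i} {f : ∀ j → B j} → j ≢ i → at i v f j ≡ f j
at-≢ {i = i} {j} j≢i with j Fin.≟ i
... | yes j≡i = contradiction j≡i j≢i
... | no  _   = refl

at-≈ : {U : Fin m → Set} {i : Fin m} {v : U i} {x z : Tuple U} →
  v ≡ z i → (∀ j → j ≢ i → x j ≡ z j) → at i v x ≈ z
at-≈ {i = i} v≡ x≡ j with j Fin.≟ i
... | yes refl = v≡
... | no j≢i   = x≡ j j≢i

at-cong : {U : Fin m → Set} {i : Fin m} {v : U i} {x z : Tuple U} →
  (∀ j → j ≢ i → x j ≡ z j) → at i v x ≈ at i v z
at-cong {i = i} x≡ j with j Fin.≟ i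
... | yes refl = refl
... | no j≢i   = x≡ j j≢i

at-self : {U : Fin m → Set} {i : Fin m} {v : U i} {x : Tuple U} → v ≡ x i → at i v x ≈ x
at-self v≡ = at-≈ v≡ (λ _ _ → refl)

at-at : {U : Fin m → Set} {i : Fin m} {v w : U i} {x : Tuple U} → at i v (at i w x) ≈ at i v x
at-at = at-cong (λ _ → at-≢)

≈-sym : {U : Fin m → Set} {x y : Tuple U} → x ≈ y → y ≈ x
≈-sym x≈y j = sym (x≈y j)

-- A Labelling of every factor is a generalized partition of the subproduct of its
-- alive points; the blocks are the nonempty fibres of label.
Hits : {U : Fin m → Set} → Pred (Tuple U) 0ℓ → (∀ i → Labelling (U i)) → Set
Hits {U = U} S Λ = ∀ (y : Tuple U) → (∀ i → Alive (Λ i) (y i)) → ∃ λ (x : Tuple U) → x ∈ S × (∀ i → Same (Λ i) (y i) (x i))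

HasCopy : {U : Fin m → Set} → Pred (Tuple U) 0ℓ → (∀ i → Labelling (U i)) → Set
HasCopy {U = U} S Λ = Σ (∀ i → U i → U i) λ s →
  (∀ i c → Alive (Λ i) c → Same (Λ i) c (s i c)) ×
  (∀ (y : Tuple U) → (∀ i → Alive (Λ i) (y i)) → (λ i → s i (y i)) ∈ S)

AmpleIn : {U : Fin m → Set} → (∀ i → Pred (U i) 0ℓ) → Pred (Tuple U) 0ℓ → Set₁
AmpleIn Y S = ∀ Λ → (∀ i v → Alive (Λ i) v → Y i v) → Hits S Λ → HasCopy S Λ

AmpleIn-⊆ : {U : Fin m → Set} {Y Y′ : ∀ i → Pred (U i) 0ℓ} {S : Pred (Tuple U) 0ℓ} →
  (∀ i v → Y′ i v → Y i v) → AmpleIn Y S → AmpleIn Y′ S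
AmpleIn-⊆ Y′⊆Y ample Λ Λ⊆Y′ = ample Λ (λ i v → Y′⊆Y i v ∘ Λ⊆Y′ i v)

-- Partitions are pulled back along `φ` and hits along `ψ`. The pulled-back alive points are cut
-- down to `Y`, because outside `Y` the map `φ` may take arbitrary default values.
AmpleIn-transport : {U U′ : Fin m → Set} {Y : ∀ i → Pred (U i) 0ℓ} {Y′ : ∀ i → Pred (U′ i) 0ℓ}
  {S : Pred (Tuple U) 0ℓ} {S′ : Pred (Tuple U′) 0ℓ} → (∀ i → Decidable (Y i)) →
  (φ : ∀ i → U i → U′ i) (ψ : ∀ i → U′ i → U i) →
  (∀ i v → Y′ i v → Y i (ψ i v)) → (∀ i v → Y′ i v → φ i (ψ i v) ≡ v) →
  (∀ x → (∀ i → Y i (x i)) → S x → S′ (λ i → φ i (x i))) →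
  (∀ x → (∀ i → Y′ i (x i)) → S′ x → S (λ i → ψ i (x i))) →
  AmpleIn Y S → AmpleIn Y′ S′
AmpleIn-transport {U = U} {Y = Y} {S = S} Y? φ ψ ψY′⊆Y φψ push pull ample Λ Λ⊆Y′ hits =
  let s , same , inS = ample Λ₁ (λ i v → proj₁) hits₁
      alive₁ = λ i c al → ψY′⊆Y i c (Λ⊆Y′ i c al) , subst (Alive (Λ i)) (sym (φψ i c (Λ⊆Y′ i c al))) al
  in (λ i → φ i ∘ s i ∘ ψ i) ,
     (λ i c al → let (_ , al′) , eq = same i (ψ i c) (alive₁ i c al)
                 in al′ , trans eq (cong (label (Λ i)) (φψ i c (Λ⊆Y′ i c al)))) ,
     λ y al → push _ (λ i → proj₁ (proj₁ (same i _ (alive₁ i _ (al i))))) (inS _ λ i → alive₁ i _ (al i))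
  where
  Λ₁ : ∀ i → Labelling (U i)
  Λ₁ i = labelling {Alive = λ v → Y i v × Alive (Λ i) (φ i v)} (λ v → Y? i v ×-dec alive? (Λ i) (φ i v))
                   (_≟ᴸ_ (Λ i)) (label (Λ i) ∘ φ i)

  hits₁ : Hits S Λ₁
  hits₁ y al with hits (λ i → φ i (y i)) (proj₂ ∘ al)
  ... | x , x∈S′ , same =
    (λ i → ψ i (x i)) , pull x (λ i → x∈Y′ i) x∈S′ ,
    λ i → (ψY′⊆Y i _ (x∈Y′ i) , subst (Alive (Λ i)) (sym (φψ i _ (x∈Y′ i))) (proj₁ (same i))) ,
          trans (cong (label (Λ i)) (φψ i _ (x∈Y′ i))) (proj₂ (same i))
    where
    x∈Y′ = λ i → Λ⊆Y′ i (x i) (proj₁ (same i))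

-- An inequality of pairs compares points of different factors, so that no case distinction on `j`
-- is built in.
_∖[_,_] : {U : Fin m → Set} → (∀ i → Pred (U i) 0ℓ) → (i : Fin m) → U i → ∀ i → Pred (U i) 0ℓ
_∖[_,_] {U = U} Y i b j v = Y j v × _≢_ {A = Σ _ U} (j , v) (i , b)

slice : {U : Fin m → Set} (i : Fin m) → Pred (Tuple U) 0ℓ → U i → Pred (Tuple U) 0ℓ
slice i S v x = at i v x ∈ S

-- S^e and S_e for the e merging a and b in factor i, as sets of tuples x with x i ≢ b.
up lo : {U : Fin m → Set} → Pred (Tuple U) 0ℓ → (i : Fin m) → U i → U i → Pred (Tuple U) 0ℓ
up S i a b x = x ∈ S × (x i ≡ a → at i b x ∈ S)
lo S i a b x = x ∈ S ⊎ (x i ≡ a × at i b x ∈ S)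

-- Hamming distance and betweenness.

difference : {P : Set} → Dec P → ℕ
difference (yes _) = 0
difference (no  _) = 1

-- The same number as `distance`, which filters a list of all coordinates, in a form that admits
-- induction on `m`.
hamming : {U : Fin m → Set} → (∀ i → DecidableEquality (U i)) → Tuple U → Tuple U → ℕ
hamming {zero}  _≟_ x y = 0
hamming {suc m} _≟_ x y =
  difference (_≟_ zero (x zero) (y zero)) + hamming (λ i → _≟_ (suc i)) (x ∘ suc) (y ∘ suc)

Between : {U : Fin m → Set} → Tuple U → Tuple U → Tuple U → Set
Between x y w = ∀ j → w j ≡ x j ⊎ w j ≡ y j

hamming-≈ : ∀ {m} {U : Fin m → Set} (_≟_ : ∀ i → DecidableEquality (U i)) (x y : Tuple U) →
  x ≈ y → hamming _≟_ x y ≡ 0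
hamming-≈ {zero}  _≟_ x y x≈y = refl
hamming-≈ {suc m} _≟_ x y x≈y with _≟_ zero (x zero) (y zero)
... | yes _  = hamming-≈ (λ i → _≟_ (suc i)) _ _ (x≈y ∘ suc)
... | no x≢y = contradiction (x≈y zero) x≢y

hamming-mono : ∀ {m} {U : Fin m → Set} (_≟_ : ∀ i → DecidableEquality (U i)) (x x′ y : Tuple U) →
  (∀ j → x′ j ≡ y j → x j ≡ y j) → hamming _≟_ x y ≤ hamming _≟_ x′ y
hamming-mono {zero}  _≟_ x x′ y imp = z≤n
hamming-mono {suc m} _≟_ x x′ y imp
  with _≟_ zero (x zero) (y zero) | _≟_ zero (x′ zero) (y zero)
... | yes _  | yes _ = hamming-mono (λ i → _≟_ (suc i)) _ _ _ (imp ∘ suc)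
... | yes _  | no _  = ℕ.m≤n⇒m≤1+n (hamming-mono (λ i → _≟_ (suc i)) _ _ _ (imp ∘ suc))
... | no x≢y | yes e = contradiction (imp zero e) x≢y
... | no _   | no _  = s≤s (hamming-mono (λ i → _≟_ (suc i)) _ _ _ (imp ∘ suc))

hamming-between : ∀ {m} {U : Fin m → Set} (_≟_ : ∀ i → DecidableEquality (U i)) (x y w : Tuple U) →
  Between x y w → hamming _≟_ x y ≡ hamming _≟_ x w + hamming _≟_ w y
hamming-between {zero}  _≟_ x y w btw = refl
hamming-between {suc m} _≟_ x y w btw
  with _≟_ zero (x zero) (y zero) | _≟_ zero (x zero) (w zero) | _≟_ zero (w zero) (y zero)
     | hamming-between (λ i → _≟_ (suc i)) (x ∘ suc) (y ∘ suc) (w ∘ suc) (btw ∘ suc)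
... | yes x≡y | yes _   | yes _   | eq = eq
... | no x≢y  | yes x≡w | yes w≡y | eq = contradiction (trans x≡w w≡y) x≢y
... | no x≢y  | no _    | yes _   | eq = cong suc eq
... | no x≢y  | yes _   | no _    | eq = trans (cong suc eq) (sym (ℕ.+-suc _ _))
... | yes x≡y | no x≢w  | _       | eq =
  [ (λ w≡x → contradiction (sym w≡x) x≢w) , (λ w≡y → contradiction (trans x≡y (sym w≡y)) x≢w) ]′ (btw zero)
... | yes x≡y | yes x≡w | no w≢y  | eq = contradiction (trans (sym x≡w) x≡y) w≢y
... | no _    | no x≢w  | no w≢y  | eq = [ (λ w≡x → contradiction (sym w≡x) x≢w) , (λ w≡y → contradiction w≡y w≢y) ]′ (btw zero)

hamming-pos : ∀ {m} {U : Fin m → Set} (_≟_ : ∀ i → DecidableEquality (U i)) (x y : Tuple U) →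
  ∀ k → x k ≢ y k → 0 < hamming _≟_ x y
hamming-pos _≟_ x y zero x≢y with _≟_ zero (x zero) (y zero)
... | yes x≡y = contradiction x≡y x≢y
... | no _    = s≤s z≤n
hamming-pos _≟_ x y (suc k) x≢y =
  ℕ.≤-trans (hamming-pos (λ i → _≟_ (suc i)) (x ∘ suc) (y ∘ suc) k x≢y) (ℕ.m≤n+m _ _)

-- Membership in P must respect ≈ because tuples are functions.
search-tuples : ∀ {m} {U : Fin m → Set} → (∀ i → Finite (U i)) → {P : Pred (Tuple U) 0ℓ} →
  P Respects _≈_ → Decidable P → Dec (∃ P)
search-tuples {zero} {U} finite P-resp P? =
  map′ (empty ,_) (λ (x , p) → P-resp {x} {empty} (λ ()) p) (P? empty)
  where
  empty : Tuple U
  empty ()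
search-tuples {suc m} {U} finite {P} P-resp P? =
  map′ (λ (v , x , p) → cons v x , p)
       (λ (x , p) → x zero , x ∘ suc , P-resp {x} {cons (x zero) (x ∘ suc)} (λ { zero → refl ; (suc i) → refl }) p)
       (Finite.search (finite zero) λ v → search-tuples (finite ∘ suc)
         (λ {x} {y} x≈y → P-resp {cons v x} {cons v y} λ { zero → refl ; (suc i) → x≈y i }) (λ x → P? (cons v x)))
  where
  cons : U zero → Tuple (U ∘ suc) → Tuple U
  cons v x zero    = v
  cons v x (suc i) = x i

-- For the finite sets at hand this is equivalent to isometricity, but it is
-- inherited by the sets lo S i a b without any choice of paths.
Switching : {U : Fin m → Set} → (∀ i → Pred (U i) 0ℓ) → Pred (Tuple U) 0ℓ → Set
Switching {U = U} Y S = ∀ {x y : Tuple U} → x ∈ S → y ∈ S → (∀ j → Y j (x j)) → (∀ j → Y j (y j)) →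
  ∀ i → x i ≢ y i → ∃ λ (w : Tuple U) → Between x y w × at i (x i) w ∈ S × at i (y i) w ∈ S

-- Together with Switching, the hypothesis of the implication (3) ⇒ (1).
UpperAmple : {U : Fin m → Set} → (∀ i → Pred (U i) 0ℓ) → Pred (Tuple U) 0ℓ → Set₁
UpperAmple Y S = ∀ i {a b} → a ≢ b → Y i a → Y i b → AmpleIn (Y ∖[ i , b ]) (up S i a b)

-- Counting, and partitions given by maps.

length-filter-≤ : {A : Set} {P Q : Pred A 0ℓ} (P? : Decidable P) (Q? : Decidable Q) →
  (∀ x → P x → Q x) → ∀ xs → length (filter P? xs) ≤ length (filter Q? xs)
length-filter-≤ P? Q? P⊆Q [] = z≤n
length-filter-≤ P? Q? P⊆Q (x ∷ xs) with P? x | Q? x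
... | yes _ | yes _ = s≤s (length-filter-≤ P? Q? P⊆Q xs)
... | yes p | no ¬q = contradiction (P⊆Q x p) ¬q
... | no _  | yes _ = ℕ.m≤n⇒m≤1+n (length-filter-≤ P? Q? P⊆Q xs)
... | no _  | no _  = length-filter-≤ P? Q? P⊆Q xs

length-filter-< : {A : Set} {P Q : Pred A 0ℓ} (P? : Decidable P) (Q? : Decidable Q) →
  (∀ x → P x → Q x) → ∀ {x xs} → x ∈ˡ xs → Q x → ¬ P x → length (filter P? xs) < length (filter Q? xs)
length-filter-< P? Q? P⊆Q {x} {_ ∷ xs} (here refl) q ¬p with P? x | Q? x
... | yes p | _     = contradiction p ¬p
... | no _  | no ¬q = contradiction q ¬q
... | no _  | yes _ = s≤s (length-filter-≤ P? Q? P⊆Q xs)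
length-filter-< P? Q? P⊆Q {x} {y ∷ xs} (there x∈xs) q ¬p with P? y | Q? y
... | yes _ | yes _  = s≤s (length-filter-< P? Q? P⊆Q x∈xs q ¬p)
... | yes p | no ¬q  = contradiction (P⊆Q y p) ¬q
... | no _  | yes _  = ℕ.m≤n⇒m≤1+n (length-filter-< P? Q? P⊆Q x∈xs q ¬p)
... | no _  | no _   = length-filter-< P? Q? P⊆Q x∈xs q ¬p

lookup-injective : {A : Set} {xs : List A} → Unique xs → ∀ i j → lookup xs i ≡ lookup xs j → i ≡ j
lookup-injective (_   ∷ _)  zero    zero    _  = refl
lookup-injective (x∉ ∷ _)   zero    (suc j) eq = contradiction eq (All.lookup x∉ (∈-lookup j))
lookup-injective (x∉ ∷ _)   (suc i) zero    eq = contradiction (sym eq) (All.lookup x∉ (∈-lookup i))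
lookup-injective (_  ∷ xs!) (suc i) (suc j) eq = cong suc (lookup-injective xs! i j eq)

-- Blocks must be numbered and nonempty, so they are the positions in the duplicate-free list of
-- values that `f` takes.
module Kernel {V : Set} (finite : Finite V) {L : Set} (_≟_ : DecidableEquality L) (f : V → L) where
  private
    open Finite finite using (elements; complete)

    values : List L
    values = deduplicate _≟_ (map f elements)

    f∈values : ∀ v → f v ∈ˡ values
    f∈values v = ∈-deduplicate⁺ _≟_ (∈-map⁺ f (complete v))

    block : V → Fin (length values)
    block v = Any.index (f∈values v)

    lookup-block : ∀ v → f v ≡ lookup values (block v)
    lookup-block v = lookup-index (f∈values v)

    lookup-inj : ∀ i j → lookup values i ≡ lookup values j → i ≡ j
    lookup-inj = lookup-injective (DecUnique.deduplicate-! _≟_ (map f elements))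

  kernel : Partition V
  kernel = record { size = length values ; blockOf = block ; nonempty = preimage }
    where
    preimage : ∀ b → ∃ λ v → block v ≡ b
    preimage b with ∈-map⁻ f (∈-deduplicate⁻ _≟_ (map f elements) (∈-lookup {xs = values} b))
    ... | v , _ , eq = v , lookup-inj _ _ (trans (sym (lookup-block v)) (sym eq))

  kernel⁺ : ∀ {v w} → f v ≡ f w → blockOf kernel v ≡ blockOf kernel w
  kernel⁺ {v} {w} eq = lookup-inj _ _ (trans (sym (lookup-block v)) (trans eq (lookup-block w)))

  kernel⁻ : ∀ {v w} → blockOf kernel v ≡ blockOf kernel w → f v ≡ f w
  kernel⁻ {v} {w} eq = trans (lookup-block v) (trans (cong (lookup values) eq) (sym (lookup-block w)))

-- Copies as subproducts, and block sizes.

Full : {U : Fin m → Set} → ∀ i → Pred (U i) 0ℓ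
Full i v = ⊤

ampleIn⇒ample : {U : Fin m → Set} {S : Pred (Tuple U) 0ℓ} → S Respects _≈_ → AmpleIn Full S → Ample U S
ampleIn⇒ample {U = U} {S} S-resp ample Λ shattered = W , copy , included
  where
  Λ′ : ∀ i → Labelling (U i)
  Λ′ i = labelling {Alive = Full {U = U} i} (λ _ → yes tt) Fin._≟_ (blockOf (Λ i))

  has-copy : HasCopy S Λ′
  has-copy = ample Λ′ (λ _ _ _ → tt) λ y _ →
    let x , x∈Box , x∈S = shattered (λ i → blockOf (Λ i) (y i)) in x , x∈S , λ i → tt , x∈Box i

  rep : ∀ i → M Λ i → U i
  rep i c = proj₁ (nonempty (Λ i) c)

  s : ∀ i → U i → U i
  s = proj₁ has-copy

  -- `s i` need not be constant on a block; evaluating it at one representative of each makes the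
  -- element of `W` in a block unique.
  W : ∀ i → Pred (U i) 0ℓ
  W i v = ∃ λ c → v ≡ s i (rep i c)

  block-s : ∀ i c → blockOf (Λ i) (s i (rep i c)) ≡ c
  block-s i c = trans (proj₂ (proj₁ (proj₂ has-copy) i (rep i c) tt)) (proj₂ (nonempty (Λ i) c))

  copy : IsCopy Λ W
  copy i c = s i (rep i c) , block-s i c , (c , refl) ,
    λ { _ ∈c (d , refl) → cong (s i ∘ rep i) (trans (sym (block-s i d)) ∈c) }

  included : Subproduct W ⊆ S
  included {x} x∈W = S-resp (λ i → sym (proj₂ (x∈W i)))
    (proj₂ (proj₂ has-copy) (λ i → rep i (proj₁ (x∈W i))) (λ _ → tt))

Fin-finite : ∀ n → Finite (Fin n)
Fin-finite n = record { _≟_ = Fin._≟_ ; elements = allFin n ; complete = ∈-allFin }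

≡-unique : {A : Set} {x y : A} (p q : x ≡ y) → p ≡ q
≡-unique refl refl = refl

block-≡ : {V : Set} {α : Partition V} {c : Fin (size α)} {x y : Σ V (Block α c)} → proj₁ x ≡ proj₁ y → x ≡ y
block-≡ {x = v , p} {y = v , q} refl = cong (v ,_) (≡-unique p q)

size-one : {V : Set} {α : Partition V} {c : Fin (size α)} → (∀ v w → Block α c v → Block α c w → v ≡ w) →
  HasSize (Block α c) 1
size-one {α = α} {c} unique = mk↔ₛ′ (λ _ → zero) (λ _ → nonempty α c) (λ { zero → refl })
  (λ (v , v∈) → block-≡ {α = α} (unique _ _ (proj₂ (nonempty α c)) v∈))

size-one⁻ : {V : Set} {α : Partition V} {c : Fin (size α)} → HasSize (Block α c) 1 →
  ∀ {v w} → Block α c v → Block α c w → v ≡ w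
size-one⁻ one v∈ w∈ = cong proj₁ (trans (sym (Inverse.strictlyInverseʳ one (_ , v∈)))
  (trans (cong (Inverse.from one) (Fin1-unique _ _)) (Inverse.strictlyInverseʳ one (_ , w∈))))
  where
  Fin1-unique : (i j : Fin 1) → i ≡ j
  Fin1-unique zero zero = refl

size-two : {V : Set} (_≟_ : DecidableEquality V) {α : Partition V} {c : Fin (size α)} {a b : V} → a ≢ b →
  Block α c a → Block α c b → (∀ v → Block α c v → v ≢ a → v ≡ b) → HasSize (Block α c) 2
size-two {V} _≟_ {α} {c} {a} {b} a≢b a∈ b∈ other = mk↔ₛ′ to from to-from from-to
  where
  to : Σ V (Block α c) → Fin 2
  to (v , _) with v ≟ a
  ... | yes _ = zero
  ... | no  _ = suc zero

  from : Fin 2 → Σ V (Block α c)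
  from zero       = a , a∈
  from (suc zero) = b , b∈

  to-from : ∀ k → to (from k) ≡ k
  to-from zero with a ≟ a
  ... | yes _  = refl
  ... | no a≢a = contradiction refl a≢a
  to-from (suc zero) with b ≟ a
  ... | yes b≡a = contradiction (sym b≡a) a≢b
  ... | no _    = refl

  from-to : ∀ x → from (to x) ≡ x
  from-to (v , v∈) with v ≟ a
  ... | yes v≡a = block-≡ {α = α} (sym v≡a)
  ... | no v≢a  = block-≡ {α = α} (sym (other v v∈ v≢a))

-- Paths and their lengths.

path-start : {U : Fin m → Set} {S : Pred (Tuple U) 0ℓ} → ∀ {k u v} → Path S k u v → u ∈ S
path-start (stop u∈S _)   = u∈S
path-start (step u∈S _ _) = u∈S

path-map : {U : Fin m → Set} {S S′ : Pred (Tuple U) 0ℓ} → S ⊆ S′ → ∀ {k u v} → Path S k u v → Path S′ k u v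
path-map S⊆S′ (stop u∈S u≈v)   = stop (S⊆S′ u∈S) u≈v
path-map S⊆S′ (step u∈S adj p) = step (S⊆S′ u∈S) adj (path-map S⊆S′ p)

path-respˡ : {U : Fin m → Set} {S : Pred (Tuple U) 0ℓ} → S Respects _≈_ →
  ∀ {k u u′ v} → u ≈ u′ → Path S k u v → Path S k u′ v
path-respˡ S-resp u≈u′ (stop u∈S u≈v) = stop (S-resp u≈u′ u∈S) λ j → trans (sym (u≈u′ j)) (u≈v j)
path-respˡ S-resp u≈u′ (step u∈S (i , u≢w , agree) p) =
  step (S-resp u≈u′ u∈S) (i , (λ eq → u≢w (trans (u≈u′ i) eq)) , λ j j≢i → trans (sym (u≈u′ j)) (agree j j≢i)) p

path-++ : {U : Fin m → Set} {S : Pred (Tuple U) 0ℓ} → S Respects _≈_ →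
  ∀ {k l u v w} → Path S k u v → Path S l v w → Path S (k + l) u w
path-++ S-resp (stop _ u≈v)     q = path-respˡ S-resp (≈-sym u≈v) q
path-++ S-resp (step u∈S adj p) q = step u∈S adj (path-++ S-resp p q)

hamming-adjacent : ∀ {m} {U : Fin m → Set} (_≟_ : ∀ i → DecidableEquality (U i)) (x y : Tuple U) →
  Adjacent x y → hamming _≟_ x y ≡ 1
hamming-adjacent _≟_ x y (zero , x≢y , agree) with _≟_ zero (x zero) (y zero)
... | yes x≡y = contradiction x≡y x≢y
... | no _    = cong suc (hamming-≈ (λ i → _≟_ (suc i)) _ _ λ i → agree (suc i) λ ())
hamming-adjacent _≟_ x y (suc i , x≢y , agree) with _≟_ zero (x zero) (y zero)
... | yes _  = hamming-adjacent (λ i → _≟_ (suc i)) _ _ (i , x≢y , λ j j≢i → agree (suc j) (j≢i ∘ Fin.suc-injective))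
... | no x≢y = contradiction (agree zero λ ()) x≢y

hamming-triangle : ∀ {m} {U : Fin m → Set} (_≟_ : ∀ i → DecidableEquality (U i)) (x y w : Tuple U) →
  hamming _≟_ x y ≤ hamming _≟_ x w + hamming _≟_ w y
hamming-triangle {zero}  _≟_ x y w = z≤n
hamming-triangle {suc m} _≟_ x y w
  with _≟_ zero (x zero) (y zero) | _≟_ zero (x zero) (w zero) | _≟_ zero (w zero) (y zero)
     | hamming-triangle (λ i → _≟_ (suc i)) (x ∘ suc) (y ∘ suc) (w ∘ suc)
... | yes _  | yes _   | yes _   | le = le
... | yes _  | yes _   | no _    | le = ℕ.≤-trans le (ℕ.+-monoʳ-≤ _ (ℕ.n≤1+n _))
... | yes _  | no _    | yes _   | le = ℕ.m≤n⇒m≤1+n le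
... | yes _  | no _    | no _    | le = ℕ.m≤n⇒m≤1+n (ℕ.≤-trans le (ℕ.+-monoʳ-≤ _ (ℕ.n≤1+n _)))
... | no x≢y | yes x≡w | yes w≡y | le = contradiction (trans x≡w w≡y) x≢y
... | no _   | yes _   | no _    | le = ℕ.≤-trans (s≤s le) (ℕ.≤-reflexive (sym (ℕ.+-suc _ _)))
... | no _   | no _    | yes _   | le = s≤s le
... | no _   | no _    | no _    | le = s≤s (ℕ.≤-trans le (ℕ.+-monoʳ-≤ _ (ℕ.n≤1+n _)))

distance≡hamming : {U : Fin m → Set} (_≟_ : ∀ i → DecidableEquality (U i)) (x y : Tuple U) →
  distance _≟_ x y ≡ hamming _≟_ x y
distance≡hamming {m} _≟_ x y = count id
  where
  count : ∀ {k} (g : Fin k → Fin m) →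
    length (filter (λ i → ¬? (_≟_ i (x i) (y i))) (tabulate g)) ≡ hamming (λ i → _≟_ (g i)) (x ∘ g) (y ∘ g)
  count {zero}  g = refl
  count {suc k} g with _≟_ (g zero) (x (g zero)) (y (g zero))
  ... | yes _ = count (g ∘ suc)
  ... | no _  = cong suc (count (g ∘ suc))

-- Passing between the product and one of its factors.

module Product {m : ℕ} {U : Fin m → Set} (finite : ∀ i → Finite (U i)) where

  infix 4 _≟_
  _≟_ : ∀ {i} → DecidableEquality (U i)
  _≟_ {i} = Finite._≟_ (finite i)

  module At (i : Fin m) (Λ : ∀ i → Labelling (U i)) where

    -- Tuples and sections of the other factors keep an arbitrary entry at `i`; `slice` overwrites
    -- it, so nothing depends on it.
    RestTuple Section : Set
    RestTuple = Σ (Tuple U) λ t → ∀ j → j ≢ i → Alive (Λ j) (t j)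
    Section = Σ (∀ j → U j → U j) λ s → ∀ j → j ≢ i → ∀ c → Alive (Λ j) c → Same (Λ j) c (s j c)

    RestBox : RestTuple → Pred (Tuple U) 0ℓ
    RestBox (t , _) x = ∀ j → j ≢ i → Same (Λ j) (t j) (x j)

    app : Section → RestTuple → Tuple U
    app (s , _) (t , _) j = s j (t j)

    open Fibres (finite i) RestBox app
      (λ (s , same) (t , al) j j≢i → same j j≢i (t j) (al j j≢i)) public

    module _ {S : Pred (Tuple U) 0ℓ} (S-resp : S Respects _≈_) where

      Hits⇒Shatters : Hits S Λ → Shatters (slice i S) (Λ i)
      Hits⇒Shatters hits (t , t-alive) c c-alive with hits (at i c t) alive
        where
        alive : ∀ j → Alive (Λ j) (at i c t j)
        alive j with j Fin.≟ i
        ... | yes refl = c-alive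
        ... | no j≢i   = t-alive j j≢i
      ... | x , x∈S , same =
        x i , subst (λ v → Same (Λ i) v (x i)) (at-≡ i) (same i) ,
        x , (λ j j≢i → subst (λ v → Same (Λ j) v (x j)) (at-≢ j≢i) (same j)) ,
        S-resp (≈-sym (at-self refl)) x∈S

      Shatters⇒Hits : ∀ {C} → Shatters (slice i S) C → Hits S (at i C Λ)
      Shatters⇒Hits {C} sh y y-alive
        with sh (y , λ j j≢i → subst (λ L → Alive L (y j)) (at-≢ j≢i) (y-alive j))
                (y i) (subst (λ L → Alive L (y i)) (at-≡ i) (y-alive i))
      ... | v , v-same , x , x∈B , x∈S = at i v x , x∈S , same
        where
        same : ∀ j → Same (at i C Λ j) (y j) (at i v x j)
        same j with j Fin.≟ i
        ... | yes refl = v-same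
        ... | no j≢i   = x∈B j j≢i

      Copies⇒HasCopy : Copies (slice i S) (Λ i) → HasCopy S Λ
      Copies⇒HasCopy ((s , s-same) , σ , h) = at i σ s , same , λ y al →
        S-resp (at-≈′ y) (proj₂ (h (y i) (al i)) (y , λ j _ → al j))
        where
        same : ∀ j c → Alive (Λ j) c → Same (Λ j) c (at i σ s j c)
        same j c al with j Fin.≟ i
        ... | yes refl = proj₁ (h c al)
        ... | no j≢i   = s-same j j≢i c al

        at-≈′ : ∀ y → at i (σ (y i)) (λ j → s j (y j)) ≈ (λ j → at i σ s j (y j))
        at-≈′ y j with j Fin.≟ i
        ... | yes refl = refl
        ... | no _     = refl

      HasCopy⇒Copies : ∀ {C} → HasCopy S (at i C Λ) → Copies (slice i S) C
      HasCopy⇒Copies {C} (s , same , inS) =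
        (s , λ j j≢i → subst (λ L → ∀ c → Alive L c → Same L c (s j c)) (at-≢ j≢i) (same j)) ,
        s i , λ c c-alive →
          subst (λ L → ∀ c → Alive L c → Same L c (s i c)) (at-≡ i) (same i) c c-alive ,
          λ (t , t-alive) → S-resp (at-≈′ c t) (inS (at i c t) (alive c c-alive t t-alive))
        where
        alive : ∀ c → Alive C c → ∀ t → (∀ j → j ≢ i → Alive (Λ j) (t j)) →
          ∀ j → Alive (at i C Λ j) (at i c t j)
        alive c c-alive t t-alive j with j Fin.≟ i
        ... | yes refl = c-alive
        ... | no j≢i   = t-alive j j≢i

        at-≈′ : ∀ c t → (λ j → s j (at i c t j)) ≈ at i (s i c) (λ j → s j (t j))
        at-≈′ c t j with j Fin.≟ i
        ... | yes refl = refl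
        ... | no _     = refl

      AmpleIn⇒Good : ∀ {Y} → (∀ j → j ≢ i → ∀ v → Alive (Λ j) v → Y j v) →
        AmpleIn Y S → Good (slice i S) (Y i)
      AmpleIn⇒Good {Y} Λ⊆Y ample C C⊆Y sh = HasCopy⇒Copies (ample (at i C Λ) sub (Shatters⇒Hits sh))
        where
        sub : ∀ j v → Alive (at i C Λ j) v → Y j v
        sub j v with j Fin.≟ i
        ... | yes refl = C⊆Y v
        ... | no j≢i   = Λ⊆Y j j≢i v

  -- Ampleness can be tested at any one factor, as long as the other partitions are arbitrary.
  Good⇒AmpleIn : ∀ i {Y S} → S Respects _≈_ →
    (∀ Λ → (∀ j → j ≢ i → ∀ v → Alive (Λ j) v → Y j v) → At.Good i Λ (slice i S) (Y i)) →
    AmpleIn Y S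
  Good⇒AmpleIn i S-resp good Λ Λ⊆Y hits =
    At.Copies⇒HasCopy i Λ S-resp
      (good Λ (λ j _ → Λ⊆Y j) (Λ i) (Λ⊆Y i) (At.Hits⇒Shatters i Λ S-resp hits))

  up-resp : ∀ (S : Pred (Tuple U) 0ℓ) i a b → S Respects _≈_ → up S i a b Respects _≈_
  up-resp S i a b S-resp {x} {y} x≈y (x∈S , both) =
    S-resp x≈y x∈S , λ y≡a → S-resp (at-cong {x = x} {z = y} λ j _ → x≈y j) (both (trans (x≈y i) y≡a))

  lo-resp : ∀ (S : Pred (Tuple U) 0ℓ) i a b → S Respects _≈_ → lo S i a b Respects _≈_
  lo-resp S i a b S-resp {x} {y} x≈y (inj₁ x∈S)          = inj₁ (S-resp x≈y x∈S)
  lo-resp S i a b S-resp {x} {y} x≈y (inj₂ (x≡a , xb∈S)) =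
    inj₂ (trans (sym (x≈y i)) x≡a , S-resp (at-cong {x = x} {z = y} λ j _ → x≈y j) xb∈S)

  module Slices {S : Pred (Tuple U) 0ℓ} (S-resp : S Respects _≈_) (i : Fin m) (Λ : ∀ i → Labelling (U i)) where
    private
      module F = At i Λ

    slice-up⁺ : ∀ {a b} v x → F.upᶠ (slice i S) a b v x → slice i (up S i a b) v x
    slice-up⁺ v x (x∈v , both) =
      x∈v , λ v≡a → S-resp (≈-sym at-at) (both (trans (sym (at-≡ i)) v≡a))

    slice-up⁻ : ∀ {a b} v x → slice i (up S i a b) v x → F.upᶠ (slice i S) a b v x
    slice-up⁻ v x (x∈v , both) = x∈v , λ v≡a → S-resp at-at (both (trans (at-≡ i) v≡a))

    slice-lo⁺ : ∀ {a b} v x → F.loᶠ (slice i S) a b v x → slice i (lo S i a b) v x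
    slice-lo⁺ v x (inj₁ x∈v)         = inj₁ x∈v
    slice-lo⁺ v x (inj₂ (v≡a , x∈b)) = inj₂ (trans (at-≡ i) v≡a , S-resp (≈-sym at-at) x∈b)

    slice-lo⁻ : ∀ {a b} v x → slice i (lo S i a b) v x → F.loᶠ (slice i S) a b v x
    slice-lo⁻ v x (inj₁ x∈v)         = inj₁ x∈v
    slice-lo⁻ v x (inj₂ (v≡a , x∈b)) = inj₂ (trans (sym (at-≡ i)) v≡a , S-resp at-at x∈b)

  ∖⁻ : ∀ (Y : ∀ i → Pred (U i) 0ℓ) {i b v} → (Y ∖[ i , b ]) i v → Y i v × v ≢ b
  ∖⁻ Y (v∈Y , ≢ib) = v∈Y , λ { refl → ≢ib refl }

  ∖⁺ : ∀ (Y : ∀ i → Pred (U i) 0ℓ) {i b v} → Y i v × v ≢ b → (Y ∖[ i , b ]) i v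
  ∖⁺ Y (v∈Y , v≢b) = v∈Y , λ { refl → v≢b refl }

  module _ {S : Pred (Tuple U) 0ℓ} (S-resp : S Respects _≈_) where

    AmpleIn-up⇒Good : ∀ {Y i a b Λ} → (∀ j → j ≢ i → ∀ v → Alive (Λ j) v → Y j v) →
      AmpleIn (Y ∖[ i , b ]) (up S i a b) →
      At.Good i Λ (At.upᶠ i Λ (slice i S) a b) (At._∖_ i Λ (Y i) b)
    AmpleIn-up⇒Good {Y} {i} {a} {b} {Λ} Λ⊆Y ample =
      At.Good-cong i Λ (λ v → ∖⁺ Y) (λ v x _ → slice-up⁻ v x) (λ v x _ → slice-up⁺ v x)
        (At.AmpleIn⇒Good i Λ (up-resp S i a b S-resp)
          (λ j j≢i v al → Λ⊆Y j j≢i v al , λ { refl → j≢i refl }) ample)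
      where open Slices S-resp i Λ

    AmpleIn-lo⇒Good : ∀ {Y i a b Λ} → (∀ j → j ≢ i → ∀ v → Alive (Λ j) v → Y j v) →
      AmpleIn (Y ∖[ i , b ]) (lo S i a b) →
      At.Good i Λ (At.loᶠ i Λ (slice i S) a b) (At._∖_ i Λ (Y i) b)
    AmpleIn-lo⇒Good {Y} {i} {a} {b} {Λ} Λ⊆Y ample =
      At.Good-cong i Λ (λ v → ∖⁺ Y) (λ v x _ → slice-lo⁻ v x) (λ v x _ → slice-lo⁺ v x)
        (At.AmpleIn⇒Good i Λ (lo-resp S i a b S-resp)
          (λ j j≢i v al → Λ⊆Y j j≢i v al , λ { refl → j≢i refl }) ample)
      where open Slices S-resp i Λ

    Good⇒AmpleIn-up : ∀ {Y i a b} →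
      (∀ Λ → (∀ j → j ≢ i → ∀ v → Alive (Λ j) v → Y j v) →
        At.Good i Λ (At.upᶠ i Λ (slice i S) a b) (At._∖_ i Λ (Y i) b)) →
      AmpleIn (Y ∖[ i , b ]) (up S i a b)
    Good⇒AmpleIn-up {Y} {i} {a} {b} good = Good⇒AmpleIn i (up-resp S i a b S-resp) λ Λ Λ⊆ →
      let open Slices S-resp i Λ
      in At.Good-cong i Λ (λ v → ∖⁻ Y) (λ v x _ → slice-up⁺ v x) (λ v x _ → slice-up⁻ v x)
           (good Λ λ j j≢i v al → proj₁ (Λ⊆ j j≢i v al))

    Good⇒AmpleIn-lo : ∀ {Y i a b} →
      (∀ Λ → (∀ j → j ≢ i → ∀ v → Alive (Λ j) v → Y j v) →
        At.Good i Λ (At.loᶠ i Λ (slice i S) a b) (At._∖_ i Λ (Y i) b)) →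
      AmpleIn (Y ∖[ i , b ]) (lo S i a b)
    Good⇒AmpleIn-lo {Y} {i} {a} {b} good = Good⇒AmpleIn i (lo-resp S i a b S-resp) λ Λ Λ⊆ →
      let open Slices S-resp i Λ
      in At.Good-cong i Λ (λ v → ∖⁻ Y) (λ v x _ → slice-lo⁺ v x) (λ v x _ → slice-lo⁻ v x)
           (good Λ λ j j≢i v al → proj₁ (Λ⊆ j j≢i v al))

    AmpleIn-up : ∀ {Y i a b} → a ≢ b → Y i b → AmpleIn Y S → AmpleIn (Y ∖[ i , b ]) (up S i a b)
    AmpleIn-up {i = i} a≢b b∈Y ample = Good⇒AmpleIn-up λ Λ Λ⊆Y →
      At.Good-up i Λ a≢b b∈Y (At.AmpleIn⇒Good i Λ S-resp Λ⊆Y ample)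

    AmpleIn-lo : ∀ {Y i a b} → a ≢ b → Y i b → AmpleIn Y S → AmpleIn (Y ∖[ i , b ]) (lo S i a b)
    AmpleIn-lo {i = i} a≢b b∈Y ample = Good⇒AmpleIn-lo λ Λ Λ⊆Y →
      At.Good-lo i Λ a≢b b∈Y (At.AmpleIn⇒Good i Λ S-resp Λ⊆Y ample)

  -- Isometricity and coverings by two slices.

  dist : Tuple U → Tuple U → ℕ
  dist = hamming (λ i → _≟_ {i})

  dist-<ʳ : ∀ {x y t} → Between x y t → (∃ λ k → t k ≢ y k) → dist x t < dist x y
  dist-<ʳ {x} {y} {t} btw (k , t≢y) rewrite hamming-between (λ i → _≟_ {i}) x y t btw =
    ℕ.m<m+n (dist x t) (hamming-pos (λ i → _≟_ {i}) t y k t≢y)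

  dist-<ˡ : ∀ {x y t} → Between x y t → (∃ λ k → x k ≢ t k) → dist t y < dist x y
  dist-<ˡ {x} {y} {t} btw (k , x≢t) rewrite hamming-between (λ i → _≟_ {i}) x y t btw =
    ℕ.m<n+m (dist t y) (hamming-pos (λ i → _≟_ {i}) x t k x≢t)

  -- Keep the two values apart in coordinate `i` and put them into one block elsewhere: `x` and `y`
  -- hit the two boxes, and a copy is a pair of points of `S` differing only at `i`.
  AmpleIn⇒Switching : ∀ {Y S} → S Respects _≈_ → AmpleIn Y S → Switching Y S
  AmpleIn⇒Switching {Y} {S} S-resp ample {x} {y} x∈S y∈S x∈Y y∈Y i x≢y = switch (ample Λ Λ⊆Y hits)
    where
    Λ : ∀ j → Labelling (U j)
    Λ j = labelling {Alive = λ v → v ≡ x j ⊎ v ≡ y j} (λ v → (v ≟ x j) ⊎-dec (v ≟ y j)) (_≟_ {j}) (collapse j)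
      where
      collapse : ∀ j → U j → U j
      collapse j v with j Fin.≟ i
      ... | yes _ = v
      ... | no  _ = x j

    Λ⊆Y : ∀ j v → v ≡ x j ⊎ v ≡ y j → Y j v
    Λ⊆Y j v (inj₁ refl) = x∈Y j
    Λ⊆Y j v (inj₂ refl) = y∈Y j

    label-i : ∀ {u v} → label (Λ i) u ≡ label (Λ i) v → u ≡ v
    label-i eq with i Fin.≟ i
    ... | yes _  = eq
    ... | no i≢i = contradiction refl i≢i

    same-label : ∀ {u v} → u i ≡ v i → ∀ j → label (Λ j) (u j) ≡ label (Λ j) (v j)
    same-label u≡v j with j Fin.≟ i
    ... | yes refl = u≡v
    ... | no _     = refl

    hits : Hits S Λ
    hits t t-alive with t-alive i
    ... | inj₁ t≡x = x , x∈S , λ j → inj₁ refl , same-label {x} {t} (sym t≡x) j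
    ... | inj₂ t≡y = y , y∈S , λ j → inj₂ refl , same-label {y} {t} (sym t≡y) j

    switch : HasCopy S Λ → _
    switch (s , same , inS) =
      (λ j → s j (x j)) , (λ j → proj₁ (same j (x j) (inj₁ refl))) ,
      S-resp (≈-sym (at-self (sym (label-i (proj₂ (same i (x i) (inj₁ refl))))))) (inS x (λ _ → inj₁ refl)) ,
      S-resp eq (inS (at i (y i) x) alive)
      where
      alive : ∀ j → Alive (Λ j) (at i (y i) x j)
      alive j with j Fin.≟ i
      ... | yes refl = inj₂ refl
      ... | no _     = inj₁ refl

      eq : (λ j → s j (at i (y i) x j)) ≈ at i (y i) (λ j → s j (x j))
      eq j with j Fin.≟ i
      ... | yes refl = label-i (proj₂ (same i (y i) (inj₂ refl)))
      ... | no _     = refl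

  -- In a counterexample with x and y at minimal distance the cube between them
  -- lies in up S i a b except for the antipodes x and y.  Merging one coordinate
  -- of the cube shows that this is not ample.
  no-antipodes : ∀ {Y S i a b} → S Respects _≈_ → Decidable S → a ≢ b → Y i b → Switching Y S →
    AmpleIn (Y ∖[ i , b ]) (up S i a b) →
    ∀ n x y → dist x y < n → x i ≡ a → y i ≡ a → (∀ j → Y j (x j)) → (∀ j → Y j (y j)) →
    (∀ t → Between x y t → t ∈ S ⊎ at i b t ∈ S) → ¬ (at i b x ∈ S) → ¬ (y ∈ S) → ⊥
  no-antipodes {Y} {S} {i} {a} {b} S-resp S? a≢b b∈Y switching ample = go
    where
    go : ∀ n x y → dist x y < n → x i ≡ a → y i ≡ a → (∀ j → Y j (x j)) → (∀ j → Y j (y j)) →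
      (∀ t → Between x y t → t ∈ S ⊎ at i b t ∈ S) → ¬ (at i b x ∈ S) → ¬ (y ∈ S) → ⊥
    go (suc n) x y (s≤s d≤n) x≡a y≡a x∈Y y∈Y cover xb∉S y∉S =
      conclude (Fin.any? λ j → ¬? (x j ≟ y j))
      where
      x∈S : x ∈ S
      x∈S = [ id , (λ xb∈S → contradiction xb∈S xb∉S) ]′ (cover x λ _ → inj₁ refl)

      yb∈S : at i b y ∈ S
      yb∈S = [ (λ y∈S → contradiction y∈S y∉S) , id ]′ (cover y λ _ → inj₂ refl)

      between-i : ∀ {t} → Between x y t → t i ≡ a
      between-i btw = [ (λ eq → trans eq x≡a) , (λ eq → trans eq y≡a) ]′ (btw i)

      between-Y : ∀ {t} → Between x y t → ∀ j → Y j (t j)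
      between-Y btw j = [ (λ eq → subst (Y j) (sym eq) (x∈Y j)) , (λ eq → subst (Y j) (sym eq) (y∈Y j)) ]′ (btw j)

      -- By minimality: `t` missing from `S` gives the smaller counterexample `x`, `t`, and
      -- `at i b t` missing from `S` gives `t`, `y`.
      interior : ∀ t → Between x y t → (∃ λ k → x k ≢ t k) → (∃ λ k → t k ≢ y k) → t ∈ up S i a b
      interior t btw t≢x t≢y =
        decidable-stable (S? t) (λ t∉S →
          go n x t (ℕ.<-≤-trans (dist-<ʳ btw t≢y) d≤n) x≡a (between-i btw) x∈Y (between-Y btw)
            (λ u btw′ → cover u λ j → [ inj₁ , (λ eq → Sum.map (trans eq) (trans eq) (btw j)) ]′ (btw′ j))
            xb∉S t∉S) ,
        λ _ → decidable-stable (S? (at i b t)) λ tb∉S →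
          go n t y (ℕ.<-≤-trans (dist-<ˡ btw t≢x) d≤n) (between-i btw) y≡a (between-Y btw) y∈Y
            (λ u btw′ → cover u λ j → [ (λ eq → Sum.map (trans eq) (trans eq) (btw j)) , inj₂ ]′ (btw′ j))
            tb∉S y∉S

      -- In dimension one, `x` and `at i b y` are at distance two, and a geodesic between them
      -- passes through `at i b x` or `y`, neither of which is in `S`.
      adjacent : ∀ j → x j ≢ y j → ¬ (∃ λ k → k ≢ j × x k ≢ y k) → ⊥
      adjacent j x≢y only-j =
        let w , btw , w∈a , w∈b = switching x∈S yb∈S x∈Y yb∈Y i
              (λ eq → a≢b (trans (sym x≡a) (trans eq (at-≡ i))))
        in [ (λ w≡x → xb∉S (S-resp (at-≈ (sym (at-≡ i)) λ k k≢i →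
                 trans (toward-x w btw w≡x k k≢i) (sym (at-≢ k≢i)))
               (subst (λ v → at i v w ∈ S) (at-≡ i) w∈b)))
           , (λ w≡y → y∉S (S-resp (at-≈ (trans x≡a (sym y≡a)) (toward-y w btw (trans w≡y (at-≢ j≢i)))) w∈a))
           ]′ (btw j)
        where
        j≢i : j ≢ i
        j≢i refl = x≢y (trans x≡a (sym y≡a))

        agree : ∀ k → k ≢ j → x k ≡ y k
        agree k k≢j = decidable-stable (x k ≟ y k) λ x≢y → only-j (k , k≢j , x≢y)

        yb∈Y : ∀ k → Y k (at i b y k)
        yb∈Y k with k Fin.≟ i
        ... | yes refl = b∈Y
        ... | no _     = y∈Y k

        toward-x : ∀ w → Between x (at i b y) w → w j ≡ x j → ∀ k → k ≢ i → w k ≡ x k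
        toward-x w btw w≡x k k≢i with k Fin.≟ j
        ... | yes refl = w≡x
        ... | no k≢j   = [ id , (λ eq → trans eq (trans (at-≢ k≢i) (sym (agree k k≢j)))) ]′ (btw k)

        toward-y : ∀ w → Between x (at i b y) w → w j ≡ y j → ∀ k → k ≢ i → w k ≡ y k
        toward-y w btw w≡y k k≢i with k Fin.≟ j
        ... | yes refl = w≡y
        ... | no k≢j   = [ (λ eq → trans eq (agree k k≢j)) , (λ eq → trans eq (at-≢ k≢i)) ]′ (btw k)

      -- With only coordinate `j` merged, each box has two points, and one of them is no antipode
      -- since a second coordinate varies. A copy, however, fixes its value at `j` and thereby
      -- contains an antipode.
      cube : ∀ j → x j ≢ y j → (∃ λ k → k ≢ j × x k ≢ y k) → ⊥
      cube j x≢y (j₁ , j₁≢j , x≢y₁) = impossible (ample Λ Λ⊆Y hits)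
        where
        collapse : ∀ k → U k → U k
        collapse k v with k Fin.≟ j
        ... | yes _ = x k
        ... | no  _ = v

        collapse-≢ : ∀ k {u v} → k ≢ j → collapse k u ≡ collapse k v → u ≡ v
        collapse-≢ k k≢j eq with k Fin.≟ j
        ... | yes k≡j = contradiction k≡j k≢j
        ... | no  _   = eq

        Λ : ∀ k → Labelling (U k)
        Λ k = labelling {Alive = λ v → v ≡ x k ⊎ v ≡ y k}
          (λ v → (v ≟ x k) ⊎-dec (v ≟ y k)) (_≟_ {k}) (collapse k)

        Λ⊆Y : ∀ k v → v ≡ x k ⊎ v ≡ y k → (Y ∖[ i , b ]) k v
        Λ⊆Y k v (inj₁ refl) = x∈Y k , λ { refl → a≢b (sym x≡a) }
        Λ⊆Y k v (inj₂ refl) = y∈Y k , λ { refl → a≢b (sym y≡a) }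

        same-at : ∀ c t k → collapse k (at j c t k) ≡ collapse k (t k)
        same-at c t k with k Fin.≟ j
        ... | yes _ = refl
        ... | no _  = refl

        btw-at : ∀ {c t} → c ≡ x j ⊎ c ≡ y j → Between x y t → Between x y (at j c t)
        btw-at c∈ btw k with k Fin.≟ j
        ... | yes refl = c∈
        ... | no _     = btw k

        hits : Hits (up S i a b) Λ
        hits t btw with Fin.any? (λ k → ¬? (k Fin.≟ j) ×-dec ¬? (x k ≟ t k))
        ... | yes (k , k≢j , x≢t) = at j (x j) t ,
          interior _ btw′ (k , λ eq → x≢t (trans eq (at-≢ k≢j))) (j , λ eq → x≢y (trans (sym (at-≡ j)) eq)) ,
          λ k → btw′ k , same-at (x j) t k
          where btw′ = btw-at (inj₁ refl) btw
        ... | no none = at j (y j) t ,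
          interior _ btw′ (j , λ eq → x≢y (trans eq (at-≡ j)))
            (j₁ , λ eq → x≢y₁ (trans (agree j₁ j₁≢j) (trans (sym (at-≢ j₁≢j)) eq))) ,
          λ k → btw′ k , same-at (y j) t k
          where
          btw′ = btw-at (inj₂ refl) btw
          agree : ∀ k → k ≢ j → x k ≡ t k
          agree k k≢j = decidable-stable (x k ≟ t k) λ x≢t → none (k , k≢j , x≢t)

        impossible : HasCopy (up S i a b) Λ → ⊥
        impossible (s , same , inS) with proj₁ (same j (x j) (inj₁ refl))
        ... | inj₁ s≡x = xb∉S (S-resp (at-cong λ k _ → sx≈x k) (proj₂ (inS x λ _ → inj₁ refl) (trans (sx≈x i) x≡a)))
          where
          sx≈x : (λ k → s k (x k)) ≈ x
          sx≈x k with k Fin.≟ j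
          ... | yes refl = s≡x
          ... | no k≢j   = collapse-≢ k k≢j (proj₂ (same k (x k) (inj₁ refl)))
        ... | inj₂ s≡y = y∉S (S-resp sy≈y (proj₁ (inS (at j (x j) y) (btw-at (inj₁ refl) λ _ → inj₂ refl))))
          where
          sy≈y : (λ k → s k (at j (x j) y k)) ≈ y
          sy≈y k with k Fin.≟ j
          ... | yes refl = s≡y
          ... | no k≢j   = collapse-≢ k k≢j (proj₂ (same k (y k) (inj₂ refl)))

      conclude : Dec (∃ λ j → x j ≢ y j) → ⊥
      conclude (no equal) = y∉S (S-resp (λ j → decidable-stable (x j ≟ y j) λ x≢y → equal (j , x≢y)) x∈S)
      conclude (yes (j , x≢y)) with Fin.any? (λ k → ¬? (k Fin.≟ j) ×-dec ¬? (x k ≟ y k))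
      ... | yes second = cube j x≢y second
      ... | no none    = adjacent j x≢y none

  module _ {Y S} (S-resp : S Respects _≈_) (switching : Switching {U = U} Y S)
    {i : Fin m} {Λ : ∀ i → Labelling (U i)} (Λ⊆Y : ∀ j → j ≢ i → ∀ v → Alive (Λ j) v → Y j v)
    where
    open At i Λ

    private
      at∈Y : ∀ {v x} → Y i v → (∀ j → j ≢ i → Alive (Λ j) (x j)) → ∀ j → Y j (at i v x j)
      at∈Y v∈Y al j with j Fin.≟ i
      ... | yes refl = v∈Y
      ... | no j≢i   = Λ⊆Y j j≢i _ (al j j≢i)

    switches : ∀ {a b} → a ≢ b → Y i a → Y i b → Switches (slice i S) a b
    switches {a} {b} a≢b a∈Y b∈Y t (x , x∈B , x∈a) (y , y∈B , y∈b) =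
      let w , btw , w∈a , w∈b = switching x∈a y∈b
            (at∈Y a∈Y λ j j≢i → proj₁ (x∈B j j≢i)) (at∈Y b∈Y λ j j≢i → proj₁ (y∈B j j≢i))
            i (λ eq → a≢b (trans (sym (at-≡ i)) (trans eq (at-≡ i))))
      in w , (λ j j≢i → [ (λ eq → subst (Same (Λ j) _) (sym (trans eq (at-≢ j≢i))) (x∈B j j≢i))
                        , (λ eq → subst (Same (Λ j) _) (sym (trans eq (at-≢ j≢i))) (y∈B j j≢i)) ]′ (btw j)) ,
         subst (λ v → at i v w ∈ S) (at-≡ i) w∈a , subst (λ v → at i v w ∈ S) (at-≡ i) w∈b

    -- A tuple missing at `a` and one missing at `b` would give the antipodes excluded by
    -- `no-antipodes`: a point between them takes each coordinate from one of the two, so it is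
    -- again a value of the section and is covered.
    merges : Decidable S → ∀ {a b} → a ≢ b → Y i a → Y i b →
      AmpleIn (Y ∖[ i , b ]) (up S i a b) → Merges (slice i S) a b
    merges S? {a} {b} a≢b a∈Y b∈Y ample section@(s , same) fills = decide (missing a) (missing b)
      where
      Missing : U i → Pred (Tuple U) 0ℓ
      Missing c t = (∀ j → j ≢ i → Alive (Λ j) (t j)) × ¬ (at i c (λ j → s j (t j)) ∈ S)

      missing : ∀ c → Dec (∃ (Missing c))
      missing c = search-tuples finite
        (λ {x} {y} x≈y (al , ∉S) → (λ j j≢i → subst (Alive (Λ j)) (x≈y j) (al j j≢i)) ,
           λ ∈S → ∉S (S-resp (at-cong λ j _ → cong (s j) (sym (x≈y j))) ∈S))
        (λ t → Fin.all? (λ j → ¬? (j Fin.≟ i) →-dec alive? (Λ j) (t j)) ×-dec ¬? (S? _))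

      full : ∀ {c} → ¬ ∃ (Missing c) → section Fills slice i S c
      full none (t , al) = decidable-stable (S? _) λ ∉S → none (t , al , ∉S)

      decide : Dec (∃ (Missing a)) → Dec (∃ (Missing b)) → section Fills slice i S a ⊎ section Fills slice i S b
      decide (no none) _ = inj₁ (full none)
      decide _ (no none) = inj₂ (full none)
      decide (yes (u , u-alive , ua∉S)) (yes (v , v-alive , vb∉S)) =
        ⊥-elim (no-antipodes S-resp S? a≢b b∈Y switching ample _ x y ℕ.≤-refl (at-≡ i) (at-≡ i)
          (at∈Y a∈Y λ j j≢i → proj₁ (same j j≢i _ (v-alive j j≢i)))
          (at∈Y a∈Y λ j j≢i → proj₁ (same j j≢i _ (u-alive j j≢i)))
          cover (λ xb∈S → vb∉S (S-resp at-at xb∈S)) ua∉S)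
        where
        x y : Tuple U
        x = at i a (λ j → s j (v j))
        y = at i a (λ j → s j (u j))

        cover : ∀ t → Between x y t → t ∈ S ⊎ at i b t ∈ S
        cover t btw = Sum.map (S-resp (at-≈ (sym t≡a) λ j → proj₂ ∘ r-spec j)) (S-resp (at-cong λ j → proj₂ ∘ r-spec j))
                        (fills (r , λ j → proj₁ ∘ r-spec j))
          where
          r : Tuple U
          r j = [ const (v j) , const (u j) ]′ (btw j)

          t≡a : t i ≡ a
          t≡a = [ (λ eq → trans eq (at-≡ i)) , (λ eq → trans eq (at-≡ i)) ]′ (btw i)

          r-spec : ∀ j → j ≢ i → Alive (Λ j) (r j) × s j (r j) ≡ t j
          r-spec j j≢i with btw j
          ... | inj₁ eq = v-alive j j≢i , sym (trans eq (at-≢ j≢i))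
          ... | inj₂ eq = u-alive j j≢i , sym (trans eq (at-≢ j≢i))

  -- Inheritance of isometricity and of condition (3) by `lo`.

  module FoldMap {i : Fin m} (a b : U i) where
    open Finite (finite i) using (merge)

    fold : ∀ j → U j → U j
    fold = at i (merge b a) (λ _ → id)

    fold-≢ : ∀ {j v} → j ≢ i → fold j v ≡ v
    fold-≢ {j} j≢i with j Fin.≟ i
    ... | yes j≡i = contradiction j≡i j≢i
    ... | no  _   = refl

    fold-i : ∀ v → fold i v ≡ merge b a v
    fold-i v with i Fin.≟ i
    ... | yes refl = refl
    ... | no i≢i   = contradiction refl i≢i

  module Fold {Y : ∀ i → Pred (U i) 0ℓ} {S : Pred (Tuple U) 0ℓ} (S-resp : S Respects _≈_)
    {i : Fin m} {a b : U i} (a≢b : a ≢ b) (a∈Y : Y i a) (b∈Y : Y i b) where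
    open FoldMap a b
    open Finite (finite i) using (merge; merge-≡; merge-≢)

    fold-lo : ∀ {z} → z ∈ S → (λ j → fold j (z j)) ∈ lo S i a b
    fold-lo {z} z∈S with z i ≟ b
    ... | yes z≡b = inj₂ (trans (fold-i _) (trans (cong (merge b a) z≡b) (merge-≡ b a)) ,
                          S-resp (≈-sym (at-≈ (sym z≡b) λ j j≢i → fold-≢ j≢i)) z∈S)
    ... | no z≢b  = inj₁ (S-resp same z∈S)
      where
      same : ∀ j → z j ≡ fold j (z j)
      same j with j Fin.≟ i
      ... | yes refl = sym (merge-≢ z≢b)
      ... | no _     = refl

    lift : ∀ {x} → x ∈ lo S i a b → (∀ j → (Y ∖[ i , b ]) j (x j)) →
      ∃ λ x′ → x′ ∈ S × (∀ j → Y j (x′ j)) × (∀ j → fold j (x′ j) ≡ x j)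
    lift {x} (inj₁ x∈S) x∈Y = x , x∈S , (λ j → proj₁ (x∈Y j)) , same
      where
      same : ∀ j → fold j (x j) ≡ x j
      same j with j Fin.≟ i
      ... | yes refl = merge-≢ (proj₂ (∖⁻ Y (x∈Y i)))
      ... | no _     = refl
    lift {x} (inj₂ (x≡a , xb∈S)) x∈Y = at i b x , xb∈S , in-Y , same
      where
      in-Y : ∀ j → Y j (at i b x j)
      in-Y j with j Fin.≟ i
      ... | yes refl = b∈Y
      ... | no _     = proj₁ (x∈Y j)

      same : ∀ j → fold j (at i b x j) ≡ x j
      same j with j Fin.≟ i
      ... | yes refl = trans (merge-≡ b a) (sym x≡a)
      ... | no _     = refl

    -- `lo` is the image of `S` under `fold`, and folding preserves betweenness; so a switch between
    -- lifted points folds down to a switch in `lo`.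
    lo-switching : Switching Y S → Switching (Y ∖[ i , b ]) (lo S i a b)
    lo-switching switching {x} {y} x∈lo y∈lo x∈Y y∈Y k x≢y =
      let x′ , x′∈S , x′∈Y , fx = lift x∈lo x∈Y
          y′ , y′∈S , y′∈Y , fy = lift y∈lo y∈Y
          w , btw , w∈x , w∈y = switching x′∈S y′∈S x′∈Y y′∈Y k
            (λ eq → x≢y (trans (sym (fx k)) (trans (cong (fold k) eq) (fy k))))
      in (λ j → fold j (w j)) ,
         (λ j → Sum.map (λ eq → trans (cong (fold j) eq) (fx j)) (λ eq → trans (cong (fold j) eq) (fy j)) (btw j)) ,
         lo-resp S i a b S-resp (fold-at k (fx k)) (fold-lo w∈x) ,
         lo-resp S i a b S-resp (fold-at k (fy k)) (fold-lo w∈y)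
      where
      fold-at : ∀ k {v u w} → fold k v ≡ u → (λ j → fold j (at k v w j)) ≈ at k u (λ j → fold j (w j))
      fold-at k eq j with j Fin.≟ k
      ... | yes refl = eq
      ... | no _     = refl

  AmpleIn-cong : ∀ {Y Y′ S S′} → (∀ i v → Y′ i v → Y i v) →
    (∀ x → (∀ i → Y′ i (x i)) → x ∈ S → x ∈ S′) → (∀ x → (∀ i → Y′ i (x i)) → x ∈ S′ → x ∈ S) →
    AmpleIn {U = U} Y S → AmpleIn Y′ S′
  AmpleIn-cong Y′⊆Y to from ample Λ Λ⊆Y′ hits =
    let s , same , inS = ample Λ (λ i v → Y′⊆Y i v ∘ Λ⊆Y′ i v) λ y al →
          let x , x∈S′ , x-same = hits y al
          in x , from x (λ i → Λ⊆Y′ i _ (proj₁ (x-same i))) x∈S′ , x-same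
    in s , same , λ y al → to _ (λ i → Λ⊆Y′ i _ (proj₁ (same i _ (al i)))) (inS y al)

  at-swap : ∀ {i j} {v : U i} {w : U j} {x : Tuple U} → i ≢ j → at i v (at j w x) ≈ at j w (at i v x)
  at-swap {i} {j} i≢j k with k Fin.≟ i | k Fin.≟ j
  ... | yes refl | yes refl = contradiction refl i≢j
  ... | yes refl | no k≢j   = sym (at-≡ k)
  ... | no k≢i   | yes refl = at-≡ k
  ... | no k≢i   | no k≢j   = trans (at-≢ k≢j) (sym (at-≢ k≢i))

  module _ {Y S} (S-resp : S Respects _≈_) (switching : Switching {U = U} Y S)
    {i : Fin m} {a b : U i} (a≢b : a ≢ b) (a∈Y : Y i a) (b∈Y : Y i b)
    {j : Fin m} (j≢i : j ≢ i) {g h : U j} (h∈Y : Y j h) where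

    lo-up⇒up-lo : ∀ x → x ∈ lo (up S j g h) i a b → x ∈ up (lo S i a b) j g h
    lo-up⇒up-lo x (inj₁ (x∈S , both))          = inj₁ x∈S , inj₁ ∘ both
    lo-up⇒up-lo x (inj₂ (x≡a , xb∈S , both)) =
      inj₂ (x≡a , xb∈S) , λ x≡g → inj₂ (trans (at-≢ (j≢i ∘ sym)) x≡a ,
        S-resp (at-swap j≢i) (both (trans (at-≢ j≢i) x≡g)))

    -- The points `x` and `at j h x` may lie in `lo` for different reasons, one with the value `a`
    -- and one with the value `b`. They then give opposite corners of a square in factors `i` and
    -- `j`, and isometricity supplies a third corner, hence a side in `S` with one value throughout.
    up-lo⇒lo-up : ∀ x → (∀ k → Y k (x k)) → x ∈ up (lo S i a b) j g h → x ∈ lo (up S j g h) i a b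
    up-lo⇒lo-up x x∈Y (x∈lo , both) with x j ≟ g
    ... | no x≢g = [ (λ x∈S → inj₁ (x∈S , λ x≡g → contradiction x≡g x≢g))
                   , (λ (x≡a , xb∈S) → inj₂ (x≡a , xb∈S , λ xb≡g → contradiction (trans (sym (at-≢ j≢i)) xb≡g) x≢g))
                   ]′ x∈lo
    ... | yes x≡g = combine x∈lo (both x≡g)
      where
      xh∈Y : ∀ k → Y k (at j h x k)
      xh∈Y k with k Fin.≟ j
      ... | yes refl = h∈Y
      ... | no _     = x∈Y k

      at-b∈Y : ∀ {y} → (∀ k → Y k (y k)) → ∀ k → Y k (at i b y k)
      at-b∈Y y∈Y k with k Fin.≟ i
      ... | yes refl = b∈Y
      ... | no _     = y∈Y k

      -- Switching coordinate i between x and at j h x, one of which is moved to b.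
      crossing : ∀ {c d} w → (∀ k → k ≢ i → w k ≡ x k ⊎ w k ≡ at j h x k) →
        at i c w ∈ S → at i d w ∈ S → at i c x ∈ S × at i d x ∈ S ⊎ at i c (at j h x) ∈ S × at i d (at j h x) ∈ S
      crossing w btw w∈c w∈d with btw j j≢i
      ... | inj₁ w≡x = inj₁ (S-resp (at-cong agree) w∈c , S-resp (at-cong agree) w∈d)
        where
        agree : ∀ k → k ≢ i → w k ≡ x k
        agree k k≢i with k Fin.≟ j
        ... | yes refl = w≡x
        ... | no k≢j   = [ id , (λ eq → trans eq (at-≢ k≢j)) ]′ (btw k k≢i)
      ... | inj₂ w≡h = inj₂ (S-resp (at-cong agree) w∈c , S-resp (at-cong agree) w∈d)
        where
        agree : ∀ k → k ≢ i → w k ≡ at j h x k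
        agree k k≢i with k Fin.≟ j
        ... | yes refl = trans w≡h (at-≡ k)
        ... | no k≢j   = [ id , (λ eq → trans eq (at-≢ k≢j)) ]′ (btw k k≢i)

      combine : x ∈ lo S i a b → at j h x ∈ lo S i a b → x ∈ lo (up S j g h) i a b
      combine (inj₁ x∈S) (inj₁ xh∈S) = inj₁ (x∈S , λ _ → xh∈S)
      combine (inj₂ (x≡a , xb∈S)) (inj₂ (_ , xhb∈S)) =
        inj₂ (x≡a , xb∈S , λ _ → S-resp (at-swap (j≢i ∘ sym)) xhb∈S)
      combine (inj₁ x∈S) (inj₂ (xh≡a , xhb∈S)) =
        let x≡a = trans (sym (at-≢ (j≢i ∘ sym))) xh≡a
            w , btw , w∈x , w∈b = switching x∈S xhb∈S x∈Y (at-b∈Y xh∈Y) i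
              (λ eq → a≢b (trans (sym x≡a) (trans eq (at-≡ i))))
        in [ (λ (_ , xb∈S) → inj₂ (x≡a , xb∈S , λ _ → S-resp (at-swap (j≢i ∘ sym)) xhb∈S))
           , (λ (xha∈S , _) → inj₁ (x∈S , λ _ → S-resp (at-self (sym xh≡a)) xha∈S))
           ]′ (crossing {a} {b} w (λ k k≢i → Sum.map₂ (λ eq → trans eq (at-≢ k≢i)) (btw k))
                (subst (λ v → at i v w ∈ S) x≡a w∈x) (subst (λ v → at i v w ∈ S) (at-≡ i) w∈b))
      combine (inj₂ (x≡a , xb∈S)) (inj₁ xh∈S) =
        let xh≡a = trans (at-≢ (j≢i ∘ sym)) x≡a
            w , btw , w∈b , w∈a = switching xb∈S xh∈S (at-b∈Y x∈Y) xh∈Y i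
              (λ eq → a≢b (sym (trans (sym (at-≡ i)) (trans eq xh≡a))))
        in [ (λ (xa∈S , _) → inj₁ (S-resp (at-self (sym x≡a)) xa∈S , λ _ → xh∈S))
           , (λ (_ , xhb∈S) → inj₂ (x≡a , xb∈S , λ _ → S-resp (at-swap (j≢i ∘ sym)) xhb∈S))
           ]′ (crossing {a} {b} w (λ k k≢i → Sum.map₁ (λ eq → trans eq (at-≢ k≢i)) (btw k))
                (subst (λ v → at i v w ∈ S) xh≡a w∈a) (subst (λ v → at i v w ∈ S) (at-≡ i) w∈b))

  module _ {Y S} (S-resp : S Respects _≈_) (switching : Switching {U = U} Y S)
    (upper : UpperAmple Y S) where

    -- In different factors the contractions commute. In the same factor only its slices matter, and
    -- the question becomes `Good-up-of-lo`.
    lo-upperAmple : ∀ {i a b} → a ≢ b → Y i a → Y i b → UpperAmple (Y ∖[ i , b ]) (lo S i a b)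
    lo-upperAmple {i} {a} {b} a≢b a∈Y b∈Y j {g} {h} g≢h g∈ h∈ with j Fin.≟ i
    ... | no j≢i = AmpleIn-cong
      (λ k v ((v∈Y , ≢ib) , ≢jh) → (v∈Y , ≢jh) , ≢ib)
      (λ x _ → lo-up⇒up-lo S-resp switching a≢b a∈Y b∈Y j≢i (proj₁ h∈) x)
      (λ x x∈ → up-lo⇒lo-up S-resp switching a≢b a∈Y b∈Y j≢i (proj₁ h∈) x (λ k → proj₁ (proj₁ (x∈ k))))
      (AmpleIn-lo (up-resp S j g h S-resp) a≢b (b∈Y , λ { refl → j≢i refl })
        (upper j g≢h (proj₁ g∈) (proj₁ h∈)))
    ... | yes refl = Good⇒AmpleIn-up (lo-resp S i a b S-resp) λ Λ Λ⊆ →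
      let open Slices S-resp i Λ
          Λ⊆Y = λ j j≢i v al → proj₁ (Λ⊆ j j≢i v al)
      in At.Good-cong i Λ (λ v (v∈ , v≢h) → ∖⁻ Y v∈ , v≢h)
           (λ { v x _ (x∈lo , both) → slice-lo⁺ v x x∈lo , slice-lo⁺ _ x ∘ both })
           (λ { v x _ (x∈lo , both) → slice-lo⁻ v x x∈lo , slice-lo⁻ _ x ∘ both })
           (At.Good-up-of-lo i Λ a≢b a∈Y b∈Y (switches S-resp switching {Λ = Λ} Λ⊆Y a≢b a∈Y b∈Y)
             (λ p≢q p∈Y q∈Y → AmpleIn-up⇒Good S-resp {Λ = Λ} Λ⊆Y (upper i p≢q p∈Y q∈Y))
             g≢h (∖⁻ Y g∈) (∖⁻ Y h∈))

  Switching-⊆ : ∀ {Y Y′ S} → (∀ i v → Y′ i v → Y i v) → Switching {U = U} Y S → Switching Y′ S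
  Switching-⊆ Y′⊆Y switching x∈S y∈S x∈Y′ y∈Y′ =
    switching x∈S y∈S (λ j → Y′⊆Y j _ (x∈Y′ j)) (λ j → Y′⊆Y j _ (y∈Y′ j))

  UpperAmple-⊆ : ∀ {Y Y′ S} → (∀ i v → Y′ i v → Y i v) → UpperAmple {U = U} Y S → UpperAmple Y′ S
  UpperAmple-⊆ Y′⊆Y upper i a≢b a∈Y′ b∈Y′ =
    AmpleIn-⊆ (λ j v (v∈Y′ , ≢ib) → Y′⊆Y j v v∈Y′ , ≢ib) (upper i a≢b (Y′⊆Y i _ a∈Y′) (Y′⊆Y i _ b∈Y′))

  -- Copies by contraction: (3) and (2) imply (1).

  Alone : (∀ i → Labelling (U i)) → ∀ i → U i → Set
  Alone Λ i v = ∀ u → Alive (Λ i) u → label (Λ i) u ≡ label (Λ i) v → u ≡ v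

  -- The list contains the points whose blocks may still have other elements. A point `b` with a
  -- partner `a` in its block is merged into it and dies; any other is dead or alone already. For
  -- the empty list all blocks are singletons, so the points that hit the boxes form the copy.
  copy-by-contraction : (points : List (Σ (Fin m) U)) → ∀ {S} → S Respects _≈_ → Decidable S → ∀ Λ →
    Switching (λ i → Alive (Λ i)) S → UpperAmple (λ i → Alive (Λ i)) S →
    (∀ i v → Alive (Λ i) v → (i , v) ∈ˡ points ⊎ Alone Λ i v) →
    Hits S Λ → HasCopy S Λ
  copy-by-contraction [] {S} S-resp S? Λ switching upper alone hits =
    (λ i → id) , (λ i c al → al , refl) , λ y al →
      let x , x∈S , same = hits y al
      in S-resp (λ i → [ (λ ()) , (λ h → h (x i) (proj₁ (same i)) (proj₂ (same i))) ]′ (alone i (y i) (al i))) x∈S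
  copy-by-contraction ((i , b) ∷ points) {S} S-resp S? Λ switching upper alone hits =
    contract (alive? (Λ i) b)
      (Finite.search (finite i) λ a → alive? (Λ i) a ×-dec (¬? (a ≟ b) ×-dec _≟ᴸ_ (Λ i) (label (Λ i) a) (label (Λ i) b)))
    where
    Partner : U i → Set
    Partner a = Alive (Λ i) a × a ≢ b × label (Λ i) a ≡ label (Λ i) b

    skip : (Alive (Λ i) b → ¬ ∃ Partner) → HasCopy S Λ
    skip lonely = copy-by-contraction points S-resp S? Λ switching upper alone′ hits
      where
      alone′ : ∀ j v → Alive (Λ j) v → (j , v) ∈ˡ points ⊎ Alone Λ j v
      alone′ j v al with alone j v al
      ... | inj₂ h           = inj₂ h
      ... | inj₁ (there v∈)  = inj₁ v∈
      ... | inj₁ (here refl) = inj₂ λ u u-alive eq →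
        decidable-stable (u ≟ b) λ u≢b → lonely al (u , u-alive , u≢b , eq)

    contract : Dec (Alive (Λ i) b) → Dec (∃ Partner) → HasCopy S Λ
    contract (no b-dead) _ = skip λ al → contradiction al b-dead
    contract _ (no none)   = skip λ _ → none
    contract (yes b-alive) (yes (a , a-alive , a≢b , a~b)) =
      Copies⇒HasCopy S-resp
        (unmerge-copies {slice i S} {Λ i} a≢b a-alive b-alive a~b
          (merges S-resp switching {Λ = Λ} (λ _ _ _ → id) S? a≢b a-alive b-alive (upper i a≢b a-alive b-alive))
          (Copies-cong {C = without (Λ i) b} slice-lo⁻ (HasCopy⇒Copies (lo-resp S i a b S-resp)
            (copy-by-contraction points (lo-resp S i a b S-resp) lo? (at i (without (Λ i) b) Λ)
              (Switching-⊆ shrink (Fold.lo-switching S-resp a≢b a-alive b-alive switching))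
              (UpperAmple-⊆ shrink (lo-upperAmple S-resp switching upper a≢b a-alive b-alive))
              alone′
              (Shatters⇒Hits (lo-resp S i a b S-resp) (Shatters-cong {C = without (Λ i) b} slice-lo⁺
                (Shatters-lo {slice i S} {Λ i} a≢b a-alive a~b (Hits⇒Shatters S-resp hits))))))))
      where
      open At i Λ
      open Slices S-resp i Λ

      lo? : Decidable (lo S i a b)
      lo? x = S? x ⊎-dec ((x i ≟ a) ×-dec S? (at i b x))

      shrink : ∀ j v → Alive (at i (without (Λ i) b) Λ j) v → ((λ k → Alive (Λ k)) ∖[ i , b ]) j v
      shrink j v al with j Fin.≟ i
      ... | yes refl = ∖⁺ (λ k → Alive (Λ k)) al
      ... | no j≢i   = al , λ { refl → j≢i refl }

      alone′ : ∀ j v → Alive (at i (without (Λ i) b) Λ j) v →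
        (j , v) ∈ˡ points ⊎ Alone (at i (without (Λ i) b) Λ) j v
      alone′ j v al with j Fin.≟ i
      ... | yes refl with alone i v (proj₁ al)
      ...   | inj₂ h           = inj₂ λ u (u-alive , _) → h u u-alive
      ...   | inj₁ (there v∈)  = inj₁ v∈
      ...   | inj₁ (here refl) = contradiction refl (proj₂ al)
      alone′ j v al | no j≢i with alone j v al
      ...   | inj₂ h           = inj₂ h
      ...   | inj₁ (there v∈)  = inj₁ v∈
      ...   | inj₁ (here refl) = contradiction refl j≢i

  points : List (Σ (Fin m) U)
  points = concat (map (λ i → map (i ,_) (Finite.elements (finite i))) (allFin m))

  ∈points : ∀ p → p ∈ˡ points
  ∈points (i , v) = ∈-concat⁺′ (∈-map⁺ (i ,_) (Finite.complete (finite i) v)) (∈-map⁺ _ (∈-allFin i))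

  upperAmple⇒ampleIn : ∀ {Y S} → S Respects _≈_ → Decidable S →
    Switching {U = U} Y S → UpperAmple Y S → AmpleIn Y S
  upperAmple⇒ampleIn S-resp S? switching upper Λ Λ⊆Y =
    copy-by-contraction points S-resp S? Λ (Switching-⊆ Λ⊆Y switching) (UpperAmple-⊆ Λ⊆Y upper)
      (λ i v _ → inj₁ (∈points (i , v)))

  contraction⇒ampleIn : ∀ {Y S i a b} → S Respects _≈_ → Decidable S → Switching {U = U} Y S →
    a ≢ b → Y i a → Y i b →
    AmpleIn (Y ∖[ i , b ]) (up S i a b) → AmpleIn (Y ∖[ i , b ]) (lo S i a b) → AmpleIn Y S
  contraction⇒ampleIn {i = i} S-resp S? switching a≢b a∈Y b∈Y ample-up ample-lo =
    Good⇒AmpleIn i S-resp λ Λ Λ⊆Y → At.Good-from-contraction i Λ a≢b a∈Y b∈Y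
      (switches S-resp switching {Λ = Λ} Λ⊆Y a≢b a∈Y b∈Y)
      (merges S-resp switching {Λ = Λ} Λ⊆Y S? a≢b a∈Y b∈Y ample-up)
      (AmpleIn-up⇒Good S-resp {Λ = Λ} Λ⊆Y ample-up) (AmpleIn-lo⇒Good S-resp {Λ = Λ} Λ⊆Y ample-lo)

  -- Intervals with a third value in one factor.

  Segment : Tuple U → Tuple U → ∀ i → Pred (U i) 0ℓ
  Segment u v i w = w ≡ u i ⊎ w ≡ v i

  module ThreePoints {S : Pred (Tuple U) 0ℓ} (S-resp : S Respects _≈_)
    (u v : Tuple U) {i : Fin m} {b : U i} (a≢b : u i ≢ b) (a≢y : u i ≢ v i) (b≢y : b ≢ v i)
    where

    private
      a y : U i
      a = u i
      y = v i

    -- The third alternative adds `b` in factor `i` only; it equates pairs because `w` and `b` have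
    -- the same type only if `j ≡ i`.
    Near : ∀ j → Pred (U j) 0ℓ
    Near j w = w ≡ u j ⊎ w ≡ v j ⊎ _≡_ {A = Σ _ U} (j , w) (i , b)

    near? : ∀ j w → Dec (Near j w)
    near? j w = (w ≟ u j) ⊎-dec ((w ≟ v j) ⊎-dec
      map′ (λ { (refl , refl) → refl }) (λ { refl → refl , refl }) (eq j w))
      where
      eq : ∀ j w → Dec (Σ (j ≡ i) λ { refl → w ≡ b })
      eq j w with j Fin.≟ i
      ... | no j≢i   = no (j≢i ∘ proj₁)
      ... | yes refl = map′ (refl ,_) (λ { (refl , e) → e }) (w ≟ b)

    module _ (minor : ∀ j w → Near j w → AmpleIn (Near ∖[ j , w ]) S) where

      module Rest (Λ : ∀ j → Labelling (U j))
        (Λ⊆ : ∀ j → j ≢ i → ∀ w → Alive (Λ j) w → Segment u v j w) where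
        open At i Λ

        F : Family
        F = slice i S

        private
          Λ⊆Near : ∀ {k r} → k ≡ i → ∀ j → j ≢ i → ∀ w → Alive (Λ j) w → (Near ∖[ k , r ]) j w
          Λ⊆Near refl j j≢i w al = [ inj₁ , inj₂ ∘ inj₁ ]′ (Λ⊆ j j≢i w al) , λ { refl → j≢i refl }

        -- Two of the three values leave out the third, so they span a proper subproduct.
        pair-good : ∀ {p q r} → Near i p → Near i q → Near i r → p ≢ r → q ≢ r → Good F ⟦ p , q ⟧
        pair-good {r = r} near-p near-q near-r p≢r q≢r = Good-cong
          (λ { w (inj₁ refl) → ∖⁺ Near (near-p , p≢r) ; w (inj₂ refl) → ∖⁺ Near (near-q , q≢r) })
          (λ _ _ _ → id) (λ _ _ _ → id)
          (AmpleIn⇒Good S-resp (Λ⊆Near refl) (minor i r near-r))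

        near-a : Near i a
        near-a = inj₁ refl

        near-y : Near i y
        near-y = inj₂ (inj₁ refl)

        near-b : Near i b
        near-b = inj₂ (inj₂ refl)

        good-ab : Good F ⟦ a , b ⟧
        good-ab = pair-good near-a near-b near-y a≢y b≢y

        good-ay : Good F ⟦ a , y ⟧
        good-ay = pair-good near-a near-y near-b a≢b (b≢y ∘ sym)

        good-by : Good F ⟦ b , y ⟧
        good-by = pair-good near-b near-y near-a (a≢b ∘ sym) (a≢y ∘ sym)

        -- If a coordinate j has both values in one block, two of the three sections
        -- found for the pairs among a, b, y take the same value p there.  Together
        -- they show that the subproduct in which j is fixed to p is still shattered.
        fix-coordinate : ∀ j → j ≢ i → ∀ p q → p ≢ q → Near j q → Alive (Λ j) p →
          (∀ w → Alive (Λ j) w → label (Λ j) w ≡ label (Λ j) p) →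
          ∀ c₀ → Alive (Λ j) c₀ →
          (∀ c → Near i c → ∃ λ s → proj₁ s j c₀ ≡ p × s Fills F c) →
          ∃ λ s → ∀ c → Near i c → s Fills F c
        fix-coordinate j j≢i p q p≢q near-q p-alive one-block c₀ c₀-alive filled =
          collect (A′.AmpleIn⇒Good S-resp Λ′⊆ (minor j q near-q) C
            (λ w near → near , λ { refl → j≢i refl }) sh)
          where
          Λ′ : ∀ k → Labelling (U k)
          Λ′ = at j (labelling {Alive = λ w → Alive (Λ j) w × w ≡ p} (λ w → alive? (Λ j) w ×-dec (w ≟ p))
                               (_≟ᴸ_ (Λ j)) (label (Λ j))) Λ

          module A′ = At i Λ′

          C : Labelling (U i)
          C = labelling (near? i) (_≟_ {i}) id

          Λ′⊆ : ∀ k → k ≢ i → ∀ w → Alive (Λ′ k) w → (Near ∖[ j , q ]) k w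
          Λ′⊆ k k≢i w al with k Fin.≟ j
          ... | yes refl = [ inj₁ , inj₂ ∘ inj₁ ]′ (Λ⊆ k k≢i w (proj₁ al)) ,
                           λ { refl → p≢q (sym (proj₂ al)) }
          ... | no k≢j   = [ inj₁ , inj₂ ∘ inj₁ ]′ (Λ⊆ k k≢i w al) , λ { refl → k≢j refl }

          sh : A′.Shatters F C
          sh (t , al) c near with filled c near
          ... | s , sc₀≡p , fills = c , (near , refl) , app s t′ , in-box , fills t′
            where
            -- At `j` only `p` is alive in `Λ′`, but the value that `s` is known to send to `p` is
            -- `c₀`; evaluating `s` there stays in the box.
            t′ : RestTuple
            t′ = at j c₀ t , alive
              where
              alive : ∀ k → k ≢ i → Alive (Λ k) (at j c₀ t k)
              alive k k≢i with k Fin.≟ j | al k k≢i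
              ... | yes refl | _   = c₀-alive
              ... | no _     | al′ = al′

            in-box : ∀ k → k ≢ i → Same (Λ′ k) (t k) (app s t′ k)
            in-box k k≢i with k Fin.≟ j | al k k≢i
            ... | yes refl | al′ , t≡p =
              (subst (Alive (Λ k)) (sym sc₀≡p) p-alive , sc₀≡p) ,
              cong (label (Λ k)) (trans sc₀≡p (sym t≡p))
            ... | no _     | al′       = proj₂ s k k≢i (t k) al′

          collect : A′.Copies F C → ∃ λ s → ∀ c → Near i c → s Fills F c
          collect ((s , same) , σ , h) = section , fills
            where
            -- In factor `j` all alive points form one block, so a constant choice is legitimate
            -- there.
            section : Section
            section = at j (const (s j p)) s , valid
              where
              valid : ∀ k → k ≢ i → ∀ c → Alive (Λ k) c → Same (Λ k) c (at j (const (s j p)) s k c)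
              valid k k≢i c c-alive with k Fin.≟ j | same k k≢i
              ... | yes refl | same′ =
                let (al , _) , eq = same′ p (p-alive , refl) in al , trans eq (sym (one-block c c-alive))
              ... | no _     | same′ = same′ c c-alive

            fills : ∀ c → Near i c → section Fills F c
            fills c near (t , al) = S-resp (at-cong agree)
              (subst (λ w → at i w (A′.app (s , same) t′) ∈ S) (proj₂ (proj₁ (h c near))) (proj₂ (h c near) t′))
              where
              t′ : A′.RestTuple
              t′ = at j p t , alive
                where
                alive : ∀ k → k ≢ i → Alive (Λ′ k) (at j p t k)
                alive k k≢i with k Fin.≟ j
                ... | yes refl = p-alive , refl
                ... | no _     = al k k≢i

              agree : ∀ k → k ≢ i → s k (at j p t k) ≡ at j (const (s j p)) s k (t k)
              agree k _ with k Fin.≟ j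
              ... | yes refl = refl
              ... | no _     = refl

        Doubled : Fin m → Set
        Doubled j = j ≢ i × u j ≢ v j × Alive (Λ j) (u j) × Alive (Λ j) (v j) ×
          label (Λ j) (u j) ≡ label (Λ j) (v j)

        doubled? : ∀ j → Dec (Doubled j)
        doubled? j = ¬? (j Fin.≟ i) ×-dec (¬? (u j ≟ v j) ×-dec (alive? (Λ j) (u j) ×-dec
          (alive? (Λ j) (v j) ×-dec _≟ᴸ_ (Λ j) (label (Λ j) (u j)) (label (Λ j) (v j)))))

        -- If no other factor has two alive points in one block, the boxes are single points, and
        -- meeting them all is filling them by the identity. Otherwise a doubled coordinate offers
        -- only two values to the three sections found for the pairs.
        fill-all : Meets (F a) → Meets (F b) → Meets (F y) → ∃ λ s → ∀ c → Near i c → s Fills F c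
        fill-all meets-a meets-b meets-y with Fin.any? doubled?
        ... | no none = ((λ _ → id) , λ j _ c al → al , refl) , fills
          where
          injective : ∀ j → j ≢ i → ∀ c d → Alive (Λ j) c → Alive (Λ j) d →
            label (Λ j) c ≡ label (Λ j) d → c ≡ d
          injective j j≢i c d c-alive d-alive eq with Λ⊆ j j≢i c c-alive | Λ⊆ j j≢i d d-alive
          ... | inj₁ refl | inj₁ refl = refl
          ... | inj₂ refl | inj₂ refl = refl
          ... | inj₁ refl | inj₂ refl = decidable-stable (u j ≟ v j) λ u≢v →
            none (j , j≢i , u≢v , c-alive , d-alive , eq)
          ... | inj₂ refl | inj₁ refl = decidable-stable (v j ≟ u j) λ v≢u →
            none (j , j≢i , v≢u ∘ sym , d-alive , c-alive , sym eq)

          unique : ∀ {c} → Meets (F c) → ∀ t → proj₁ t ∈ F c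
          unique meets (t , al) with meets (t , al)
          ... | x , x∈B , x∈c = S-resp (at-cong λ j j≢i →
            injective j j≢i _ _ (proj₁ (x∈B j j≢i)) (al j j≢i) (proj₂ (x∈B j j≢i))) x∈c

          fills : ∀ c → Near i c → ∀ t → proj₁ t ∈ F c
          fills c (inj₁ refl)        = unique meets-a
          fills c (inj₂ (inj₁ refl)) = unique meets-y
          fills c (inj₂ (inj₂ refl)) = unique meets-b
        ... | yes (j , j≢i , u≢v , u-alive , v-alive , u~v) =
          pigeonhole (common-filling good-ab meets-a meets-b)
                     (common-filling good-ay meets-a meets-y)
                     (common-filling good-by meets-b meets-y)
          where
          image : ∀ s → proj₁ s j (u j) ≡ u j ⊎ proj₁ s j (u j) ≡ v j
          image s = Λ⊆ j j≢i _ (proj₁ (proj₂ s j j≢i (u j) u-alive))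

          fix-u : (∀ c → Near i c → ∃ λ s → proj₁ s j (u j) ≡ u j × s Fills F c) →
            ∃ λ s → ∀ c → Near i c → s Fills F c
          fix-u = fix-coordinate j j≢i (u j) (v j) u≢v (inj₂ (inj₁ refl)) u-alive
            (λ w al → [ (λ { refl → refl }) , (λ { refl → sym u~v }) ]′ (Λ⊆ j j≢i w al)) (u j) u-alive

          fix-v : (∀ c → Near i c → ∃ λ s → proj₁ s j (u j) ≡ v j × s Fills F c) →
            ∃ λ s → ∀ c → Near i c → s Fills F c
          fix-v = fix-coordinate j j≢i (v j) (u j) (u≢v ∘ sym) (inj₁ refl) v-alive
            (λ w al → [ (λ { refl → u~v }) , (λ { refl → refl }) ]′ (Λ⊆ j j≢i w al)) (u j) u-alive

          by-cases : ∀ {P : Section → Set} → (∃ λ s → P s × s Fills F a) → (∃ λ s → P s × s Fills F b) →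
            (∃ λ s → P s × s Fills F y) → ∀ c → Near i c → ∃ λ s → P s × s Fills F c
          by-cases at-a at-b at-y c (inj₁ refl)        = at-a
          by-cases at-a at-b at-y c (inj₂ (inj₁ refl)) = at-y
          by-cases at-a at-b at-y c (inj₂ (inj₂ refl)) = at-b

          -- Any two of the three sections together fill all of the slices at `a`, `b` and `y`, so
          -- two that agree at `u j` suffice.
          pigeonhole : (∃ λ s → s Fills F a × s Fills F b) → (∃ λ s → s Fills F a × s Fills F y) →
            (∃ λ s → s Fills F b × s Fills F y) → ∃ λ s → ∀ c → Near i c → s Fills F c
          pigeonhole (s₁ , a₁ , b₁) (s₂ , a₂ , y₂) (s₃ , b₃ , y₃) with image s₁ | image s₂ | image s₃
          ... | inj₁ e₁ | inj₁ e₂ | _       = fix-u (by-cases (s₁ , e₁ , a₁) (s₁ , e₁ , b₁) (s₂ , e₂ , y₂))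
          ... | inj₁ e₁ | inj₂ _  | inj₁ e₃ = fix-u (by-cases (s₁ , e₁ , a₁) (s₁ , e₁ , b₁) (s₃ , e₃ , y₃))
          ... | inj₁ _  | inj₂ e₂ | inj₂ e₃ = fix-v (by-cases (s₂ , e₂ , a₂) (s₃ , e₃ , b₃) (s₂ , e₂ , y₂))
          ... | inj₂ e₁ | inj₂ e₂ | _       = fix-v (by-cases (s₁ , e₁ , a₁) (s₁ , e₁ , b₁) (s₂ , e₂ , y₂))
          ... | inj₂ e₁ | inj₁ _  | inj₂ e₃ = fix-v (by-cases (s₁ , e₁ , a₁) (s₁ , e₁ , b₁) (s₃ , e₃ , y₃))
          ... | inj₂ _  | inj₁ e₂ | inj₁ e₃ = fix-u (by-cases (s₂ , e₂ , a₂) (s₃ , e₃ , b₃) (s₂ , e₂ , y₂))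

        -- Only separate blocks for `a` and `y` require the three slices at once; all other
        -- labellings are settled by comparing two values at a time.
        good-up : Good (upᶠ F a b) ⟦ a , y ⟧
        good-up C C⊆ sh with alive? C a | alive? C y
        ... | _ | no y-dead = Good-up a≢b (inj₂ refl) good-ab C
          (λ { w al → [ (λ { refl → inj₁ refl , a≢b }) , (λ { refl → contradiction al y-dead }) ]′ (C⊆ w al) }) sh
        ... | no a-dead | yes _ =
          let s , σ , h = good-ay C C⊆ λ t c al → map₂ (map₂ (map₂ (map₂ proj₁))) (sh t c al)
          in s , σ , λ c al → let same , fills = h c al in same , λ t →
               fills t , λ σc≡a → contradiction (subst (Alive C) σc≡a (proj₁ same)) a-dead
        ... | yes a-alive | yes y-alive with _≟ᴸ_ C (label C a) (label C y)
        ...   | yes a~y = same-block-copies C a≢y good-ab good-ay good-by C⊆ a-alive y-alive a~y sh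
        ...   | no a≁y  =
          let s , fills = fill-all (λ t → map₂ (map₂ proj₁) (meets-ab t))
                            (λ t → map₂ (map₂ λ p → proj₂ p refl) (meets-ab t)) meets-y
          in s , id , λ c al → (al , refl) , λ t → fills c ([ inj₁ , inj₂ ∘ inj₁ ]′ (C⊆ c al)) t ,
               λ _ → fills b near-b t
          where
          meets-ab : Meets (upᶠ F a b a)
          meets-ab t with sh t a a-alive
          ... | w , (al , eq) , hit with C⊆ w al
          ...   | inj₁ refl = hit
          ...   | inj₂ refl = contradiction (sym eq) a≁y

          meets-y : Meets (F y)
          meets-y t with sh t y y-alive
          ... | w , (al , eq) , hit with C⊆ w al
          ...   | inj₁ refl = contradiction eq a≁y
          ...   | inj₂ refl = map₂ (map₂ proj₁) hit

      ampleIn-up : AmpleIn (Segment u v) (up S i a b)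
      ampleIn-up = Good⇒AmpleIn i (up-resp S i a b S-resp) λ Λ Λ⊆ →
        let open Slices S-resp i Λ
        in At.Good-cong i Λ (λ _ → id) (λ w x _ → slice-up⁺ w x) (λ w x _ → slice-up⁻ w x)
             (Rest.good-up Λ Λ⊆)

  -- Ampleness in intervals, by induction on the number of points.

  LocallyAmple : (∀ i → Pred (U i) 0ℓ) → Pred (Tuple U) 0ℓ → Set₁
  LocallyAmple Y S = ∀ u v → u ∈ S → v ∈ S → (∀ i → Y i (u i)) → (∀ i → Y i (v i)) → AmpleIn (Segment u v) S

  extent : (Y : ∀ i → Pred (U i) 0ℓ) → (∀ i → Decidable (Y i)) → ℕ
  extent Y Y? = length (filter (λ (i , v) → Y? i v) points)

  locallyAmple⇒switching : ∀ Y {S} → S Respects _≈_ → LocallyAmple Y S → Switching Y S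
  locallyAmple⇒switching Y S-resp local x∈S y∈S x∈Y y∈Y =
    AmpleIn⇒Switching S-resp (local _ _ x∈S y∈S x∈Y y∈Y) x∈S y∈S (λ _ → inj₁ refl) (λ _ → inj₂ refl)

  ∖-dec : ∀ Y → (∀ i → Decidable (Y i)) → ∀ i b j → Decidable ((Y ∖[ i , b ]) j)
  ∖-dec Y Y? i b j w with j Fin.≟ i
  ... | no j≢i   = map′ (λ w∈Y → w∈Y , λ { refl → j≢i refl }) proj₁ (Y? j w)
  ... | yes refl = map′ (∖⁺ Y) (∖⁻ Y) (Y? i w ×-dec ¬? (w ≟ b))

  extent-∖ : ∀ Y Y? {i b} → Y i b → extent (Y ∖[ i , b ]) (∖-dec Y Y? i b) < extent Y Y?
  extent-∖ Y Y? {i} {b} b∈Y =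
    length-filter-< (λ (j , w) → ∖-dec Y Y? i b j w) (λ (j , w) → Y? j w)
      (λ _ → proj₁) (∈points (i , b)) b∈Y (λ (_ , ≢ib) → ≢ib refl)

  -- By way of condition (3): ampleness in intervals gives `Switching`, and `up S i a b` lives on
  -- one point fewer, so the induction hypothesis applies to it once it is locally ample.
  locallyAmple⇒ampleIn : ∀ n Y Y? → extent Y Y? < n →
    ∀ {S} → S Respects _≈_ → Decidable S → LocallyAmple Y S → AmpleIn Y S
  locallyAmple⇒ampleIn (suc n) Y Y? (s≤s extent≤n) {S} S-resp S? local =
    upperAmple⇒ampleIn S-resp S? (locallyAmple⇒switching Y S-resp local) λ i {a} {b} a≢b a∈Y b∈Y →
      smaller i b b∈Y (up-resp S i a b S-resp) (λ x → S? x ×-dec ((x i ≟ a) →-dec S? (at i b x)))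
        (local-up a≢b a∈Y b∈Y)
    where
    smaller : ∀ i b → Y i b → ∀ {S} → S Respects _≈_ → Decidable S →
      LocallyAmple (Y ∖[ i , b ]) S → AmpleIn (Y ∖[ i , b ]) S
    smaller i b b∈Y = locallyAmple⇒ampleIn n (Y ∖[ i , b ]) (∖-dec Y Y? i b) (ℕ.<-≤-trans (extent-∖ Y Y? b∈Y) extent≤n)

    three-points : ∀ {i b} u v → (∀ j → (Y ∖[ i , b ]) j (u j)) → (∀ j → (Y ∖[ i , b ]) j (v j)) →
      Y i b → u i ≢ b → u i ≢ v i → b ≢ v i → AmpleIn (Segment u v) (up S i (u i) b)
    three-points {i} {b} u v u∈Y v∈Y b∈Y u≢b u≢v b≢v = ampleIn-up λ j w near →
      AmpleIn-⊆ (λ k c (near , ≢jw) → Near⊆Y k c near , ≢jw)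
        (smaller j w (Near⊆Y j w near) S-resp S? λ x y x∈S y∈S x∈Y y∈Y →
          local x y x∈S y∈S (proj₁ ∘ x∈Y) (proj₁ ∘ y∈Y))
      where
      open ThreePoints S-resp u v u≢b u≢v b≢v

      Near⊆Y : ∀ j w → Near j w → Y j w
      Near⊆Y j w (inj₁ refl)        = proj₁ (u∈Y j)
      Near⊆Y j w (inj₂ (inj₁ refl)) = proj₁ (v∈Y j)
      Near⊆Y j w (inj₂ (inj₂ refl)) = b∈Y

    local-up : ∀ {i a b} → a ≢ b → Y i a → Y i b → LocallyAmple (Y ∖[ i , b ]) (up S i a b)
    local-up {i} {a} {b} a≢b a∈Y b∈Y u v (u∈S , u-both) (v∈S , v-both) u∈Y v∈Y = cases (u i ≟ a) (v i ≟ a)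
      where
      u≢b : u i ≢ b
      u≢b = proj₂ (∖⁻ Y (u∈Y i))

      v≢b : v i ≢ b
      v≢b = proj₂ (∖⁻ Y (v∈Y i))

      -- Away from `a` the set agrees with `S` on the segment. If both endpoints have the value `a`,
      -- moving `v` to `b` gives an interval between points of `S` whose contraction contains the
      -- segment. With just one endpoint at `a`, the values `a`, `b` and a third one occur together.
      cases : Dec (u i ≡ a) → Dec (v i ≡ a) → AmpleIn (Segment u v) (up S i a b)
      cases (no u≢a) (no v≢a) = AmpleIn-cong (λ _ _ → id)
        (λ x x∈ x∈S → x∈S , λ x≡a → [ (λ x≡u → contradiction (trans (sym x≡u) x≡a) u≢a)
                                    , (λ x≡v → contradiction (trans (sym x≡v) x≡a) v≢a) ]′ (x∈ i))
        (λ _ _ → proj₁)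
        (local u v u∈S v∈S (proj₁ ∘ u∈Y) (proj₁ ∘ v∈Y))
      cases (yes u≡a) (yes v≡a) = AmpleIn-⊆ sub
        (AmpleIn-up S-resp a≢b (inj₂ (sym (at-≡ i))) (local u (at i b v) u∈S (v-both v≡a) (proj₁ ∘ u∈Y) vb∈Y))
        where
        vb∈Y : ∀ j → Y j (at i b v j)
        vb∈Y j with j Fin.≟ i
        ... | yes refl = b∈Y
        ... | no _     = proj₁ (v∈Y j)

        sub : ∀ j w → Segment u v j w → (Segment u (at i b v) ∖[ i , b ]) j w
        sub j w (inj₁ refl) = inj₁ refl , λ { refl → u≢b refl }
        sub j w (inj₂ refl) with j Fin.≟ i
        ... | yes refl = inj₁ (trans v≡a (sym u≡a)) , λ { refl → v≢b refl }
        ... | no j≢i   = inj₂ refl , λ { refl → j≢i refl }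
      cases (yes refl) (no v≢a) = three-points u v u∈Y v∈Y b∈Y a≢b (v≢a ∘ sym) (v≢b ∘ sym)
      cases (no u≢a) (yes refl) = AmpleIn-⊆ (λ _ _ → Sum.swap)
        (three-points v u v∈Y u∈Y b∈Y a≢b (u≢a ∘ sym) (u≢b ∘ sym))

  -- The list contains all points that may be dead. `adjoin` calls for copies of up to two
  -- partitions in which `p` is alive, so `Λ` stays arbitrary in the induction on the list. Once
  -- nothing is dead, the labels give a generalized partition of `U` itself.
  copy-by-adjunction : (points : List (Σ (Fin m) U)) → ∀ {S} → S Respects _≈_ → Ample U S → ∀ Λ →
    (∀ i v → ¬ Alive (Λ i) v → (i , v) ∈ˡ points) → Hits S Λ → HasCopy S Λ
  copy-by-adjunction [] {S} S-resp ample Λ dead∈ hits = copy (ample Λ′ shattered)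
    where
    alive : ∀ i v → Alive (Λ i) v
    alive i v = decidable-stable (alive? (Λ i) v) λ dead → contradiction (dead∈ i v dead) λ ()

    module K i = Kernel (finite i) (_≟ᴸ_ (Λ i)) (label (Λ i))

    Λ′ : GeneralizedPartition U
    Λ′ i = K.kernel i

    shattered : Shattered S Λ′
    shattered P =
      let x , x∈S , same = hits (λ i → proj₁ (nonempty (Λ′ i) (P i))) (λ i → alive i _)
      in x , (λ i → trans (K.kernel⁺ i (proj₂ (same i))) (proj₂ (nonempty (Λ′ i) (P i)))) , x∈S

    copy : StronglyShattered S Λ′ → HasCopy S Λ
    copy (W , is-copy , included) =
      (λ i c → proj₁ (is-copy i (blockOf (Λ′ i) c))) ,
      (λ i c _ → alive i _ , K.kernel⁻ i (proj₁ (proj₂ (is-copy i (blockOf (Λ′ i) c))))) ,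
      λ y _ → included λ i → proj₁ (proj₂ (proj₂ (is-copy i (blockOf (Λ′ i) (y i)))))
  copy-by-adjunction ((i , p) ∷ points) {S} S-resp ample Λ dead∈ hits with alive? (Λ i) p
  ... | yes p-alive = copy-by-adjunction points S-resp ample Λ dead∈′ hits
    where
    dead∈′ : ∀ j v → ¬ Alive (Λ j) v → (j , v) ∈ˡ points
    dead∈′ j v dead with dead∈ j v dead
    ... | here refl = contradiction p-alive dead
    ... | there v∈  = v∈
  ... | no p-dead = Copies⇒HasCopy S-resp (adjoin (Λ i) p p-dead ((λ _ → id) , λ _ _ _ al → al , refl)
      (λ C′ off-p p-alive sh → HasCopy⇒Copies S-resp
        (copy-by-adjunction points S-resp ample (at i C′ Λ) (dead∈′ C′ off-p p-alive) (Shatters⇒Hits S-resp sh)))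
      (Hits⇒Shatters S-resp hits))
    where
    open At i Λ

    dead∈′ : ∀ C′ → (∀ {v} → v ≢ p → (Alive (Λ i) v → Alive C′ v) × (Alive C′ v → Alive (Λ i) v)) → Alive C′ p →
      ∀ j v → ¬ Alive (at i C′ Λ j) v → (j , v) ∈ˡ points
    dead∈′ C′ off-p p-alive j v dead with j Fin.≟ i
    ... | yes refl with dead∈ i v (λ al → dead (proj₁ (off-p λ { refl → dead p-alive }) al))
    ...   | here refl = contradiction p-alive dead
    ...   | there v∈  = v∈
    dead∈′ C′ off-p p-alive j v dead | no j≢i with dead∈ j v dead
    ...   | here refl = contradiction refl j≢i
    ...   | there v∈  = v∈

  ample⇒ampleIn : ∀ {S} → S Respects _≈_ → Ample U S → AmpleIn Full S
  ample⇒ampleIn S-resp ample Λ _ = copy-by-adjunction points S-resp ample Λ (λ i v _ → ∈points (i , v))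

  -- Elementary minor-subproducts as deletions of a point.

  record Contracts (e : GeneralizedPartition U) (i : Fin m) (a b : U i) : Set where
    field
      a≢b         : a ≢ b
      a~b         : blockOf (e i) a ≡ blockOf (e i) b
      injective   : ∀ {v w} → v ≢ b → w ≢ b → blockOf (e i) v ≡ blockOf (e i) w → v ≡ w
      injective-≢ : ∀ {j} → j ≢ i → ∀ {v w} → blockOf (e j) v ≡ blockOf (e j) w → v ≡ w

  module Contraction {e : GeneralizedPartition U} {i a b} (contracts : Contracts e i a b)
    {S : Pred (Tuple U) 0ℓ} (S-resp : S Respects _≈_) where
    open Contracts contracts
    open FoldMap a b
    open Fold {Y = Full} S-resp a≢b tt tt

    Contracted : ∀ j → Pred (U j) 0ℓ
    Contracted = Full ∖[ i , b ]

    contracted? : ∀ j → Decidable (Contracted j)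
    contracted? = ∖-dec Full (λ _ _ → yes tt) i b

    fold∈ : ∀ j v → Contracted j (fold j v)
    fold∈ j v with j Fin.≟ i
    ... | yes refl = ∖⁺ Full (tt , Finite.merge-elim (finite i) (λ _ w → w ≢ b) a≢b (λ _ → id) v)
    ... | no j≢i   = tt , λ { refl → j≢i refl }

    block-fold : ∀ j v → blockOf (e j) (fold j v) ≡ blockOf (e j) v
    block-fold j v with j Fin.≟ i
    ... | yes refl = Finite.merge-elim (finite i) (λ v w → blockOf (e i) w ≡ blockOf (e i) v) a~b (λ _ _ → refl) v
    ... | no _     = refl

    block-injective : ∀ j {v w} → Contracted j v → Contracted j w → blockOf (e j) v ≡ blockOf (e j) w → v ≡ w
    block-injective j v∈ w∈ eq with j Fin.≟ i
    ... | yes refl = injective (proj₂ (∖⁻ Full v∈)) (proj₂ (∖⁻ Full w∈)) eq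
    ... | no j≢i   = injective-≢ j≢i eq

    -- Deleting `b` leaves exactly one point in every block, so `φ` and `ψ` are inverse to each
    -- other between the remaining points and the blocks; `fold` keeps `ψ` away from `b` whatever
    -- representative `nonempty` supplies.
    φ : ∀ j → U j → M e j
    φ j = blockOf (e j)

    ψ : ∀ j → M e j → U j
    ψ j c = fold j (proj₁ (nonempty (e j) c))

    φψ : ∀ j c → φ j (ψ j c) ≡ c
    φψ j c = trans (block-fold j _) (proj₂ (nonempty (e j) c))

    ψφ : ∀ j v → Contracted j v → ψ j (φ j v) ≡ v
    ψφ j v v∈ = block-injective j (fold∈ j _) v∈ (φψ j (φ j v))

    fold-fix : ∀ j {v} → Contracted j v → fold j v ≡ v
    fold-fix j v∈ = block-injective j (fold∈ j _) v∈ (block-fold j _)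

    fold-box : ∀ {P x} → x ∈ Box e P → ∀ j → fold j (x j) ≡ ψ j (P j)
    fold-box x∈P j = block-injective j (fold∈ j _) (fold∈ j _)
      (trans (block-fold j _) (trans (x∈P j) (sym (φψ j _))))

    at-b∈Box : ∀ {P x} → x i ≡ a → x ∈ Box e P → at i b x ∈ Box e P
    at-b∈Box x≡a x∈P j with j Fin.≟ i
    ... | yes refl = trans (sym a~b) (trans (cong (blockOf (e i)) (sym x≡a)) (x∈P i))
    ... | no _     = x∈P j

    upper⁺ : ∀ x → (∀ j → Contracted j (x j)) → x ∈ up S i a b → (λ j → φ j (x j)) ∈ upper S e
    upper⁺ x x∈ (x∈S , both) {y} y∈Box with y i ≟ b
    ... | yes y≡b = S-resp (at-≈ (sym y≡b) λ j j≢i → trans (sym (fold≡ j)) (fold-≢ j≢i))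
        (both (trans (sym (fold≡ i)) (trans (fold-i (y i))
          (trans (cong (Finite.merge (finite i) b a) y≡b) (Finite.merge-≡ (finite i) b a)))))
      where
      fold≡ : ∀ j → fold j (y j) ≡ x j
      fold≡ j = trans (fold-box y∈Box j) (ψφ j _ (x∈ j))
    ... | no y≢b = S-resp (λ j → trans (sym (trans (fold-box y∈Box j) (ψφ j _ (x∈ j)))) (fold-fix j (y∈ j))) x∈S
      where
      y∈ : ∀ j → Contracted j (y j)
      y∈ j = tt , λ { refl → y≢b refl }

    upper⁻ : ∀ P → P ∈ upper S e → (λ j → ψ j (P j)) ∈ up S i a b
    upper⁻ P P∈ = P∈ (λ j → φψ j _) , λ ψ≡a → P∈ (at-b∈Box ψ≡a (λ j → φψ j _))

    lower⁺ : ∀ x → (∀ j → Contracted j (x j)) → x ∈ lo S i a b → (λ j → φ j (x j)) ∈ lower S e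
    lower⁺ x x∈ (inj₁ x∈S)          = x , (λ j → refl) , x∈S
    lower⁺ x x∈ (inj₂ (x≡a , xb∈S)) = at i b x , at-b∈Box x≡a (λ j → refl) , xb∈S

    lower⁻ : ∀ P → P ∈ lower S e → (λ j → ψ j (P j)) ∈ lo S i a b
    lower⁻ P (x , x∈Box , x∈S) = lo-resp S i a b S-resp (fold-box x∈Box) (fold-lo x∈S)

    upper-resp : upper S e Respects _≈_
    upper-resp P≈Q P∈ x∈Q = P∈ λ j → trans (x∈Q j) (sym (P≈Q j))

    lower-resp : lower S e Respects _≈_
    lower-resp P≈Q (x , x∈P , x∈S) = x , (λ j → trans (x∈P j) (P≈Q j)) , x∈S

  module _ {e : GeneralizedPartition U} {i a b} (contracts : Contracts e i a b)
    {S : Pred (Tuple U) 0ℓ} (S-resp : S Respects _≈_) where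
    open Contraction contracts S-resp

    ampleIn-up⇒upper : AmpleIn (Full ∖[ i , b ]) (up S i a b) → Ample (M e) (upper S e)
    ampleIn-up⇒upper ample = ampleIn⇒ample upper-resp
      (AmpleIn-transport contracted? φ ψ (λ j _ _ → fold∈ j _) (λ j c _ → φψ j c) upper⁺ (λ P _ → upper⁻ P) ample)

    ampleIn-lo⇒lower : AmpleIn (Full ∖[ i , b ]) (lo S i a b) → Ample (M e) (lower S e)
    ampleIn-lo⇒lower ample = ampleIn⇒ample lower-resp
      (AmpleIn-transport contracted? φ ψ (λ j _ _ → fold∈ j _) (λ j c _ → φψ j c) lower⁺ (λ P _ → lower⁻ P) ample)

-- Comparison with ampleness in minors and in intervals.

module Comparison {m : ℕ} {U : Fin m → Set} (finite : ∀ i → Finite (U i)) where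
  open Product finite

  module _ {e : GeneralizedPartition U} {i a b} (contracts : Contracts e i a b)
    {S : Pred (Tuple U) 0ℓ} (S-resp : S Respects _≈_) where
    open Contraction contracts S-resp
    private
      -- The blocks form a product other than `U`, in which ampleness has to be extended to
      -- subproducts as well.
      module Me = Product {U = M e} (λ j → Fin-finite (size (e j)))

    upper⇒ampleIn-up : Ample (M e) (upper S e) → AmpleIn (Full ∖[ i , b ]) (up S i a b)
    upper⇒ampleIn-up ample =
      AmpleIn-transport (λ _ _ → yes tt) ψ φ (λ _ _ _ → tt) ψφ (λ P _ → upper⁻ P) upper⁺
        (Me.ample⇒ampleIn upper-resp ample)

    lower⇒ampleIn-lo : Ample (M e) (lower S e) → AmpleIn (Full ∖[ i , b ]) (lo S i a b)
    lower⇒ampleIn-lo ample =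
      AmpleIn-transport (λ _ _ → yes tt) ψ φ (λ _ _ _ → tt) ψφ (λ P _ → lower⁻ P) lower⁺
        (Me.ample⇒ampleIn lower-resp ample)

  -- The bijection with `Fin 2` names the two merged points; which of them is called `b` is
  -- arbitrary.
  elementary⇒contracts : ∀ e → Elementary e → ∃ λ i → ∃ λ a → ∃ λ b → Contracts e i a b
  elementary⇒contracts e (i , c , two , one , one-≢) = i , a , b , record
    { a≢b         = λ a≡b → contradiction (from-injective (block-≡ {α = e i} a≡b)) λ ()
    ; a~b         = trans a∈ (sym b∈)
    ; injective   = inj
    ; injective-≢ = λ j≢i eq → size-one⁻ {α = e _} (one-≢ _ j≢i _) eq refl
    }
    where
    open Inverse two

    a = proj₁ (from zero)
    b = proj₁ (from (suc zero))
    a∈ = proj₂ (from zero)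
    b∈ = proj₂ (from (suc zero))

    from-injective : ∀ {k l} → from k ≡ from l → k ≡ l
    from-injective eq = trans (sym (strictlyInverseˡ _)) (trans (cong to eq) (strictlyInverseˡ _))

    only : ∀ v → Block (e i) c v → v ≢ b → v ≡ a
    only v v∈ v≢b with to (v , v∈) | strictlyInverseʳ (v , v∈)
    ... | zero     | eq = cong proj₁ (sym eq)
    ... | suc zero | eq = contradiction (cong proj₁ (sym eq)) v≢b

    inj : ∀ {v w} → v ≢ b → w ≢ b → blockOf (e i) v ≡ blockOf (e i) w → v ≡ w
    inj {v} {w} v≢b w≢b eq with blockOf (e i) w Fin.≟ c
    ... | yes w∈ = trans (only v (trans eq w∈) v≢b) (sym (only w w∈ w≢b))
    ... | no w∉  = size-one⁻ {α = e i} (one _ w∉) eq refl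

  module _ {i : Fin m} {a b : U i} (a≢b : a ≢ b) where
    open FoldMap a b
    open Finite (finite i) using (merge-≡; merge-≢)

    private
      module K j = Kernel (finite j) (_≟_ {j}) (fold j)

      fold-a : fold i a ≡ a
      fold-a = trans (fold-i a) (merge-≢ a≢b)

      fold-b : fold i b ≡ a
      fold-b = trans (fold-i b) (merge-≡ b a)

      fold-fix : ∀ {v} → v ≢ b → fold i v ≡ v
      fold-fix v≢b = trans (fold-i _) (merge-≢ v≢b)

    contraction : GeneralizedPartition U
    contraction j = K.kernel j

    contraction-contracts : Contracts contraction i a b
    contraction-contracts = record
      { a≢b         = a≢b
      ; a~b         = K.kernel⁺ i (trans fold-a (sym fold-b))
      ; injective   = λ v≢b w≢b eq → trans (sym (fold-fix v≢b)) (trans (K.kernel⁻ i eq) (fold-fix w≢b))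
      ; injective-≢ = λ {j} j≢i eq → trans (sym (fold-≢ j≢i)) (trans (K.kernel⁻ j eq) (fold-≢ j≢i))
      }

    contraction-elementary : Elementary contraction
    contraction-elementary = i , blockOf (contraction i) a ,
      size-two _≟_ {α = contraction i} a≢b refl (sym a~b) pair ,
      (λ c c≢a → size-one {α = contraction i} λ v w v∈ w∈ →
        injective (not-b c≢a v∈) (not-b c≢a w∈) (trans v∈ (sym w∈))) ,
      λ j j≢i c → size-one {α = contraction j} λ v w v∈ w∈ → injective-≢ j≢i (trans v∈ (sym w∈))
      where
      open Contracts contraction-contracts hiding (a≢b)

      pair : ∀ v → blockOf (contraction i) v ≡ blockOf (contraction i) a → v ≢ a → v ≡ b
      pair v eq v≢a = decidable-stable (v ≟ b) λ v≢b → v≢a (injective v≢b a≢b eq)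

      not-b : ∀ {c v} → c ≢ blockOf (contraction i) a → blockOf (contraction i) v ≡ c → v ≢ b
      not-b c≢a v∈ refl = c≢a (trans (sym v∈) (sym a~b))

  module _ (u v : Tuple U) {S : Pred (Tuple U) 0ℓ} (S-resp : S Respects _≈_) where

    private
      segment? : ∀ i → Decidable (Segment u v i)
      segment? i w = (w ≟ u i) ⊎-dec (w ≟ v i)

      in-segment : ∀ {i} (w : Interval u v i) → Segment u v i (value w)
      in-segment (w , [ w∈ ]) = recompute (segment? _ w) w∈

      Interval-finite : ∀ i → Finite (Interval u v i)
      Interval-finite i = record
        { _≟_      = Refinement._≟_ _≟_
        ; elements = (u i , [ inj₁ refl ]) ∷ (v i , [ inj₂ refl ]) ∷ []
        ; complete = λ w → [ (λ { refl → here refl }) , (λ { refl → there (here refl) }) ]′ (in-segment w)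
        }

      inject : ∀ i → U i → Interval u v i
      inject i w with segment? i w
      ... | yes w∈ = w , [ w∈ ]
      -- An arbitrary default: `inject` matters only on the segment.
      ... | no _   = u i , [ inj₁ refl ]

      value-inject : ∀ i w → Segment u v i w → value (inject i w) ≡ w
      value-inject i w w∈ with segment? i w
      ... | yes _  = refl
      ... | no w∉  = contradiction w∈ w∉

      restrict-resp : restrict S u v Respects _≈_
      restrict-resp x≈y = S-resp λ i → cong value (x≈y i)

    ampleIn⇒interval : AmpleIn (Segment u v) S → Ample (Interval u v) (restrict S u v)
    ampleIn⇒interval ample = ampleIn⇒ample restrict-resp
      (AmpleIn-transport segment? inject (λ _ → value) (λ _ w _ → in-segment w)
        (λ i w _ → Refinement.value-injective (value-inject i (value w) (in-segment w)))
        (λ x x∈ → S-resp λ i → sym (value-inject i (x i) (x∈ i))) (λ _ _ → id) ample)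

    interval⇒ampleIn : Ample (Interval u v) (restrict S u v) → AmpleIn (Segment u v) S
    interval⇒ampleIn ample =
      AmpleIn-transport (λ _ _ → yes tt) (λ _ → value) inject (λ _ _ _ → tt) value-inject
        (λ _ _ → id) (λ x x∈ → S-resp λ i → sym (value-inject i (x i) (x∈ i)))
        (Product.ample⇒ampleIn Interval-finite restrict-resp ample)

  -- Geodesics and isometricity.

  path-length : ∀ {S k u v} → Path S k u v → dist u v ≤ k
  path-length (stop _ u≈v) = ℕ.≤-reflexive (hamming-≈ (λ i → _≟_ {i}) _ _ u≈v)
  path-length {u = u} {v} (step {w = w} _ adj p) = ℕ.≤-trans (hamming-triangle (λ i → _≟_ {i}) u v w)
    (subst (λ d → d + dist w v ≤ _) (sym (hamming-adjacent (λ i → _≟_ {i}) u w adj)) (s≤s (path-length p)))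

  -- A switch at one differing coordinate supplies an edge between `u` and `v`, leaving two shorter
  -- distances to bridge.
  geodesic : ∀ n Y {S} → S Respects _≈_ → Switching Y S → ∀ u v → dist u v < n →
    u ∈ S → v ∈ S → (∀ j → Y j (u j)) → (∀ j → Y j (v j)) → Path S (dist u v) u v
  geodesic (suc n) Y {S} S-resp switching u v (s≤s d≤n) u∈S v∈S u∈Y v∈Y
    with Fin.any? (λ i → ¬? (u i ≟ v i))
  ... | no equal = subst (λ k → Path S k u v) (sym (hamming-≈ (λ i → _≟_ {i}) u v u≈v)) (stop u∈S u≈v)
    where
    u≈v : u ≈ v
    u≈v i = decidable-stable (u i ≟ v i) λ u≢v → equal (i , u≢v)
  ... | yes (i , u≢v) = connect (switching u∈S v∈S u∈Y v∈Y i u≢v)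
    where
    connect : (∃ λ w → Between u v w × at i (u i) w ∈ S × at i (v i) w ∈ S) → Path S (dist u v) u v
    connect (w , btw , w₁∈S , w₂∈S) = subst (λ k → Path S k u v) (sym total)
      (path-++ S-resp
        (geodesic n Y S-resp switching u w₁ (ℕ.<-≤-trans (dist-<ʳ {u} {v} {w₁} btw₁ (i , λ eq → u≢v (trans (sym (at-≡ i)) eq))) d≤n)
          u∈S w₁∈S u∈Y (between-Y btw₁))
        (step w₁∈S adj
          (geodesic n Y S-resp switching w₂ v (ℕ.<-≤-trans (dist-<ˡ {u} {v} {w₂} btw₂ (i , λ eq → u≢v (trans eq (at-≡ i)))) d≤n)
            w₂∈S v∈S (between-Y btw₂) v∈Y)))
      where
      w₁ w₂ : Tuple U
      w₁ = at i (u i) w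
      w₂ = at i (v i) w

      btw₁ : Between u v w₁
      btw₁ j with j Fin.≟ i
      ... | yes refl = inj₁ refl
      ... | no _     = btw j

      btw₂ : Between u v w₂
      btw₂ j with j Fin.≟ i
      ... | yes refl = inj₂ refl
      ... | no _     = btw j

      btw₁₂ : Between w₁ v w₂
      btw₁₂ j with j Fin.≟ i
      ... | yes refl = inj₂ refl
      ... | no _     = inj₁ refl

      between-Y : ∀ {w} → Between u v w → ∀ j → Y j (w j)
      between-Y btw j = [ (λ eq → subst (Y j) (sym eq) (u∈Y j)) , (λ eq → subst (Y j) (sym eq) (v∈Y j)) ]′ (btw j)

      adj : Adjacent w₁ w₂
      adj = i , (λ eq → u≢v (trans (sym (at-≡ i)) (trans eq (at-≡ i)))) , λ j j≢i → trans (at-≢ j≢i) (sym (at-≢ j≢i))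

      total : dist u v ≡ dist u w₁ + suc (dist w₂ v)
      total = trans (hamming-between (λ i → _≟_ {i}) u v w₁ btw₁) (cong (dist u w₁ +_)
        (trans (hamming-between (λ i → _≟_ {i}) w₁ v w₂ btw₁₂)
          (cong (_+ dist w₂ v) (hamming-adjacent (λ i → _≟_ {i}) w₁ w₂ adj))))

  record Crossing (S : Pred (Tuple U) 0ℓ) (x y : Tuple U) (i : Fin m) : Set where
    field
      before after : Tuple U
      before∈S     : before ∈ S
      before≡      : before i ≡ x i
      after≡       : after i ≡ y i
      agree        : ∀ j → j ≢ i → before j ≡ after j
      before-between : Between x y before
      after-between  : Between x y after
      rest         : Path S (dist after y) after y

  -- The bound on `k` leaves no slack: each step must give its coordinate the value of `y`, so
  -- coordinate `i` jumps directly from `x i` to `y i`.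
  crossing : ∀ {S} → S Respects _≈_ → ∀ {k x y} → Path S k x y → k ≤ dist x y → ∀ i → x i ≢ y i → Crossing S x y i
  crossing S-resp (stop _ x≈y) _ i x≢y = contradiction (x≈y i) x≢y
  crossing {S} S-resp {suc k} {x} {y} (step {w = x′} x∈S (j , x≢x′ , agree) p) k<d i x≢y = cross (j Fin.≟ i)
    where
    d≤1+d′ : dist x y ≤ suc (dist x′ y)
    d≤1+d′ = subst (λ d → dist x y ≤ d + dist x′ y)
      (hamming-adjacent (λ i → _≟_ {i}) x x′ (j , x≢x′ , agree)) (hamming-triangle (λ i → _≟_ {i}) x y x′)

    k≤d′ : k ≤ dist x′ y
    k≤d′ = ℕ.≤-pred (ℕ.≤-trans k<d d≤1+d′)

    -- Otherwise every coordinate in which `x′` agrees with `y` was already right in `x`, and the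
    -- step has brought nothing nearer.
    x′≡y : x′ j ≡ y j
    x′≡y = decidable-stable (x′ j ≟ y j) λ x′≢y →
      ℕ.<⇒≱ (ℕ.<-≤-trans (s≤s (path-length p)) k<d) (hamming-mono (λ i → _≟_ {i}) x x′ y (closer x′≢y))
      where
      closer : x′ j ≢ y j → ∀ l → x′ l ≡ y l → x l ≡ y l
      closer x′≢y l eq with l Fin.≟ j
      ... | yes refl = contradiction eq x′≢y
      ... | no l≢j   = trans (agree l l≢j) eq

    x′-between : Between x y x′
    x′-between l with l Fin.≟ j
    ... | yes refl = inj₂ x′≡y
    ... | no l≢j   = inj₁ (sym (agree l l≢j))

    cross : Dec (j ≡ i) → Crossing S x y i
    cross (yes refl) = record
      { before = x ; after = x′ ; before∈S = x∈S ; before≡ = refl ; after≡ = x′≡y ; agree = agree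
      ; before-between = λ _ → inj₁ refl ; after-between = x′-between
      ; rest = subst (λ k → Path S k x′ y) (ℕ.≤-antisym k≤d′ (path-length p)) p }
    cross (no j≢i) = record
      { Crossing c
      ; before≡        = trans (Crossing.before≡ c) (sym (agree i (j≢i ∘ sym)))
      ; before-between = widen (Crossing.before-between c)
      ; after-between  = widen (Crossing.after-between c) }
      where
      c : Crossing S x′ y i
      c = crossing S-resp p k≤d′ i λ x′≡y → x≢y (trans (agree i (j≢i ∘ sym)) x′≡y)

      widen : ∀ {w} → Between x′ y w → Between x y w
      widen btw l = [ (λ eq → [ inj₁ ∘ trans eq , inj₂ ∘ trans eq ]′ (x′-between l)) , inj₂ ]′ (btw l)

  geodesics⇒switching : ∀ {S} → S Respects _≈_ → (∀ u v → u ∈ S → v ∈ S → Path S (dist u v) u v) → Switching Full S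
  geodesics⇒switching {S} S-resp path {x} {y} x∈S y∈S _ _ i x≢y =
    before , before-between ,
    S-resp (≈-sym (at-self (sym before≡))) before∈S ,
    S-resp (≈-sym (at-≈ (sym after≡) agree)) (path-start rest)
    where open Crossing (crossing S-resp (path x y x∈S y∈S) ℕ.≤-refl i x≢y)

  -- The first step of a path u → u′ → ⋯ → v is shortcut inside up S i (u i) (u′ i),
  -- which contains u and the point where a geodesic from u′ reaches v i.
  straighten : ∀ {S} → S Respects _≈_ → UpperAmple Full S → ∀ {k u v} → Path S k u v → Path S (dist u v) u v
  straighten {S} S-resp upper {u = u} {v} (stop u∈S u≈v) =
    subst (λ k → Path S k u v) (sym (hamming-≈ (λ i → _≟_ {i}) u v u≈v)) (stop u∈S u≈v)
  straighten {S} S-resp upper {u = u} {v} (step {w = u′} u∈S (i , u≢u′ , agree) p) = shorten (u′ i ≟ v i)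
    where
    direct : Path S (dist u′ v) u′ v
    direct = straighten S-resp upper p

    shorten : Dec (u′ i ≡ v i) → Path S (dist u v) u v
    shorten (yes u′≡v) = subst (λ k → Path S k u v) (sym total) (step u∈S (i , u≢u′ , agree) direct)
      where
      btw : Between u v u′
      btw j with j Fin.≟ i
      ... | yes refl = inj₂ u′≡v
      ... | no j≢i   = inj₁ (sym (agree j j≢i))

      total : dist u v ≡ suc (dist u′ v)
      total = trans (hamming-between (λ i → _≟_ {i}) u v u′ btw)
        (cong (_+ dist u′ v) (hamming-adjacent (λ i → _≟_ {i}) u u′ (i , u≢u′ , agree)))
    shorten (no u′≢v) = subst (λ k → Path S k u v) (sym (hamming-between (λ i → _≟_ {i}) u v C.after btw))
      (path-++ S-resp (path-map proj₁ to-after) C.rest)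
      where
      module C = Crossing (crossing S-resp direct ℕ.≤-refl i u′≢v)

      btw : Between u v C.after
      btw j with j Fin.≟ i
      ... | yes refl = inj₂ C.after≡
      ... | no j≢i   = Sum.map₁ (λ eq → trans eq (sym (agree j j≢i))) (C.after-between j)

      u∈up : u ∈ up S i (u i) (u′ i)
      u∈up = u∈S , λ _ → S-resp (≈-sym (at-≈ refl agree)) (path-start p)

      -- The point preceding `after` on the geodesic is `after` with the value `u′ i` in coordinate
      -- `i`.
      after∈up : C.after ∈ up S i (u i) (u′ i)
      after∈up = path-start C.rest , λ _ →
        S-resp (≈-sym (at-≈ (sym C.before≡) λ j j≢i → sym (C.agree j j≢i))) C.before∈S

      avoids : ∀ {x : Tuple U} {c} → x i ≢ c → ∀ j → (Full ∖[ i , c ]) j (x j)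
      avoids x≢c j = tt , λ { refl → x≢c refl }

      to-after : Path (up S i (u i) (u′ i)) (dist u C.after) u C.after
      to-after = geodesic _ (Full ∖[ i , u′ i ]) up-respects
        (AmpleIn⇒Switching up-respects (upper i u≢u′ tt tt)) u C.after ℕ.≤-refl u∈up after∈up
        (avoids {u} u≢u′) (avoids {C.after} λ eq → u′≢v (trans (sym eq) C.after≡))
        where up-respects = up-resp S i (u i) (u′ i) S-resp

-- The equivalences.

theorem3 : (m : ℕ) (U : Fin m → Set) (card : Fin m → ℕ)
    (nonempty : ∀ i → 1 ≤ card i)
    (finite : ∀ i → U i ↔ Fin (card i))
    (S : Pred (Tuple U) 0ℓ) → Decidable S → S Respects _≈_ →
      -- (1) ⇔ (2); if every U i is a singleton, there is no elementary
      -- minor-subproduct at all, so (2) fails although S is ample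
      ((∃[ i ] 2 ≤ card i) →
        Ample U S ⇔
          (Isometric (λ i → finite⇒≟ (finite i)) S
            × Σ (GeneralizedPartition U) λ e →
                Elementary e × Ample (M e) (upper S e) × Ample (M e) (lower S e)))
      -- (1) ⇔ (3)
    × (Ample U S ⇔
        (Connected S
          × ((e : GeneralizedPartition U) → Elementary e → Ample (M e) (upper S e))))
      -- (1) ⇔ (4)
    × (Ample U S ⇔
        (∀ u v → u ∈ S → v ∈ S → Ample (Interval u v) (restrict S u v)))
theorem3 m U card nonempty finite S S? S-resp =
  (λ (i , two) → mk⇔ (1⇒2 i two) 2⇒1) , mk⇔ 1⇒3 3⇒1 , mk⇔ 1⇒4 4⇒1
  where
  U-finite : ∀ i → Finite (U i)
  U-finite i = record
    { _≟_      = finite⇒≟ (finite i)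
    ; elements = map (Inverse.from (finite i)) (allFin (card i))
    ; complete = λ v → subst (_∈ˡ map (Inverse.from (finite i)) (allFin (card i)))
                   (Inverse.strictlyInverseʳ (finite i) v) (∈-map⁺ (Inverse.from (finite i)) (∈-allFin _))
    }

  open Product U-finite
  open Comparison U-finite

  ≟-U : ∀ i → DecidableEquality (U i)
  ≟-U i = finite⇒≟ (finite i)

  distance≡ : ∀ u v → distance ≟-U u v ≡ dist u v
  distance≡ = distance≡hamming ≟-U

  within : Ample U S → AmpleIn Full S
  within = ample⇒ampleIn S-resp

  whole : AmpleIn Full S → Ample U S
  whole = ampleIn⇒ample S-resp

  isometric : Ample U S → ∀ u v → u ∈ S → v ∈ S → Path S (dist u v) u v
  isometric ample u v u∈S v∈S =
    geodesic _ Full S-resp (AmpleIn⇒Switching S-resp (within ample)) u v ℕ.≤-refl u∈S v∈S (λ _ → tt) (λ _ → tt)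

  upper-ample : Ample U S → ∀ e → Elementary e → Ample (M e) (upper S e)
  upper-ample ample e elementary =
    let i , a , b , contracts = elementary⇒contracts e elementary
    in ampleIn-up⇒upper contracts S-resp (AmpleIn-up S-resp (Contracts.a≢b contracts) tt (within ample))

  1⇒2 : ∀ i → 2 ≤ card i → Ample U S → Isometric ≟-U S × Σ (GeneralizedPartition U) λ e →
    Elementary e × Ample (M e) (upper S e) × Ample (M e) (lower S e)
  1⇒2 i two ample =
    (λ u v u∈S v∈S → subst (λ k → Path S k u v) (sym (distance≡ u v)) (isometric ample u v u∈S v∈S)) ,
    contraction a≢b , contraction-elementary a≢b ,
    upper-ample ample (contraction a≢b) (contraction-elementary a≢b) ,
    ampleIn-lo⇒lower (contraction-contracts a≢b) S-resp (AmpleIn-lo S-resp a≢b tt (within ample))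
    where
    k₀ k₁ : Fin (card i)
    k₀ = Fin.fromℕ< (ℕ.≤-trans (s≤s z≤n) two)
    k₁ = Fin.fromℕ< two

    a≢b : Inverse.from (finite i) k₀ ≢ Inverse.from (finite i) k₁
    a≢b eq = contradiction (Fin.fromℕ<-injective 0 1 _ _
      (trans (sym (Inverse.strictlyInverseˡ (finite i) k₀))
        (trans (cong (Inverse.to (finite i)) eq) (Inverse.strictlyInverseˡ (finite i) k₁)))) λ ()

  2⇒1 : Isometric ≟-U S × Σ (GeneralizedPartition U) (λ e →
    Elementary e × Ample (M e) (upper S e) × Ample (M e) (lower S e)) → Ample U S
  2⇒1 (iso , e , elementary , ample-upper , ample-lower) =
    let i , a , b , contracts = elementary⇒contracts e elementary
    in whole (contraction⇒ampleIn S-resp S?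
         (geodesics⇒switching S-resp λ u v u∈S v∈S → subst (λ k → Path S k u v) (distance≡ u v) (iso u v u∈S v∈S))
         (Contracts.a≢b contracts) tt tt
         (upper⇒ampleIn-up contracts S-resp ample-upper) (lower⇒ampleIn-lo contracts S-resp ample-lower))

  1⇒3 : Ample U S → Connected S × (∀ e → Elementary e → Ample (M e) (upper S e))
  1⇒3 ample = (λ u v u∈S v∈S → dist u v , isometric ample u v u∈S v∈S) , upper-ample ample

  3⇒1 : Connected S × (∀ e → Elementary e → Ample (M e) (upper S e)) → Ample U S
  3⇒1 (connected , ample-upper) = whole (upperAmple⇒ampleIn S-resp S?
    (geodesics⇒switching S-resp λ u v u∈S v∈S → straighten S-resp upper-full (proj₂ (connected u v u∈S v∈S)))
    upper-full)
    where
    -- Serves twice: to straighten paths into geodesics and to build the copies.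
    upper-full : UpperAmple Full S
    upper-full i a≢b _ _ = upper⇒ampleIn-up (contraction-contracts a≢b) S-resp
      (ample-upper (contraction a≢b) (contraction-elementary a≢b))

  1⇒4 : Ample U S → ∀ u v → u ∈ S → v ∈ S → Ample (Interval u v) (restrict S u v)
  1⇒4 ample u v _ _ = ampleIn⇒interval u v S-resp (AmpleIn-⊆ (λ _ _ _ → tt) (within ample))

  4⇒1 : (∀ u v → u ∈ S → v ∈ S → Ample (Interval u v) (restrict S u v)) → Ample U S
  4⇒1 ample = whole (locallyAmple⇒ampleIn _ Full (λ _ _ → yes tt) ℕ.≤-refl S-resp S?
    λ u v u∈S v∈S _ _ → interval⇒ampleIn u v S-resp (ample u v u∈S v∈S))
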